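{- There exists an oriented matroid of rank $3$ on $13$ points whose realization space is connected and non-irreducible.
   Context: Let $E=\{1,\dots,n\}$ and let $r\ge 1$ be an integer. An oriented matroid $\mathcal{M}=\mathcal{M}(E,\chi)$ of rank $r$ on $E$ (that is, on $n$ points) is defined by a map $\chi:E^r\to\{ -1,0,+1\}$, called its chirotope, such that: (1) $\chi$ is not identically zero; (2) $\chi$ is alternating: $\chi(i_{\sigma(1)},\dots,i_{\sigma(r)})=\operatorname{sgn}(\sigma)\,\chi(i_1,\dots,i_r)$ for all $i_1,\dots,i_r\in E$ and all permutations $\sigma$ of $\{1,\dots,r\}$; (3) for all $i_1,\dots,i_r,j_1,\dots,j_r\in E$ such that $\chi(j_k,i_2,\dots,i_r)\cdot\chi(j_1,\dots,j_{k-1},i_1,j_{k+1},\dots,j_r)\ge 0$ for every $k=1,\dots,r$, we have $\chi(i_1,\dots,i_r)\cdot\chi(j_1,\dots,j_r)\ge 0$. For a real $r\times n$ matrix $X=(x_1,\dots,x_n)$ of rank $r$ with columns $x_i\in\mathbb{R}^r$, its chirotope is $\chi_X:E^r\to\{ -1,0,+1\}$, $\chi_X(i_1,\dots,i_r)=\operatorname{sgn}\det(x_{i_1},\dots,x_{i_r})$. A realization of $\mathcal{M}(E,\chi)$ is a real $r\times n$ matrix $X$ of rank $r$ with $\chi_X=\chi$ or $\chi_X=-\chi$. Two realizations $X,X'$ are linearly equivalent if $X'=AX$ for some $A\in GL(r,\mathbb{R})$. The realization space $\mathcal{R}(\mathcal{M})$ is the set of all linear equivalence classes of realizations of $\mathcal{M}$,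 with the quotient topology induced from $\mathbb{R}^{rn}$ (the set of realizations carrying the subspace topology). Via $X\mapsto$ row space of $X$, $\mathcal{R}(\mathcal{M})$ is a semialgebraic subset of the real Grassmannian of $r$-dimensional subspaces of $\mathbb{R}^n$. Connectedness refers to the (Euclidean) quotient topology above. A nonempty semialgebraic set is irreducible if it is not the union of two proper subsets that are relatively closed in the Zariski topology (equivalently, its Zariski closure is irreducible); non-irreducible means not irreducible. -}

module Defs where

open import Algebra.Bundles using (CommutativeRing; Semiring)
import Algebra.Definitions.RawSemiring as RawSemiringDefinitions
open import Data.Bool.Base using (if_then_else_)
open import Data.Fin.Base using (Fin; zero; suc; toℕ; fromℕ<; punchIn)
import Data.Fin.Properties as Fin
open import Data.Fin.Permutation using (Permutation′; _⟨$⟩ʳ_)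
open import Data.List.Base using (allFin; cartesianProduct; foldr)
open import Data.Nat.Base as ℕ using (ℕ; NonZero)
open import Data.Product.Base using (Σ; ∃; ∃-syntax; _×_; _,_; proj₂)
open import Data.Sum.Base using (_⊎_)
open import Data.Vec.Base using (Vec; lookup; tabulate; _[_]≔_)
open import Function.Bundles using (_⇔_)
open import Level using (0ℓ)
open import Relation.Binary.Core using (Rel)
open import Relation.Binary.Definitions using (_Respects_; tri<; tri≈; tri>)
open import Relation.Binary.PropositionalEquality.Core using (_≡_; _≢_)
open import Relation.Binary.Structures using (IsStrictTotalOrder)
open import Relation.Nullary.Decidable.Core using (does; _×-dec_)
open import Relation.Nullary.Negation.Core using (¬_)
open import Relation.Unary using (Pred; Satisfiable; Universal; Empty; _∪_; _∩_)

-- The standard library has no real numbers.  They are taken to be an arbitrary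
-- Dedekind-complete ordered field, a structure that is unique up to
-- isomorphism.  Trichotomy is part of `IsStrictTotalOrder`, so the order is the
-- classical one, and the supremum axiom ranges over arbitrary predicates.
record CompleteOrderedField : Set₁ where
  infix 4 _<_ _≤_
  field
    commutativeRing : CommutativeRing 0ℓ 0ℓ

  open CommutativeRing commutativeRing public

  field
    _<_                : Rel Carrier 0ℓ
    isStrictTotalOrder : IsStrictTotalOrder _≈_ _<_
    0≉1                : 0# ≉ 1#
    *-inverse          : ∀ x → x ≉ 0# → ∃[ y ] x * y ≈ 1#
    +-monoˡ-<          : ∀ x y z → x < y → x + z < y + z
    *-positive         : ∀ x y → 0# < x → 0# < y → 0# < x * y

  _≤_ : Rel Carrier 0ℓ
  x ≤ y = ¬ y < x

  UpperBound : Pred Carrier 0ℓ → Pred Carrier 0ℓ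
  UpperBound P u = ∀ x → P x → x ≤ u

  field
    supremum : (P : Pred Carrier 0ℓ) → Satisfiable P → Satisfiable (UpperBound P) →
               ∃[ s ] UpperBound P s × (∀ u → UpperBound P u → s ≤ u)

  open IsStrictTotalOrder isStrictTotalOrder public using (compare)
  open RawSemiringDefinitions (Semiring.rawSemiring semiring) public
    using (sum; _^_)

------------------------------------------------------------------------
-- Oriented matroids

data Sgn : Set where
  -1ˢ 0ˢ +1ˢ : Sgn

infix  8 -ˢ_
infixl 7 _*ˢ_

-ˢ_ : Sgn → Sgn
-ˢ -1ˢ = +1ˢ
-ˢ 0ˢ  = 0ˢ
-ˢ +1ˢ = -1ˢ

_*ˢ_ : Sgn → Sgn → Sgn
-1ˢ *ˢ t = -ˢ t
0ˢ  *ˢ t = 0ˢ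
+1ˢ *ˢ t = t

NonNegative : Pred Sgn 0ℓ
NonNegative s = s ≢ -1ˢ

-- (-1) to the number of inversions of σ.
sgnPerm : ∀ {r} → Permutation′ r → Sgn
sgnPerm {r} σ = foldr (λ p s → factor p *ˢ s) +1ˢ (cartesianProduct (allFin r) (allFin r))
  where
  factor : Fin r × Fin r → Sgn
  factor (a , b) =
    if does ((a Fin.<? b) ×-dec ((σ ⟨$⟩ʳ b) Fin.<? (σ ⟨$⟩ʳ a))) then -1ˢ else +1ˢ

first : ∀ {r} .{{_ : NonZero r}} → Fin r
first {r} = fromℕ< (ℕ.>-nonZero⁻¹ r)

-- E = {1,…,n} is `Fin n`, and Eʳ is `Vec (Fin n) r`.
record OrientedMatroid (r n : ℕ) .{{_ : NonZero r}} : Set where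
  field
    χ : Vec (Fin n) r → Sgn

    nontrivial  : ∃[ i ] χ i ≢ 0ˢ

    alternating : ∀ (i : Vec (Fin n) r) (σ : Permutation′ r) →
                  χ (tabulate (λ k → lookup i (σ ⟨$⟩ʳ k))) ≡ sgnPerm σ *ˢ χ i

    exchange    : ∀ (i j : Vec (Fin n) r) →
                  (∀ k → NonNegative (χ (i [ first ]≔ lookup j k) *ˢ
                                      χ (j [ k ]≔ lookup i first))) →
                  NonNegative (χ i *ˢ χ j)

------------------------------------------------------------------------
-- Matrices

module Matrices (ℝ : CompleteOrderedField) where
  open CompleteOrderedField ℝ hiding (zero)

  Matrix : ℕ → ℕ → Set
  Matrix m n = Fin m → Fin n → Carrier

  infix  4 _≋_
  infixl 7 _⊡_

  _≋_ : ∀ {m n} → Rel (Matrix m n) 0ℓ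
  X ≋ Y = ∀ a b → X a b ≈ Y a b

  _⊡_ : ∀ {l m n} → Matrix l m → Matrix m n → Matrix l n
  (X ⊡ Y) a c = sum (λ b → X a b * Y b c)

  I : ∀ {m} → Matrix m m
  I a b = if does (a Fin.≟ b) then 1# else 0#

  Invertible : ∀ {m} → Pred (Matrix m m) 0ℓ
  Invertible A = ∃[ B ] (A ⊡ B ≋ I) × (B ⊡ A ≋ I)

  -- Laplace expansion along the first row.
  det : ∀ {m} → Matrix m m → Carrier
  det {ℕ.zero}  M = 1#
  det {ℕ.suc m} M =
    sum (λ k → (- 1#) ^ toℕ k * (M zero k * det (λ a b → M (suc a) (punchIn k b))))

  -- An r × n matrix has rank r iff its r rows are linearly independent.
  HasFullRowRank : ∀ {r n} → Pred (Matrix r n) 0ℓ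
  HasFullRowRank {r} X =
    ∀ (c : Fin r → Carrier) → (∀ b → sum (λ a → c a * X a b) ≈ 0#) → ∀ a → c a ≈ 0#

  sgn : Carrier → Sgn
  sgn x with compare x 0#
  ... | tri< _ _ _ = -1ˢ
  ... | tri≈ _ _ _ = 0ˢ
  ... | tri> _ _ _ = +1ˢ

  minor : ∀ {r n} → Matrix r n → Vec (Fin n) r → Carrier
  minor X i = det (λ a b → X a (lookup i b))

  chirotope : ∀ {r n} → Matrix r n → Vec (Fin n) r → Sgn
  chirotope X i = sgn (minor X i)

  -- Homogeneous polynomials of given degree with variables in V.
  data Form (V : Set) : ℕ → Set where
    con  : Carrier → Form V 0
    var  : V → Form V 1
    _⊕_  : ∀ {d} → Form V d → Form V d → Form V d
    _⊗_  : ∀ {d e} → Form V d → Form V e → Form V (d ℕ.+ e)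

  eval : ∀ {V d} → Form V d → (V → Carrier) → Carrier
  eval (con c) ρ = c
  eval (var v) ρ = ρ v
  eval (F ⊕ G) ρ = eval F ρ + eval G ρ
  eval (F ⊗ G) ρ = eval F ρ * eval G ρ

------------------------------------------------------------------------
-- The realization space

-- The realization space is `Realization` modulo the relation `_∼_`.
module RealizationSpace (ℝ : CompleteOrderedField)
                        {r n : ℕ} .{{_ : NonZero r}} (M : OrientedMatroid r n) where
  open CompleteOrderedField ℝ hiding (zero)
  open Matrices ℝ
  open OrientedMatroid M

  record Realization : Set where
    field
      matrix   : Matrix r n
      fullRank : HasFullRowRank matrix
      realizes : (∀ i → chirotope matrix i ≡ χ i) ⊎ (∀ i → chirotope matrix i ≡ -ˢ χ i)

  open Realization public

  infix 4 _∼_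

  _∼_ : Rel Realization 0ℓ
  X ∼ X′ = ∃[ A ] Invertible A × (matrix X′ ≋ A ⊡ matrix X)

  Close : Carrier → Rel Realization 0ℓ
  Close ε X Y = ∀ a b → (- ε < matrix X a b - matrix Y a b) × (matrix X a b - matrix Y a b < ε)

  -- A subset of the quotient is a `_∼_`-invariant predicate; it is open in the
  -- quotient topology iff that predicate, its preimage under the quotient map,
  -- is open in the subspace topology of ℝ^(r × n).
  IsOpen : Pred Realization 0ℓ → Set
  IsOpen U = (U Respects _∼_) ×
             (∀ X → U X → ∃[ ε ] (0# < ε) × (∀ Y → Close ε X Y → U Y))

  Connected : Set₁
  Connected =
    ¬ (∃[ U ] ∃[ V ] IsOpen U × IsOpen V × Satisfiable U × Satisfiable V ×
                     Universal (U ∪ V) × Empty (U ∩ V))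

  -- The relative Zariski topology of the realization space in the Grassmannian,
  -- embedded in projective space by the Plücker coordinates `minor X`: closed
  -- sets are the common zero sets of homogeneous polynomials in them.  Using the
  -- coordinates of all r-tuples rather than only of increasing ones adds no
  -- closed sets, as the additional ones are zero or ± an increasing one.  Such a
  -- set is `_∼_`-invariant, because A ∈ GL(r) scales all coordinates by det A.
  ZariskiClosed : Pred Realization 0ℓ → Set₁
  ZariskiClosed Z =
    ∃[ K ] Σ (K → ∃ (Form (Vec (Fin n) r))) λ F →
      ∀ X → Z X ⇔ (∀ k → eval (proj₂ (F k)) (minor (matrix X)) ≈ 0#)

  Proper : Pred Realization 0ℓ → Set
  Proper Z = ¬ Universal Z

  -- An empty space satisfies this vacuously (it has no proper subsets), so a
  -- space that is not irreducible is in particular nonempty.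
  Irreducible : Set₁
  Irreducible =
    ¬ (∃[ Z ] ∃[ W ] ZariskiClosed Z × ZariskiClosed W × Proper Z × Proper W ×
                     Universal (Z ∪ W))

{-# OPTIONS --safe #-}
module Submission where

-- In the affine plane take the points 0 = (0,0), 1 = (1,0), 2 = (0,1),
-- 3 = (1,1) and a free point 4 = (u/w , v/w), and construct further points as
-- intersections of lines:
--   5 = 34 ∩ 02,  6 = 24 ∩ 13,  7 = 04 ∩ 13,  8 = 14 ∩ 02,  9 = 02 ∩ 13,
--   10 = 68 ∩ 15,  11 = 57 ∩ 06,  12 = (2,11) ∩ (3,10).
-- Then 4, 9 and 12 are collinear iff
--   u (w - u) (2u - w) (u² - uw + w² - vw) = 0.
-- Here u and w - u are brackets of the configuration and do not vanish, 2u = w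
-- says that 4 lies on the mirror axis of the square, a symmetry which the
-- construction respects, and the last factor is a conic that meets this axis in
-- (1/2 , 3/4).  The oriented matroid is that of the 13 points at this crossing,
-- (u : v : w) = (2 : 3 : 4), so its realizations fall into two branches.  Both
-- are parametrized by positive reals α, β (subject to β² + αβ - α² > 0 on the
-- axis) in such a way that almost every bracket is a polynomial in α, β whose
-- nonzero coefficients have the same sign; hence the chirotope is constant along
-- each branch, and a path leads from every realization to the crossing α = β = 1.

open import Defs
open import Algebra.Bundles using (CommutativeRing)
open import Data.Bool.Base using (Bool; true; false; T; _∧_; _∨_; if_then_else_)
open import Data.Bool.Properties using (T-∧; T-∨)
open import Data.Empty using (⊥)
open import Data.Fin using (#_)
open import Data.Fin.Base using (Fin; zero; suc; toℕ; punchIn)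
open import Data.Fin.Patterns
open import Data.Fin.Permutation using (Permutation′; _⟨$⟩ʳ_; _⟨$⟩ˡ_; inverseˡ)
import Data.Fin.Properties as Fin
open import Data.Integer.Base as ℤ using (ℤ; +_; -[1+_]; 0ℤ; 1ℤ; _⊖_; _◃_)
import Data.Integer.Properties as ℤ
open import Data.List.Base using (List; []; _∷_; allFin; cartesianProduct; foldr)
open import Data.Maybe.Base using (Maybe; just; nothing; _>>=_)
open import Data.Nat.Base as ℕ using (ℕ; zero; suc; NonZero; nonZero)
import Data.Nat.Properties as ℕ
open import Data.Product.Base using (Σ; ∃-syntax; _×_; _,_; proj₁; proj₂)
import Data.Sign.Base as Sign
open import Data.Sum.Base using (_⊎_; inj₁; inj₂; [_,_]′; swap)
open import Data.Unit.Base using (⊤; tt)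
open import Data.Vec.Base as Vec using (Vec; []; _∷_; lookup; tabulate; _[_]≔_)
open import Data.Vec.N-ary using (N-ary; _$ⁿ_)
open import Data.Vec.Properties using (lookup∘tabulate; lookup-map)
open import Data.Vec.Relation.Unary.All using (All; []; _∷_)
open import Function.Bundles using (Equivalence; mk⇔)
open import Level using (0ℓ)
open import Relation.Binary.Definitions using (tri<; tri≈; tri>)
open import Relation.Binary.PropositionalEquality.Core as ≡ using (_≡_; _≢_)
open import Relation.Binary.Structures using (IsStrictTotalOrder)
open import Relation.Nullary.Decidable.Core using (does; _×-dec_)
open import Relation.Nullary.Negation.Core using (¬_; contradiction)
open import Relation.Unary using (Pred; Universal; Empty; _∪_; _∩_)

-- The reflection in the mirror axis exchanges 0 with 1, 2 with 3, 5 with 6, 7 with 8 and 10 with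
-- 11; it fixes 9, the point at infinity of the axis, and exchanges the lines (2,11) and (3,10). So
-- if 4 lies on the axis, then 12 does too, and 4, 9, 12 are collinear by symmetry alone: hence the
-- factor `2u - w`, and the conic is what remains. The difficulty lies in the 286 brackets. One that
-- changed sign along a branch would cut it, and the fibre over a branch could have further pieces.
-- Both are excluded by parameters `α`, `β` that are themselves brackets up to positive factors:
-- every realization yields positive parameters, and conversely the expansion of all brackets in
-- `α`, `β` shows that every admissible pair gives a realization. What remains free are an
-- invertible matrix and positive column factors, and the latter can be deformed to 1 along with the
-- parameters.

-- Integer polynomials in Horner form, and ring expressions

module Polynomials where

  -- Coefficients are listed by ascending powers of the variable `zero`. Trailing zeros are kept, so
  -- normal forms are not unique and vanishing is tested by `isZero`.
  Poly : ℕ → Set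
  Poly zero    = ℤ
  Poly (suc n) = List (Poly n)

  constant : ∀ n → ℤ → Poly n
  constant zero    c = c
  constant (suc n) c = constant n c ∷ []

  variableᴾ : ∀ n → Fin n → Poly n
  variableᴾ (suc n) zero    = constant n 0ℤ ∷ constant n 1ℤ ∷ []
  variableᴾ (suc n) (suc i) = variableᴾ n i ∷ []

  add : ∀ n → Poly n → Poly n → Poly n
  add zero    p        q        = p ℤ.+ q
  add (suc n) []       q        = q
  add (suc n) (p ∷ ps) []       = p ∷ ps
  add (suc n) (p ∷ ps) (q ∷ qs) = add n p q ∷ add (suc n) ps qs

  negate : ∀ n → Poly n → Poly n
  negate zero    p        = ℤ.- p
  negate (suc n) []       = []
  negate (suc n) (p ∷ ps) = negate n p ∷ negate (suc n) ps

  mutual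
    multiply : ∀ n → Poly n → Poly n → Poly n
    multiply zero    p        q = p ℤ.* q
    multiply (suc n) []       q = []
    multiply (suc n) (p ∷ ps) q =
      add (suc n) (scale n p q) (constant n 0ℤ ∷ multiply (suc n) ps q)

    scale : ∀ n → Poly n → Poly (suc n) → Poly (suc n)
    scale n p []       = []
    scale n p (q ∷ qs) = multiply n p q ∷ scale n p qs

  isZeroℤ : ℤ → Bool
  isZeroℤ (+ zero)  = true
  isZeroℤ (+ suc _) = false
  isZeroℤ -[1+ _ ]  = false

  isZero : ∀ n → Poly n → Bool
  isZero zero    p        = isZeroℤ p
  isZero (suc n) []       = true
  isZero (suc n) (p ∷ ps) = isZero n p ∧ isZero (suc n) ps

  signℤ : ℤ → Sgn
  signℤ (+ zero)  = 0ˢ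
  signℤ (+ suc _) = +1ˢ
  signℤ -[1+ _ ]  = -1ˢ

  _⊞_ : Sgn → Sgn → Maybe Sgn
  -1ˢ ⊞ +1ˢ = nothing
  -1ˢ ⊞ t   = just -1ˢ
  0ˢ  ⊞ t   = just t
  +1ˢ ⊞ -1ˢ = nothing
  +1ˢ ⊞ t   = just +1ˢ

  -- The common sign of the nonzero coefficients, if they have one.
  coefficientSign : ∀ n → Poly n → Maybe Sgn
  coefficientSign zero    p        = just (signℤ p)
  coefficientSign (suc n) []       = just 0ˢ
  coefficientSign (suc n) (p ∷ ps) =
    coefficientSign n p >>= λ s → coefficientSign (suc n) ps >>= λ t → s ⊞ t

  infixl 6 _:+_ _:-_
  infixl 7 _:*_
  infix  8 :-_

  data Expr (n : ℕ) : Set where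
    con  : ℤ → Expr n
    var  : Fin n → Expr n
    _:+_ : Expr n → Expr n → Expr n
    _:*_ : Expr n → Expr n → Expr n
    :-_  : Expr n → Expr n

  _:-_ : ∀ {n} → Expr n → Expr n → Expr n
  e :- f = e :+ :- f

  -- Substitutes polynomials for the variables while normalizing. Thus a bracket is computed from
  -- columns that are already polynomials in few variables, and is never expanded in its nine
  -- entries.
  normIn : ∀ {m} n → Vec (Poly n) m → Expr m → Poly n
  normIn n σ (con c)  = constant n c
  normIn n σ (var i)  = lookup σ i
  normIn n σ (e :+ f) = add n (normIn n σ e) (normIn n σ f)
  normIn n σ (e :* f) = multiply n (normIn n σ e) (normIn n σ f)
  normIn n σ (:- e)   = negate n (normIn n σ e)

  norm : ∀ {n} → Expr n → Poly n
  norm {n} = normIn n (Vec.tabulate (variableᴾ n))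

  -- A syntactic copy of `Matrices.det`, so that the two agree definitionally.
  detᴱ : ∀ {n} m → (Fin m → Fin m → Expr n) → Expr n
  detᴱ         zero    M = con (+ 1)
  detᴱ {n} (suc m) M =
    sumᴱ (λ k → power (toℕ k) :* (M zero k :* detᴱ m (λ a b → M (suc a) (punchIn k b))))
    where
    power : ℕ → Expr n
    power zero    = con (+ 1)
    power (suc k) = (:- con (+ 1)) :* power k
    sumᴱ : ∀ {l} → (Fin l → Expr n) → Expr n
    sumᴱ {zero}  f = con (+ 0)
    sumᴱ {suc l} f = f zero :+ sumᴱ (λ k → f (suc k))

  ⟨_,_,_⟩ : ∀ {a} {A : Set a} → A → A → A → Fin 3 → A
  ⟨ x , y , z ⟩ zero             = x
  ⟨ x , y , z ⟩ (suc zero)       = y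
  ⟨ x , y , z ⟩ (suc (suc zero)) = z

  det₃ᵉ : ∀ {n} → (Fin 3 → Expr n) → (Fin 3 → Expr n) → (Fin 3 → Expr n) → Expr n
  det₃ᵉ x y z =
    x (# 0) :* (y (# 1) :* z (# 2) :- y (# 2) :* z (# 1)) :-
    x (# 1) :* (y (# 0) :* z (# 2) :- y (# 2) :* z (# 0)) :+
    x (# 2) :* (y (# 0) :* z (# 1) :- y (# 1) :* z (# 0))

  -- The determinant in its nine entries, read column by column.
  det₃ᴱ : Expr 9
  det₃ᴱ = det₃ᵉ ⟨ var (# 0) , var (# 1) , var (# 2) ⟩ ⟨ var (# 3) , var (# 4) , var (# 5) ⟩
                ⟨ var (# 6) , var (# 7) , var (# 8) ⟩

-- Evaluation in a commutative ring, and proof of ring identities by normalization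

module Evaluation (R : CommutativeRing 0ℓ 0ℓ) where
  open Polynomials
  open CommutativeRing R hiding (zero)
  open import Algebra.Properties.Ring ring
  open import Algebra.Properties.CommutativeSemigroup +-commutativeSemigroup
    using () renaming (interchange to +-medial)
  import Algebra.Properties.CommutativeSemigroup *-commutativeSemigroup as *-CS
  open import Relation.Binary.Reasoning.Setoid setoid

  -- The separate clause for 1 makes `con (+ 1)` and `con (+ 2)` evaluate to `1#` and `1# + 1#` by
  -- computation, so that solved identities match the goals as they are written.
  ℕ→R : ℕ → Carrier
  ℕ→R zero          = 0#
  ℕ→R (suc zero)    = 1#
  ℕ→R (suc (suc n)) = 1# + ℕ→R (suc n)

  ℤ→R : ℤ → Carrier
  ℤ→R (+ n)    = ℕ→R n
  ℤ→R -[1+ n ] = - ℕ→R (suc n)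

  ℕ→R-suc : ∀ n → ℕ→R (suc n) ≈ 1# + ℕ→R n
  ℕ→R-suc zero    = sym (+-identityʳ 1#)
  ℕ→R-suc (suc n) = refl

  ℕ→R-+ : ∀ m n → ℕ→R (m ℕ.+ n) ≈ ℕ→R m + ℕ→R n
  ℕ→R-+ zero    n = sym (+-identityˡ _)
  ℕ→R-+ (suc m) n = begin
    ℕ→R (suc (m ℕ.+ n))      ≈⟨ ℕ→R-suc (m ℕ.+ n) ⟩
    1# + ℕ→R (m ℕ.+ n)       ≈⟨ +-congˡ (ℕ→R-+ m n) ⟩
    1# + (ℕ→R m + ℕ→R n)     ≈⟨ +-assoc _ _ _ ⟨
    1# + ℕ→R m + ℕ→R n       ≈⟨ +-congʳ (ℕ→R-suc m) ⟨
    ℕ→R (suc m) + ℕ→R n      ∎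

  ℕ→R-* : ∀ m n → ℕ→R (m ℕ.* n) ≈ ℕ→R m * ℕ→R n
  ℕ→R-* zero    n = sym (zeroˡ _)
  ℕ→R-* (suc m) n = begin
    ℕ→R (n ℕ.+ m ℕ.* n)              ≈⟨ ℕ→R-+ n (m ℕ.* n) ⟩
    ℕ→R n + ℕ→R (m ℕ.* n)            ≈⟨ +-cong (sym (*-identityˡ _)) (ℕ→R-* m n) ⟩
    1# * ℕ→R n + ℕ→R m * ℕ→R n       ≈⟨ distribʳ _ _ _ ⟨
    (1# + ℕ→R m) * ℕ→R n             ≈⟨ *-congʳ (ℕ→R-suc m) ⟨
    ℕ→R (suc m) * ℕ→R n              ∎

  ℤ→R-⊖ : ∀ m n → ℤ→R (m ⊖ n) ≈ ℕ→R m - ℕ→R n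
  ℤ→R-⊖ zero    zero    = sym (-‿inverseʳ 0#)
  ℤ→R-⊖ zero    (suc n) = sym (+-identityˡ _)
  ℤ→R-⊖ (suc m) zero    = sym (trans (+-congˡ -0#≈0#) (+-identityʳ _))
  ℤ→R-⊖ (suc m) (suc n) = begin
    ℤ→R (suc m ⊖ suc n)                  ≈⟨ reflexive (≡.cong ℤ→R (ℤ.[1+m]⊖[1+n]≡m⊖n m n)) ⟩
    ℤ→R (m ⊖ n)                          ≈⟨ ℤ→R-⊖ m n ⟩
    ℕ→R m - ℕ→R n                        ≈⟨ +-identityˡ _ ⟨
    0# + (ℕ→R m - ℕ→R n)                 ≈⟨ +-congʳ (-‿inverseʳ 1#) ⟨
    (1# - 1#) + (ℕ→R m - ℕ→R n)          ≈⟨ +-medial _ _ _ _ ⟩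
    (1# + ℕ→R m) + (- 1# + - ℕ→R n)      ≈⟨ +-congˡ (-‿+-comm _ _) ⟩
    (1# + ℕ→R m) - (1# + ℕ→R n)          ≈⟨ +-cong (ℕ→R-suc m) (-‿cong (ℕ→R-suc n)) ⟨
    ℕ→R (suc m) - ℕ→R (suc n)            ∎

  ℤ→R-+ : ∀ i j → ℤ→R (i ℤ.+ j) ≈ ℤ→R i + ℤ→R j
  ℤ→R-+ (+ m)    (+ n)    = ℕ→R-+ m n
  ℤ→R-+ (+ m)    -[1+ n ] = ℤ→R-⊖ m (suc n)
  ℤ→R-+ -[1+ m ] (+ n)    = trans (ℤ→R-⊖ n (suc m)) (+-comm _ _)
  ℤ→R-+ -[1+ m ] -[1+ n ] = begin
    - ℕ→R (suc (suc (m ℕ.+ n)))            ≈⟨ -‿cong (+-congˡ (ℕ→R-+ (suc m) n)) ⟩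
    - (1# + (ℕ→R (suc m) + ℕ→R n))         ≈⟨ -‿cong (+-congˡ (+-comm _ _)) ⟩
    - (1# + (ℕ→R n + ℕ→R (suc m)))         ≈⟨ -‿cong (+-assoc _ _ _) ⟨
    - (1# + ℕ→R n + ℕ→R (suc m))           ≈⟨ -‿cong (+-congʳ (ℕ→R-suc n)) ⟨
    - (ℕ→R (suc n) + ℕ→R (suc m))          ≈⟨ -‿cong (+-comm _ _) ⟩
    - (ℕ→R (suc m) + ℕ→R (suc n))          ≈⟨ -‿+-comm _ _ ⟨
    - ℕ→R (suc m) - ℕ→R (suc n)            ∎

  ℤ→R-neg : ∀ i → ℤ→R (ℤ.- i) ≈ - ℤ→R i
  ℤ→R-neg (+ zero)  = sym -0#≈0#
  ℤ→R-neg (+ suc n) = refl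
  ℤ→R-neg -[1+ n ]  = sym (-‿involutive _)

  ℤ→R-* : ∀ i j → ℤ→R (i ℤ.* j) ≈ ℤ→R i * ℤ→R j
  ℤ→R-* (+ m) (+ n) = begin
    ℤ→R (Sign.+ ◃ m ℕ.* n)          ≈⟨ reflexive (≡.cong ℤ→R (ℤ.+◃n≡+n (m ℕ.* n))) ⟩
    ℕ→R (m ℕ.* n)                   ≈⟨ ℕ→R-* m n ⟩
    ℕ→R m * ℕ→R n                   ∎
  ℤ→R-* (+ m) -[1+ n ] = begin
    ℤ→R (Sign.- ◃ m ℕ.* suc n)      ≈⟨ reflexive (≡.cong ℤ→R (ℤ.-◃n≡-n (m ℕ.* suc n))) ⟩
    ℤ→R (ℤ.- (+ (m ℕ.* suc n)))     ≈⟨ ℤ→R-neg (+ (m ℕ.* suc n)) ⟩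
    - ℕ→R (m ℕ.* suc n)             ≈⟨ -‿cong (ℕ→R-* m (suc n)) ⟩
    - (ℕ→R m * ℕ→R (suc n))         ≈⟨ -‿distribʳ-* _ _ ⟩
    ℕ→R m * - ℕ→R (suc n)           ∎
  ℤ→R-* -[1+ m ] (+ n) = begin
    ℤ→R (Sign.- ◃ suc m ℕ.* n)      ≈⟨ reflexive (≡.cong ℤ→R (ℤ.-◃n≡-n (suc m ℕ.* n))) ⟩
    ℤ→R (ℤ.- (+ (suc m ℕ.* n)))     ≈⟨ ℤ→R-neg (+ (suc m ℕ.* n)) ⟩
    - ℕ→R (suc m ℕ.* n)             ≈⟨ -‿cong (ℕ→R-* (suc m) n) ⟩
    - (ℕ→R (suc m) * ℕ→R n)         ≈⟨ -‿distribˡ-* _ _ ⟩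
    - ℕ→R (suc m) * ℕ→R n           ∎
  ℤ→R-* -[1+ m ] -[1+ n ] = begin
    ℕ→R (suc m ℕ.* suc n)           ≈⟨ ℕ→R-* (suc m) (suc n) ⟩
    ℕ→R (suc m) * ℕ→R (suc n)       ≈⟨ -‿involutive _ ⟨
    - - (ℕ→R (suc m) * ℕ→R (suc n)) ≈⟨ -‿cong (-‿distribʳ-* _ _) ⟩
    - (ℕ→R (suc m) * - ℕ→R (suc n)) ≈⟨ -‿distribˡ-* _ _ ⟩
    - ℕ→R (suc m) * - ℕ→R (suc n)   ∎

  evalᴾ : ∀ n → Poly n → Vec Carrier n → Carrier
  evalᴾ zero    p        []      = ℤ→R p
  evalᴾ (suc n) []       ρ       = 0#
  evalᴾ (suc n) (p ∷ ps) (x ∷ ρ) = evalᴾ n p ρ + x * evalᴾ (suc n) ps (x ∷ ρ)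

  eval-constant : ∀ n c ρ → evalᴾ n (constant n c) ρ ≈ ℤ→R c
  eval-constant zero    c []      = refl
  eval-constant (suc n) c (x ∷ ρ) =
    trans (+-cong (eval-constant n c ρ) (zeroʳ x)) (+-identityʳ _)

  eval-variable : ∀ n i ρ → evalᴾ n (variableᴾ n i) ρ ≈ lookup ρ i
  eval-variable (suc n) zero (x ∷ ρ) = begin
    evalᴾ n (constant n 0ℤ) ρ + x * (evalᴾ n (constant n 1ℤ) ρ + x * 0#)
      ≈⟨ +-cong (eval-constant n 0ℤ ρ) (*-congˡ (+-cong (eval-constant n 1ℤ ρ) (zeroʳ x))) ⟩
    0# + x * (1# + 0#)  ≈⟨ +-identityˡ _ ⟩
    x * (1# + 0#)       ≈⟨ *-congˡ (+-identityʳ 1#) ⟩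
    x * 1#              ≈⟨ *-identityʳ x ⟩
    x                   ∎
  eval-variable (suc n) (suc i) (x ∷ ρ) =
    trans (+-cong (eval-variable n i ρ) (zeroʳ x)) (+-identityʳ _)

  eval-add : ∀ n p q ρ → evalᴾ n (add n p q) ρ ≈ evalᴾ n p ρ + evalᴾ n q ρ
  eval-add zero    p        q        []      = ℤ→R-+ p q
  eval-add (suc n) []       q        (x ∷ ρ) = sym (+-identityˡ _)
  eval-add (suc n) (p ∷ ps) []       (x ∷ ρ) = sym (+-identityʳ _)
  eval-add (suc n) (p ∷ ps) (q ∷ qs) (x ∷ ρ) = begin
    evalᴾ n (add n p q) ρ + x * evalᴾ (suc n) (add (suc n) ps qs) (x ∷ ρ)
      ≈⟨ +-cong (eval-add n p q ρ) (*-congˡ (eval-add (suc n) ps qs (x ∷ ρ))) ⟩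
    (evalᴾ n p ρ + evalᴾ n q ρ) + x * (evalᴾ (suc n) ps (x ∷ ρ) + evalᴾ (suc n) qs (x ∷ ρ))
      ≈⟨ +-congˡ (distribˡ _ _ _) ⟩
    (evalᴾ n p ρ + evalᴾ n q ρ) + (x * evalᴾ (suc n) ps (x ∷ ρ) + x * evalᴾ (suc n) qs (x ∷ ρ))
      ≈⟨ +-medial _ _ _ _ ⟩
    evalᴾ (suc n) (p ∷ ps) (x ∷ ρ) + evalᴾ (suc n) (q ∷ qs) (x ∷ ρ) ∎

  eval-negate : ∀ n p ρ → evalᴾ n (negate n p) ρ ≈ - evalᴾ n p ρ
  eval-negate zero    p        []      = ℤ→R-neg p
  eval-negate (suc n) []       (x ∷ ρ) = sym -0#≈0#
  eval-negate (suc n) (p ∷ ps) (x ∷ ρ) = begin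
    evalᴾ n (negate n p) ρ + x * evalᴾ (suc n) (negate (suc n) ps) (x ∷ ρ)
      ≈⟨ +-cong (eval-negate n p ρ) (*-congˡ (eval-negate (suc n) ps (x ∷ ρ))) ⟩
    - evalᴾ n p ρ + x * - evalᴾ (suc n) ps (x ∷ ρ)
      ≈⟨ +-congˡ (-‿distribʳ-* _ _) ⟨
    - evalᴾ n p ρ - x * evalᴾ (suc n) ps (x ∷ ρ)
      ≈⟨ -‿+-comm _ _ ⟩
    - evalᴾ (suc n) (p ∷ ps) (x ∷ ρ) ∎

  mutual
    eval-multiply : ∀ n p q ρ → evalᴾ n (multiply n p q) ρ ≈ evalᴾ n p ρ * evalᴾ n q ρ
    eval-multiply zero    p        q []      = ℤ→R-* p q
    eval-multiply (suc n) []       q (x ∷ ρ) = sym (zeroˡ _)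
    eval-multiply (suc n) (p ∷ ps) q (x ∷ ρ) = begin
      evalᴾ (suc n) (add (suc n) (scale n p q) (constant n 0ℤ ∷ multiply (suc n) ps q)) (x ∷ ρ)
        ≈⟨ eval-add (suc n) (scale n p q) _ (x ∷ ρ) ⟩
      evalᴾ (suc n) (scale n p q) (x ∷ ρ) +
      (evalᴾ n (constant n 0ℤ) ρ + x * evalᴾ (suc n) (multiply (suc n) ps q) (x ∷ ρ))
        ≈⟨ +-cong (eval-scale n p q x ρ)
                  (trans (+-congʳ (eval-constant n 0ℤ ρ)) (+-identityˡ _)) ⟩
      evalᴾ n p ρ * evalᴾ (suc n) q (x ∷ ρ) + x * evalᴾ (suc n) (multiply (suc n) ps q) (x ∷ ρ)
        ≈⟨ +-congˡ (*-congˡ (eval-multiply (suc n) ps q (x ∷ ρ))) ⟩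
      evalᴾ n p ρ * evalᴾ (suc n) q (x ∷ ρ) +
      x * (evalᴾ (suc n) ps (x ∷ ρ) * evalᴾ (suc n) q (x ∷ ρ))
        ≈⟨ +-congˡ (*-assoc _ _ _) ⟨
      evalᴾ n p ρ * evalᴾ (suc n) q (x ∷ ρ) +
      x * evalᴾ (suc n) ps (x ∷ ρ) * evalᴾ (suc n) q (x ∷ ρ)
        ≈⟨ distribʳ _ _ _ ⟨
      evalᴾ (suc n) (p ∷ ps) (x ∷ ρ) * evalᴾ (suc n) q (x ∷ ρ) ∎

    eval-scale : ∀ n p q x ρ →
      evalᴾ (suc n) (scale n p q) (x ∷ ρ) ≈ evalᴾ n p ρ * evalᴾ (suc n) q (x ∷ ρ)
    eval-scale n p []       x ρ = sym (zeroʳ _)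
    eval-scale n p (q ∷ qs) x ρ = begin
      evalᴾ n (multiply n p q) ρ + x * evalᴾ (suc n) (scale n p qs) (x ∷ ρ)
        ≈⟨ +-cong (eval-multiply n p q ρ) (*-congˡ (eval-scale n p qs x ρ)) ⟩
      evalᴾ n p ρ * evalᴾ n q ρ + x * (evalᴾ n p ρ * evalᴾ (suc n) qs (x ∷ ρ))
        ≈⟨ +-congˡ (*-CS.x∙yz≈y∙xz _ _ _) ⟩
      evalᴾ n p ρ * evalᴾ n q ρ + evalᴾ n p ρ * (x * evalᴾ (suc n) qs (x ∷ ρ))
        ≈⟨ distribˡ _ _ _ ⟨
      evalᴾ n p ρ * evalᴾ (suc n) (q ∷ qs) (x ∷ ρ) ∎

  eval-isZero : ∀ n p ρ → T (isZero n p) → evalᴾ n p ρ ≈ 0#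
  eval-isZero zero    (+ zero) []      _ = refl
  eval-isZero (suc n) []       ρ       _ = refl
  eval-isZero (suc n) (p ∷ ps) (x ∷ ρ) z with Equivalence.to T-∧ z
  ... | z₁ , z₂ = begin
    evalᴾ n p ρ + x * evalᴾ (suc n) ps (x ∷ ρ)
      ≈⟨ +-cong (eval-isZero n p ρ z₁) (*-congˡ (eval-isZero (suc n) ps (x ∷ ρ) z₂)) ⟩
    0# + x * 0#  ≈⟨ +-identityˡ _ ⟩
    x * 0#       ≈⟨ zeroʳ x ⟩
    0#           ∎

  ⟦_⟧ : ∀ {n} → Expr n → Vec Carrier n → Carrier
  ⟦ con c  ⟧ ρ = ℤ→R c
  ⟦ var i  ⟧ ρ = lookup ρ i
  ⟦ e :+ f ⟧ ρ = ⟦ e ⟧ ρ + ⟦ f ⟧ ρ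
  ⟦ e :* f ⟧ ρ = ⟦ e ⟧ ρ * ⟦ f ⟧ ρ
  ⟦ :- e   ⟧ ρ = - ⟦ e ⟧ ρ

  normIn-correct : ∀ {m} n (σ : Vec (Poly n) m) ρ (ρ′ : Vec Carrier m) →
                   (∀ i → evalᴾ n (lookup σ i) ρ ≈ lookup ρ′ i) →
                   ∀ e → evalᴾ n (normIn n σ e) ρ ≈ ⟦ e ⟧ ρ′
  normIn-correct n σ ρ ρ′ eq (con c)  = eval-constant n c ρ
  normIn-correct n σ ρ ρ′ eq (var i)  = eq i
  normIn-correct n σ ρ ρ′ eq (e :+ f) =
    trans (eval-add n (normIn n σ e) (normIn n σ f) ρ)
          (+-cong (normIn-correct n σ ρ ρ′ eq e) (normIn-correct n σ ρ ρ′ eq f))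
  normIn-correct n σ ρ ρ′ eq (e :* f) =
    trans (eval-multiply n (normIn n σ e) (normIn n σ f) ρ)
          (*-cong (normIn-correct n σ ρ ρ′ eq e) (normIn-correct n σ ρ ρ′ eq f))
  normIn-correct n σ ρ ρ′ eq (:- e)   =
    trans (eval-negate n (normIn n σ e) ρ) (-‿cong (normIn-correct n σ ρ ρ′ eq e))

  norm-correct : ∀ {n} (e : Expr n) ρ → evalᴾ n (norm e) ρ ≈ ⟦ e ⟧ ρ
  norm-correct {n} e ρ = normIn-correct n _ ρ ρ eq e
    where
    eq : ∀ i → evalᴾ n (lookup (Vec.tabulate (variableᴾ n)) i) ρ ≈ lookup ρ i
    eq i = trans (reflexive (≡.cong (λ p → evalᴾ n p ρ) (lookup∘tabulate (variableᴾ n) i)))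
                 (eval-variable n i ρ)

  abstract
    -- The difference is normalized and tested for zero; comparing two normal forms would fail on
    -- trailing zeros.
    expr-≈ : ∀ {n} (e f : Expr n) ρ → T (isZero n (norm (e :- f))) → ⟦ e ⟧ ρ ≈ ⟦ f ⟧ ρ
    expr-≈ {n} e f ρ z = x∙y⁻¹≈ε⇒x≈y _ _
      (trans (sym (norm-correct (e :- f) ρ)) (eval-isZero n (norm (e :- f)) ρ z))

    -- The equation is a function of its variables, which can then be named. The hidden argument has
    -- a type that evaluates to the unit type when the identity holds, so it is filled in by eta.
    ring-≈ : ∀ {n} (ρ : Vec Carrier n) (f : N-ary n (Expr n) (Expr n × Expr n)) →
             let eqn = f $ⁿ Vec.map var (Vec.allFin n) in
             {_ : T (isZero n (norm (proj₁ eqn :- proj₂ eqn)))} →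
             ⟦ proj₁ eqn ⟧ ρ ≈ ⟦ proj₂ eqn ⟧ ρ
    ring-≈ {n} ρ f {z} = expr-≈ (proj₁ (f $ⁿ vars)) (proj₂ (f $ⁿ vars)) ρ z
      where
      vars : Vec (Expr n) n
      vars = Vec.map var (Vec.allFin n)

  ⟦⟧-cong : ∀ {n} (e : Expr n) {ρ ρ′} → (∀ i → lookup ρ i ≈ lookup ρ′ i) → ⟦ e ⟧ ρ ≈ ⟦ e ⟧ ρ′
  ⟦⟧-cong (con c)  eq = refl
  ⟦⟧-cong (var i)  eq = eq i
  ⟦⟧-cong (e :+ f) eq = +-cong (⟦⟧-cong e eq) (⟦⟧-cong f eq)
  ⟦⟧-cong (e :* f) eq = *-cong (⟦⟧-cong e eq) (⟦⟧-cong f eq)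
  ⟦⟧-cong (:- e)   eq = -‿cong (⟦⟧-cong e eq)

-- The 13 points, the two branches, and the sign checks

module Configuration where
  open Polynomials

  -- Common factors of the cross products are removed; up to sign they return as the `κ` of
  -- `aligned-meet`. Signs are chosen so that from point 2 on the second coordinate, which is the
  -- bracket with the points 0 and 1, is positive at the crossing. Point 12 is entered as the meet
  -- of (2,11) and (4,9), so that its incidence with (3,10) becomes the condition that singles out
  -- the branches.
  columns : Vec (Vec (Expr 3) 3) 13
  columns =
      (:0 ∷ :0 ∷ :1 ∷ [])
    ∷ (:1 ∷ :0 ∷ :1 ∷ [])
    ∷ (:0 ∷ :1 ∷ :1 ∷ [])
    ∷ (:1 ∷ :1 ∷ :1 ∷ [])
    ∷ (u  ∷ v  ∷ w  ∷ [])
    ∷ (:0 ∷ v :- u ∷ w :- u ∷ [])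
    ∷ (u  ∷ u :+ v :- w ∷ u ∷ [])
    ∷ (u  ∷ v  ∷ u ∷ [])
    ∷ (:0 ∷ v  ∷ w :- u ∷ [])
    ∷ (:0 ∷ :1 ∷ :0 ∷ [])
    ∷ (:- (u :* u)
        ∷ u :* w :- u :* u :+ v :* v :- v :* w
        ∷ :2 :* u :* w :- u :* v :- :2 :* u :* u :+ v :* w :- w :* w ∷ [])
    ∷ (u :* v :- u :* u
        ∷ u :* w :- u :* u :+ v :* v :- v :* w
        ∷ :2 :* u :* w :+ u :* v :- :2 :* u :* u :- w :* w ∷ [])
    ∷ (u :* (v :- u)
        ∷ u :* u :- u :* v :+ v :* v :- :2 :* u :* w :+ w :* w
        ∷ w :* (v :- u) ∷ [])
    ∷ []
    where
    u v w :0 :1 :2 : Expr 3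
    u  = var (# 0)
    v  = var (# 1)
    w  = var (# 2)
    :0 = con (+ 0)
    :1 = con (+ 1)
    :2 = con (+ 2)

  column : Fin 3 → Fin 13 → Expr 3
  column a k = lookup (lookup columns k) a

  Columns : ℕ → Set
  Columns n = Vec (Vec (Poly n) 3) 13

  columnsAt : ∀ {n} → Vec (Expr n) 3 → Columns n
  columnsAt {n} σ = Vec.map (Vec.map (normIn n (Vec.map norm σ))) columns

  minorᴾ : ∀ {n} → Columns n → Fin 13 → Fin 13 → Fin 13 → Poly n
  minorᴾ {n} cs i j k = normIn n (lookup cs i Vec.++ lookup cs j Vec.++ lookup cs k) det₃ᴱ

  αᴱ βᴱ : Expr 2
  αᴱ = var (# 0)
  βᴱ = var (# 1)

  -- On the axis `α = v - u` and `β = w - v`. The conic is the graph `v = (u² - uw + w²) / w`, so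
  -- there `α = u` and `β = w - u`, and the triple is multiplied by `w = α + β` to clear the
  -- denominator.
  branch₁ branch₂ : Vec (Expr 2) 3
  branch₁ = αᴱ :+ βᴱ ∷ con (+ 2) :* αᴱ :+ βᴱ ∷ con (+ 2) :* (αᴱ :+ βᴱ) ∷ []
  branch₂ = αᴱ :* (αᴱ :+ βᴱ) ∷ αᴱ :* αᴱ :+ αᴱ :* βᴱ :+ βᴱ :* βᴱ ∷ (αᴱ :+ βᴱ) :* (αᴱ :+ βᴱ) ∷ []

  basePoint : Vec (Expr 0) 3
  basePoint = con (+ 2) ∷ con (+ 3) ∷ con (+ 4) ∷ []

  -- The polynomial code in zero variables is integer arithmetic, so `χ` is the same for every field
  -- and its values on closed triples hold by `≡.refl`.
  χ : Vec (Fin 13) 3 → Sgn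
  χ (i ∷ j ∷ k ∷ []) = signℤ (minorᴾ (columnsAt basePoint) i j k)

  infix 4 _==_
  _==_ : Sgn → Sgn → Bool
  -1ˢ == -1ˢ = true
  0ˢ  == 0ˢ  = true
  +1ˢ == +1ˢ = true
  _   == _   = false

  hasSign : Maybe Sgn → Sgn → Bool
  hasSign nothing  t = false
  hasSign (just s) t = s == t

  allFinᵇ : ∀ {n} → (Fin n → Bool) → Bool
  allFinᵇ {zero}  f = true
  allFinᵇ {suc n} f = f zero ∧ allFinᵇ (λ k → f (suc k))

  allFinᵇ-sound : ∀ {n} (f : Fin n → Bool) → T (allFinᵇ f) → ∀ k → T (f k)
  allFinᵇ-sound f p zero    = proj₁ (Equivalence.to T-∧ p)
  allFinᵇ-sound f p (suc k) =
    allFinᵇ-sound (λ k → f (suc k)) (proj₂ (Equivalence.to (T-∧ {f zero}) p)) k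

  infix 4 _<ᶠ_
  _<ᶠ_ : ∀ {n} → Fin n → Fin n → Bool
  i <ᶠ j = toℕ i ℕ.<ᵇ toℕ j

  -- The order tests guard the inner computation, so that for 13 points only the 286 increasing
  -- triples are expanded.
  allIncreasing : ∀ {n} → (Fin n → Fin n → Fin n → Bool) → Bool
  allIncreasing f = allFinᵇ λ i → allFinᵇ λ j →
    if i <ᶠ j then (allFinᵇ λ k → if j <ᶠ k then f i j k else true) else true

  if-sound : ∀ b {c} → T (if b then c else true) → T b → T c
  if-sound true p _ = p

  allIncreasing-sound : ∀ {n} (f : Fin n → Fin n → Fin n → Bool) → allIncreasing f ≡ true →
                        ∀ i j k → T (i <ᶠ j) → T (j <ᶠ k) → T (f i j k)
  allIncreasing-sound f eq i j k i<j j<k =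
    if-sound (j <ᶠ k) (allFinᵇ-sound (λ k → if j <ᶠ k then f i j k else true)
      (if-sound (i <ᶠ j) (allFinᵇ-sound _ (allFinᵇ-sound
        (λ i → allFinᵇ λ j → if i <ᶠ j then (allFinᵇ λ k → if j <ᶠ k then f i j k else true) else true)
        (≡.subst T (≡.sym eq) _) i) j) i<j) k) j<k

  -- Positive exactly when α / β is below the golden ratio.
  golden : Expr 2
  golden = βᴱ :* βᴱ :+ αᴱ :* βᴱ :- αᴱ :* αᴱ

  -- On the first branch one minor, that of the points 7, 8 and 12, has
  -- coefficients of both signs; it is minus this product.
  goldenMinor : Expr 2
  goldenMinor = golden :* ((αᴱ :+ βᴱ) :* (αᴱ :+ βᴱ))

  coefficientCheck : Poly 2 → Sgn → Bool
  coefficientCheck p s = hasSign (coefficientSign 2 p) s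

  goldenCheck : Poly 2 → Sgn → Bool
  goldenCheck p s = (s == -1ˢ) ∧ isZero 2 (add 2 p (norm goldenMinor))

  check₁ : Poly 2 → Sgn → Bool
  check₁ p s = coefficientCheck p s ∨ goldenCheck p s

  checkMinor : (Poly 2 → Sgn → Bool) → Columns 2 → Columns 0 → Fin 13 → Fin 13 → Fin 13 → Bool
  checkMinor check cs ds i j k = check (minorᴾ cs i j k) (signℤ (minorᴾ ds i j k))

  -- A bracket that vanishes at the crossing passes only if it vanishes identically on the branch,
  -- since only zero coefficients have the common sign `0ˢ`. So the required collinearities are
  -- checked here together with the signs.
  signs₁ : allIncreasing (checkMinor check₁ (columnsAt branch₁) (columnsAt basePoint)) ≡ true
  signs₁ = ≡.refl

  signs₂ : allIncreasing (checkMinor coefficientCheck (columnsAt branch₂) (columnsAt basePoint)) ≡ true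
  signs₂ = ≡.refl

-- Signs in an ordered field

module OrderedField (ℝ : CompleteOrderedField) where
  open Polynomials
  open CompleteOrderedField ℝ hiding (zero)
  open Evaluation commutativeRing
  open Matrices ℝ using (sgn)
  open import Algebra.Properties.Ring ring
  open IsStrictTotalOrder isStrictTotalOrder
    using () renaming (trans to <-trans; irrefl to <-irrefl; asym to <-asym;
                       <-respʳ-≈ to <-respʳ; <-respˡ-≈ to <-respˡ) public

  x<0⇒0<-x : ∀ {x} → x < 0# → 0# < - x
  x<0⇒0<-x {x} x<0 =
    <-respʳ (+-identityˡ _) (<-respˡ (-‿inverseʳ x) (+-monoˡ-< x 0# (- x) x<0))

  0<x⇒-x<0 : ∀ {x} → 0# < x → - x < 0#
  0<x⇒-x<0 {x} 0<x =
    <-respˡ (+-identityˡ _) (<-respʳ (-‿inverseʳ x) (+-monoˡ-< 0# x (- x) 0<x))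

  x<y⇒0<y-x : ∀ {x y} → x < y → 0# < y - x
  x<y⇒0<y-x {x} {y} x<y = <-respˡ (-‿inverseʳ x) (+-monoˡ-< x y (- x) x<y)

  0<y-x⇒x<y : ∀ {x y} → 0# < y - x → x < y
  0<y-x⇒x<y {x} {y} p = <-respˡ (+-identityˡ x)
    (<-respʳ (ring-≈ (x ∷ y ∷ []) λ x y → y :- x :+ x , y) (+-monoˡ-< 0# (y - x) x p))

  +-positive : ∀ {x y} → 0# < x → 0# < y → 0# < x + y
  +-positive {x} {y} 0<x 0<y =
    <-trans 0<y (<-respˡ (+-identityˡ y) (+-monoˡ-< 0# x y 0<x))

  abstract
    0<1 : 0# < 1#
    0<1 with compare 0# 1#
    ... | tri< p _ _ = p
    ... | tri≈ _ p _ = contradiction p 0≉1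
    -- If `1#` were negative, it would still be the square of the positive element `- 1#`.
    ... | tri> _ _ p = <-respʳ (ring-≈ [] ((:- con (+ 1)) :* (:- con (+ 1)) , con (+ 1)))
                               (*-positive _ _ (x<0⇒0<-x p) (x<0⇒0<-x p))

  -- `sgn` is stuck on `compare`; the proofs argue with this predicate and return to `sgn` by
  -- `hasSign-unique`.
  HasSign : Sgn → Carrier → Set
  HasSign -1ˢ x = x < 0#
  HasSign 0ˢ  x = x ≈ 0#
  HasSign +1ˢ x = 0# < x

  sgn-hasSign : ∀ x → HasSign (sgn x) x
  sgn-hasSign x with compare x 0#
  ... | tri< p _ _ = p
  ... | tri≈ _ p _ = p
  ... | tri> _ _ p = p

  hasSign-unique : ∀ {s t x} → HasSign s x → HasSign t x → s ≡ t
  hasSign-unique { -1ˢ} { -1ˢ} p q = ≡.refl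
  hasSign-unique { -1ˢ} {0ˢ}   p q = contradiction p (<-irrefl q)
  hasSign-unique { -1ˢ} {+1ˢ}  p q = contradiction p (<-asym q)
  hasSign-unique {0ˢ}   { -1ˢ} p q = contradiction q (<-irrefl p)
  hasSign-unique {0ˢ}   {0ˢ}   p q = ≡.refl
  hasSign-unique {0ˢ}   {+1ˢ}  p q = contradiction q (<-irrefl (sym p))
  hasSign-unique {+1ˢ}  { -1ˢ} p q = contradiction p (<-asym q)
  hasSign-unique {+1ˢ}  {0ˢ}   p q = contradiction p (<-irrefl (sym q))
  hasSign-unique {+1ˢ}  {+1ˢ}  p q = ≡.refl

  hasSign⇒sgn : ∀ s {x} → HasSign s x → sgn x ≡ s
  hasSign⇒sgn s {x} p = hasSign-unique (sgn-hasSign x) p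

  sgn⇒hasSign : ∀ {s x} → sgn x ≡ s → HasSign s x
  sgn⇒hasSign {x = x} eq = ≡.subst (λ s → HasSign s x) eq (sgn-hasSign x)

  hasSign-cong : ∀ s {x y} → x ≈ y → HasSign s x → HasSign s y
  hasSign-cong -1ˢ eq = <-respˡ eq
  hasSign-cong 0ˢ  eq = trans (sym eq)
  hasSign-cong +1ˢ eq = <-respʳ eq

  sgn-cong : ∀ {x y} → x ≈ y → sgn x ≡ sgn y
  sgn-cong {x} {y} eq = hasSign⇒sgn (sgn y) (hasSign-cong (sgn y) (sym eq) (sgn-hasSign y))

  hasSign-neg : ∀ s {x} → HasSign s x → HasSign (-ˢ s) (- x)
  hasSign-neg -1ˢ p = x<0⇒0<-x p
  hasSign-neg 0ˢ  p = trans (-‿cong p) -0#≈0#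
  hasSign-neg +1ˢ p = 0<x⇒-x<0 p

  -ˢ-involutive : ∀ s → -ˢ (-ˢ s) ≡ s
  -ˢ-involutive -1ˢ = ≡.refl
  -ˢ-involutive 0ˢ  = ≡.refl
  -ˢ-involutive +1ˢ = ≡.refl

  hasSign-positive-* : ∀ t {x y} → 0# < x → HasSign t y → HasSign t (x * y)
  hasSign-positive-* +1ˢ p q = *-positive _ _ p q
  hasSign-positive-* 0ˢ  p q = trans (*-congˡ q) (zeroʳ _)
  hasSign-positive-* -1ˢ {x} {y} p q = <-respˡ
    (ring-≈ (x ∷ y ∷ []) λ x y → :- (x :* (:- y)) , x :* y)
    (0<x⇒-x<0 (*-positive _ _ p (x<0⇒0<-x q)))

  hasSign-* : ∀ s t {x y} → HasSign s x → HasSign t y → HasSign (s *ˢ t) (x * y)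
  hasSign-* +1ˢ t p q = hasSign-positive-* t p q
  hasSign-* 0ˢ  t p q = trans (*-congʳ p) (zeroˡ _)
  hasSign-* -1ˢ t {x} {y} p q = hasSign-cong (-ˢ t)
    (ring-≈ (x ∷ y ∷ []) λ x y → :- ((:- x) :* y) , x :* y)
    (hasSign-neg t (hasSign-positive-* t (x<0⇒0<-x p) q))

  sgn-* : ∀ x y → sgn (x * y) ≡ sgn x *ˢ sgn y
  sgn-* x y = hasSign⇒sgn (sgn x *ˢ sgn y) (hasSign-* (sgn x) (sgn y) (sgn-hasSign x) (sgn-hasSign y))

  sgn-neg : ∀ x → sgn (- x) ≡ -ˢ sgn x
  sgn-neg x = hasSign⇒sgn (-ˢ sgn x) (hasSign-neg (sgn x) (sgn-hasSign x))

  -- Multiplication by a positive `x` preserves the sign of `y`, and a number has only one sign.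
  positive-cancelˡ : ∀ s {x y} → 0# < x → HasSign s (x * y) → HasSign s y
  positive-cancelˡ s {x} {y} 0<x p =
    ≡.subst (λ t → HasSign t y) (hasSign-unique {sgn y} {s} {x * y}
             (hasSign-positive-* (sgn y) 0<x (sgn-hasSign y)) p)
            (sgn-hasSign y)

  positive⇒≉0 : ∀ {x} → 0# < x → x ≉ 0#
  positive⇒≉0 p eq = <-irrefl (sym eq) p

  *-≉0 : ∀ {x y} → x ≉ 0# → y ≉ 0# → x * y ≉ 0#
  *-≉0 {x} {y} x≉0 y≉0 xy≈0 with *-inverse x x≉0
  ... | z , xz≈1 = y≉0 (trans (sym (*-identityˡ y)) (trans (*-congʳ (sym xz≈1))
      (trans (ring-≈ (x ∷ y ∷ z ∷ []) λ x y z → x :* z :* y , z :* (x :* y))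
      (trans (*-congˡ xy≈0) (zeroʳ z)))))

  *-cancel-≈0 : ∀ {x y} → x ≉ 0# → x * y ≈ 0# → y ≈ 0#
  *-cancel-≈0 {x} {y} x≉0 xy≈0 with compare y 0#
  ... | tri< _ y≉0 _ = contradiction xy≈0 (*-≉0 x≉0 y≉0)
  ... | tri≈ _ y≈0 _ = y≈0
  ... | tri> _ y≉0 _ = contradiction xy≈0 (*-≉0 x≉0 y≉0)

  *-≈0 : ∀ {x y} → x * y ≈ 0# → x ≈ 0# ⊎ y ≈ 0#
  *-≈0 {x} xy≈0 with compare x 0#
  ... | tri< _ x≉0 _ = inj₂ (*-cancel-≈0 x≉0 xy≈0)
  ... | tri≈ _ x≈0 _ = inj₁ x≈0
  ... | tri> _ x≉0 _ = inj₂ (*-cancel-≈0 x≉0 xy≈0)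

  ≤-cases : ∀ {x y} → x ≤ y → x < y ⊎ x ≈ y
  ≤-cases {x} {y} x≤y with compare x y
  ... | tri< p _ _ = inj₁ p
  ... | tri≈ _ p _ = inj₂ p
  ... | tri> _ _ p = contradiction p x≤y

  mix : Carrier → Carrier → Carrier → Carrier
  mix t x y = (1# - t) * x + t * y

  mix-positive : ∀ {t x y} → 0# ≤ t → t ≤ 1# → 0# < x → 0# < y → 0# < mix t x y
  mix-positive {t} {x} {y} 0≤t t≤1 0<x 0<y with ≤-cases 0≤t | ≤-cases t≤1
  ... | inj₁ 0<t | inj₁ t<1 =
    +-positive (*-positive _ _ (x<y⇒0<y-x t<1) 0<x) (*-positive _ _ 0<t 0<y)
  ... | _ | inj₂ t≈1 = <-respʳ
    (trans (ring-≈ (x ∷ y ∷ []) λ x y → y , (con (+ 1) :- con (+ 1)) :* x :+ con (+ 1) :* y)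
           (+-cong (*-congʳ (+-congˡ (-‿cong (sym t≈1)))) (*-congʳ (sym t≈1)))) 0<y
  ... | inj₂ 0≈t | _ = <-respʳ
    (trans (ring-≈ (x ∷ y ∷ []) λ x y → x , (con (+ 1) :- con (+ 0)) :* x :+ con (+ 0) :* y)
           (+-cong (*-congʳ (+-congˡ (-‿cong 0≈t))) (*-congʳ 0≈t))) 0<x

  hasSign-+ : ∀ s t {r x y} → s ⊞ t ≡ just r → HasSign s x → HasSign t y → HasSign r (x + y)
  hasSign-+ -1ˢ -1ˢ ≡.refl p q = <-respˡ (ring-≈ (_ ∷ _ ∷ []) λ x y → :- (:- x :+ :- y) , x :+ y)
    (0<x⇒-x<0 (+-positive (x<0⇒0<-x p) (x<0⇒0<-x q)))
  hasSign-+ -1ˢ 0ˢ  ≡.refl p q = <-respˡ (sym (trans (+-congˡ q) (+-identityʳ _))) p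
  hasSign-+ 0ˢ  t   ≡.refl p q = hasSign-cong t (sym (trans (+-congʳ p) (+-identityˡ _))) q
  hasSign-+ +1ˢ 0ˢ  ≡.refl p q = <-respʳ (sym (trans (+-congˡ q) (+-identityʳ _))) p
  hasSign-+ +1ˢ +1ˢ ≡.refl p q = +-positive p q

  ℕ→R-positive : ∀ n → 0# < ℕ→R (suc n)
  ℕ→R-positive zero    = 0<1
  ℕ→R-positive (suc n) = +-positive 0<1 (ℕ→R-positive n)

  hasSign-ℤ : ∀ i → HasSign (signℤ i) (ℤ→R i)
  hasSign-ℤ (+ zero)  = refl
  hasSign-ℤ (+ suc n) = ℕ→R-positive n
  hasSign-ℤ -[1+ n ]  = 0<x⇒-x<0 (ℕ→R-positive n)

  -- At positive arguments every monomial is positive, so the terms cannot cancel when the nonzero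
  -- coefficients agree in sign.
  hasSign-evalᴾ : ∀ n p {s} {ρ} → coefficientSign n p ≡ just s → All (0# <_) ρ →
                  HasSign s (evalᴾ n p ρ)
  hasSign-evalᴾ zero    p        ≡.refl [] = hasSign-ℤ p
  hasSign-evalᴾ (suc n) []       ≡.refl (_ ∷ _) = refl
  hasSign-evalᴾ (suc n) (p ∷ ps) eq (0<x ∷ 0<ρ)
    with coefficientSign n p in eq₁ | coefficientSign (suc n) ps in eq₂
  ... | just s | just t =
    hasSign-+ s t eq (hasSign-evalᴾ n p eq₁ 0<ρ)
              (hasSign-* +1ˢ t 0<x (hasSign-evalᴾ (suc n) ps eq₂ (0<x ∷ 0<ρ)))

-- Determinants of order three

module LinearAlgebra (ℝ : CompleteOrderedField) where
  open Polynomials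
  open CompleteOrderedField ℝ hiding (zero)
  open Evaluation commutativeRing
  open Matrices ℝ
  open OrderedField ℝ
  open import Algebra.Properties.Ring ring
  open import Relation.Binary.Reasoning.Setoid setoid

  Vector : Set
  Vector = Fin 3 → Carrier

  col : ∀ {n} → Matrix 3 n → Fin n → Vector
  col X k a = X a k

  coordinates : Vector → Vector → Vector → Vec Carrier 9
  coordinates x y z =
    x (# 0) ∷ x (# 1) ∷ x (# 2) ∷ y (# 0) ∷ y (# 1) ∷ y (# 2) ∷ z (# 0) ∷ z (# 1) ∷ z (# 2) ∷ []

  -- Has the shape of `det₃ᵉ`, whose evaluation therefore reduces to it; every identity between
  -- determinants can then be left to the ring solver.
  det₃ : Vector → Vector → Vector → Carrier
  det₃ x y z =
    x (# 0) * (y (# 1) * z (# 2) - y (# 2) * z (# 1)) -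
    x (# 1) * (y (# 0) * z (# 2) - y (# 2) * z (# 0)) +
    x (# 2) * (y (# 0) * z (# 1) - y (# 1) * z (# 0))

  det₃-cong : ∀ {x x′ y y′ z z′} → (∀ a → x a ≈ x′ a) → (∀ a → y a ≈ y′ a) →
              (∀ a → z a ≈ z′ a) → det₃ x y z ≈ det₃ x′ y′ z′
  det₃-cong {x} {x′} {y} {y′} {z} {z′} p q r =
    ⟦⟧-cong det₃ᴱ {coordinates x y z} {coordinates x′ y′ z′} eq
    where
    eq : ∀ i → lookup (coordinates x y z) i ≈ lookup (coordinates x′ y′ z′) i
    eq 0F = p _
    eq 1F = p _
    eq 2F = p _
    eq 3F = q _
    eq 4F = q _
    eq 5F = q _
    eq 6F = r _
    eq 7F = r _
    eq 8F = r _

  minor-det₃ : ∀ {n} (X : Matrix 3 n) i j k →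
               minor X (i ∷ j ∷ k ∷ []) ≈ det₃ (col X i) (col X j) (col X k)
  minor-det₃ X i j k =
    ring-≈ (coordinates (col X i) (col X j) (col X k))
           (λ x₀ x₁ x₂ y₀ y₁ y₂ z₀ z₁ z₂ →
             let M : Fin 3 → Fin 3 → Expr 9
                 M a b = ⟨ ⟨ x₀ , x₁ , x₂ ⟩ , ⟨ y₀ , y₁ , y₂ ⟩ , ⟨ z₀ , z₁ , z₂ ⟩ ⟩ b a
             in detᴱ 3 M , det₃ᵉ ⟨ x₀ , x₁ , x₂ ⟩ ⟨ y₀ , y₁ , y₂ ⟩ ⟨ z₀ , z₁ , z₂ ⟩)

  -- Multiplicativity of the determinant, verified as a polynomial identity in 18 entries.
  minor-⊡ : ∀ {n} (A : Matrix 3 3) (X : Matrix 3 n) i →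
            minor (A ⊡ X) i ≈ det₃ (col A (# 0)) (col A (# 1)) (col A (# 2)) * minor X i
  minor-⊡ A X (i ∷ j ∷ k ∷ []) = begin
    minor (A ⊡ X) (i ∷ j ∷ k ∷ [])
      ≈⟨ minor-det₃ (A ⊡ X) i j k ⟩
    det₃ (col (A ⊡ X) i) (col (A ⊡ X) j) (col (A ⊡ X) k)
      ≈⟨ ring-≈ (coordinates (col A (# 0)) (col A (# 1)) (col A (# 2)) Vec.++
                 coordinates (col X i) (col X j) (col X k))
                (λ a b c d e f g h l x₀ x₁ x₂ y₀ y₁ y₂ z₀ z₁ z₂ →
                  let A· : (Fin 3 → Expr 18) → Fin 3 → Expr 18
                      A· t = λ r → ⟨ a , b , c ⟩ r :* t (# 0) :+ (⟨ d , e , f ⟩ r :* t (# 1) :+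
                                     (⟨ g , h , l ⟩ r :* t (# 2) :+ con (+ 0)))
                      x = ⟨ x₀ , x₁ , x₂ ⟩
                      y = ⟨ y₀ , y₁ , y₂ ⟩
                      z = ⟨ z₀ , z₁ , z₂ ⟩
                  in det₃ᵉ (A· x) (A· y) (A· z) ,
                     det₃ᵉ ⟨ a , b , c ⟩ ⟨ d , e , f ⟩ ⟨ g , h , l ⟩ :* det₃ᵉ x y z) ⟩
    det₃ (col A (# 0)) (col A (# 1)) (col A (# 2)) * det₃ (col X i) (col X j) (col X k)
      ≈⟨ *-congˡ (minor-det₃ X i j k) ⟨
    det₃ (col A (# 0)) (col A (# 1)) (col A (# 2)) * minor X (i ∷ j ∷ k ∷ []) ∎

  det₃-invertible : ∀ (A : Matrix 3 3) → det₃ (col A (# 0)) (col A (# 1)) (col A (# 2)) ≉ 0# →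
                    Invertible A
  det₃-invertible A D≉0 with *-inverse _ D≉0
  ... | e , De≈1 = B , A⊡B≋I , B⊡A≋I
    where
    D = det₃ (col A (# 0)) (col A (# 1)) (col A (# 2))
    ρ = e ∷ coordinates (col A (# 0)) (col A (# 1)) (col A (# 2))

    next : Fin 3 → Fin 3
    next = ⟨ # 1 , # 2 , # 0 ⟩

    -- Cyclic indices give the cofactors without explicit signs.
    B : Matrix 3 3
    B a b = e * (A (next b) (next a) * A (next (next b)) (next (next a)) -
                 A (next b) (next (next a)) * A (next (next b)) (next a))

    Aᴱ Bᴱ : Fin 3 → Fin 3 → Expr 10
    Aᴱ a b = ⟨ ⟨ var (# 1) , var (# 2) , var (# 3) ⟩ , ⟨ var (# 4) , var (# 5) , var (# 6) ⟩ ,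
               ⟨ var (# 7) , var (# 8) , var (# 9) ⟩ ⟩ b a
    Bᴱ a b = var (# 0) :* (Aᴱ (next b) (next a) :* Aᴱ (next (next b)) (next (next a)) :-
                           Aᴱ (next b) (next (next a)) :* Aᴱ (next (next b)) (next a))

    _⊡ᴱ_ : (M N : Fin 3 → Fin 3 → Expr 10) → Fin 3 → Fin 3 → Expr 10
    (M ⊡ᴱ N) a c = M a (# 0) :* N (# 0) c :+ (M a (# 1) :* N (# 1) c :+
                  (M a (# 2) :* N (# 2) c :+ con (+ 0)))

    det·e : Expr 10
    det·e = det₃ᵉ (λ a → Aᴱ a (# 0)) (λ a → Aᴱ a (# 1)) (λ a → Aᴱ a (# 2)) :* var (# 0)

    A⊡B≋I : A ⊡ B ≋ I
    A⊡B≋I 0F 0F = trans (expr-≈ ((Aᴱ ⊡ᴱ Bᴱ) (# 0) (# 0)) det·e ρ _) De≈1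
    A⊡B≋I 0F 1F = expr-≈ ((Aᴱ ⊡ᴱ Bᴱ) (# 0) (# 1)) (con (+ 0)) ρ _
    A⊡B≋I 0F 2F = expr-≈ ((Aᴱ ⊡ᴱ Bᴱ) (# 0) (# 2)) (con (+ 0)) ρ _
    A⊡B≋I 1F 0F = expr-≈ ((Aᴱ ⊡ᴱ Bᴱ) (# 1) (# 0)) (con (+ 0)) ρ _
    A⊡B≋I 1F 1F = trans (expr-≈ ((Aᴱ ⊡ᴱ Bᴱ) (# 1) (# 1)) det·e ρ _) De≈1
    A⊡B≋I 1F 2F = expr-≈ ((Aᴱ ⊡ᴱ Bᴱ) (# 1) (# 2)) (con (+ 0)) ρ _
    A⊡B≋I 2F 0F = expr-≈ ((Aᴱ ⊡ᴱ Bᴱ) (# 2) (# 0)) (con (+ 0)) ρ _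
    A⊡B≋I 2F 1F = expr-≈ ((Aᴱ ⊡ᴱ Bᴱ) (# 2) (# 1)) (con (+ 0)) ρ _
    A⊡B≋I 2F 2F = trans (expr-≈ ((Aᴱ ⊡ᴱ Bᴱ) (# 2) (# 2)) det·e ρ _) De≈1

    B⊡A≋I : B ⊡ A ≋ I
    B⊡A≋I 0F 0F = trans (expr-≈ ((Bᴱ ⊡ᴱ Aᴱ) (# 0) (# 0)) det·e ρ _) De≈1
    B⊡A≋I 0F 1F = expr-≈ ((Bᴱ ⊡ᴱ Aᴱ) (# 0) (# 1)) (con (+ 0)) ρ _
    B⊡A≋I 0F 2F = expr-≈ ((Bᴱ ⊡ᴱ Aᴱ) (# 0) (# 2)) (con (+ 0)) ρ _
    B⊡A≋I 1F 0F = expr-≈ ((Bᴱ ⊡ᴱ Aᴱ) (# 1) (# 0)) (con (+ 0)) ρ _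
    B⊡A≋I 1F 1F = trans (expr-≈ ((Bᴱ ⊡ᴱ Aᴱ) (# 1) (# 1)) det·e ρ _) De≈1
    B⊡A≋I 1F 2F = expr-≈ ((Bᴱ ⊡ᴱ Aᴱ) (# 1) (# 2)) (con (+ 0)) ρ _
    B⊡A≋I 2F 0F = expr-≈ ((Bᴱ ⊡ᴱ Aᴱ) (# 2) (# 0)) (con (+ 0)) ρ _
    B⊡A≋I 2F 1F = expr-≈ ((Bᴱ ⊡ᴱ Aᴱ) (# 2) (# 1)) (con (+ 0)) ρ _
    B⊡A≋I 2F 2F = trans (expr-≈ ((Bᴱ ⊡ᴱ Aᴱ) (# 2) (# 2)) det·e ρ _) De≈1

  -- Cramer's rule: the determinant times `c a` is a combination of the entries of `c X` at `i`,
  -- `j`, `k` with cofactors as coefficients.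
  minor≉0⇒fullRowRank : ∀ {n} (X : Matrix 3 n) i → minor X i ≉ 0# → HasFullRowRank X
  minor≉0⇒fullRowRank X (i ∷ j ∷ k ∷ []) m≉0 c cX≈0 =
    λ { 0F             → *-cancel-≈0 D≉0 (combination (y (# 1) * z (# 2) - y (# 2) * z (# 1))
                             (z (# 1) * x (# 2) - z (# 2) * x (# 1))
                             (x (# 1) * y (# 2) - x (# 2) * y (# 1))
                             (ring-≈ ρ λ c₀ c₁ c₂ x₀ x₁ x₂ y₀ y₁ y₂ z₀ z₁ z₂ →
                               Dᴱ x₀ x₁ x₂ y₀ y₁ y₂ z₀ z₁ z₂ :* c₀ ,
                               dot c₀ c₁ c₂ x₀ x₁ x₂ :* (y₁ :* z₂ :- y₂ :* z₁) :+
                               dot c₀ c₁ c₂ y₀ y₁ y₂ :* (z₁ :* x₂ :- z₂ :* x₁) :+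
                               dot c₀ c₁ c₂ z₀ z₁ z₂ :* (x₁ :* y₂ :- x₂ :* y₁)))
      ; 1F       → *-cancel-≈0 D≉0 (combination (y (# 2) * z (# 0) - y (# 0) * z (# 2))
                             (z (# 2) * x (# 0) - z (# 0) * x (# 2))
                             (x (# 2) * y (# 0) - x (# 0) * y (# 2))
                             (ring-≈ ρ λ c₀ c₁ c₂ x₀ x₁ x₂ y₀ y₁ y₂ z₀ z₁ z₂ →
                               Dᴱ x₀ x₁ x₂ y₀ y₁ y₂ z₀ z₁ z₂ :* c₁ ,
                               dot c₀ c₁ c₂ x₀ x₁ x₂ :* (y₂ :* z₀ :- y₀ :* z₂) :+
                               dot c₀ c₁ c₂ y₀ y₁ y₂ :* (z₂ :* x₀ :- z₀ :* x₂) :+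
                               dot c₀ c₁ c₂ z₀ z₁ z₂ :* (x₂ :* y₀ :- x₀ :* y₂)))
      ; 2F → *-cancel-≈0 D≉0 (combination (y (# 0) * z (# 1) - y (# 1) * z (# 0))
                             (z (# 0) * x (# 1) - z (# 1) * x (# 0))
                             (x (# 0) * y (# 1) - x (# 1) * y (# 0))
                             (ring-≈ ρ λ c₀ c₁ c₂ x₀ x₁ x₂ y₀ y₁ y₂ z₀ z₁ z₂ →
                               Dᴱ x₀ x₁ x₂ y₀ y₁ y₂ z₀ z₁ z₂ :* c₂ ,
                               dot c₀ c₁ c₂ x₀ x₁ x₂ :* (y₀ :* z₁ :- y₁ :* z₀) :+
                               dot c₀ c₁ c₂ y₀ y₁ y₂ :* (z₀ :* x₁ :- z₁ :* x₀) :+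
                               dot c₀ c₁ c₂ z₀ z₁ z₂ :* (x₀ :* y₁ :- x₁ :* y₀))) }
    where
    x y z : Vector
    x = col X i
    y = col X j
    z = col X k
    ρ = c (# 0) ∷ c (# 1) ∷ c (# 2) ∷ coordinates x y z

    D≉0 : det₃ x y z ≉ 0#
    D≉0 eq = m≉0 (trans (minor-det₃ X i j k) eq)

    Dᴱ : (x₀ x₁ x₂ y₀ y₁ y₂ z₀ z₁ z₂ : Expr 12) → Expr 12
    Dᴱ x₀ x₁ x₂ y₀ y₁ y₂ z₀ z₁ z₂ = det₃ᵉ ⟨ x₀ , x₁ , x₂ ⟩ ⟨ y₀ , y₁ , y₂ ⟩ ⟨ z₀ , z₁ , z₂ ⟩

    dot : (c₀ c₁ c₂ x₀ x₁ x₂ : Expr 12) → Expr 12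
    dot c₀ c₁ c₂ x₀ x₁ x₂ = c₀ :* x₀ :+ (c₁ :* x₁ :+ (c₂ :* x₂ :+ con (+ 0)))

    combination : ∀ p q r {t} →
      t ≈ sum (λ a → c a * x a) * p + sum (λ a → c a * y a) * q + sum (λ a → c a * z a) * r →
      t ≈ 0#
    combination p q r eq = trans eq (trans
      (+-cong (+-cong (*-congʳ (cX≈0 i)) (*-congʳ (cX≈0 j))) (*-congʳ (cX≈0 k)))
      (ring-≈ (p ∷ q ∷ r ∷ []) λ p q r →
        con (+ 0) :* p :+ con (+ 0) :* q :+ con (+ 0) :* r , con (+ 0)))

  det₃-scale : ∀ l m n x y z →
    det₃ (λ a → l * x a) (λ a → m * y a) (λ a → n * z a) ≈ l * m * n * det₃ x y z
  det₃-scale l m n x y z = ring-≈ (l ∷ m ∷ n ∷ coordinates x y z)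
    λ l m n x₀ x₁ x₂ y₀ y₁ y₂ z₀ z₁ z₂ →
      det₃ᵉ ⟨ l :* x₀ , l :* x₁ , l :* x₂ ⟩ ⟨ m :* y₀ , m :* y₁ , m :* y₂ ⟩
            ⟨ n :* z₀ , n :* z₁ , n :* z₂ ⟩ ,
      l :* m :* n :* det₃ᵉ ⟨ x₀ , x₁ , x₂ ⟩ ⟨ y₀ , y₁ , y₂ ⟩ ⟨ z₀ , z₁ , z₂ ⟩

  chirotope-scale : ∀ {n} (X : Matrix 3 n) (l : Fin n → Carrier) → (∀ k → 0# < l k) →
                    ∀ i → chirotope (λ a k → l k * X a k) i ≡ chirotope X i
  chirotope-scale X l 0<l (i ∷ j ∷ k ∷ []) =
    hasSign⇒sgn (chirotope X (i ∷ j ∷ k ∷ [])) (hasSign-cong (chirotope X (i ∷ j ∷ k ∷ [])) eq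
      (hasSign-positive-* (chirotope X (i ∷ j ∷ k ∷ []))
        (*-positive _ _ (*-positive _ _ (0<l i) (0<l j)) (0<l k))
        (sgn-hasSign (minor X (i ∷ j ∷ k ∷ [])))))
    where
    X′ : Matrix 3 _
    X′ a k = l k * X a k
    eq : l i * l j * l k * minor X (i ∷ j ∷ k ∷ []) ≈ minor X′ (i ∷ j ∷ k ∷ [])
    eq = begin
      l i * l j * l k * minor X (i ∷ j ∷ k ∷ [])           ≈⟨ *-congˡ (minor-det₃ X i j k) ⟩
      l i * l j * l k * det₃ (col X i) (col X j) (col X k)
        ≈⟨ det₃-scale (l i) (l j) (l k) (col X i) (col X j) (col X k) ⟨
      det₃ (col X′ i) (col X′ j) (col X′ k)                ≈⟨ minor-det₃ X′ i j k ⟨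
      minor X′ (i ∷ j ∷ k ∷ [])                            ∎

  -- The chirotope of a real matrix satisfies the oriented matroid axioms

  module _ {n} (X : Matrix 3 n) where

    private
      ρ : Fin n → Fin n → Fin n → Vec Carrier 9
      ρ i j k = coordinates (col X i) (col X j) (col X k)

      negated : ∀ {i j k i′ j′ k′} →
                det₃ (col X i) (col X j) (col X k) ≈ - det₃ (col X i′) (col X j′) (col X k′) →
                chirotope X (i ∷ j ∷ k ∷ []) ≡ -ˢ chirotope X (i′ ∷ j′ ∷ k′ ∷ [])
      negated {i} {j} {k} {i′} {j′} {k′} eq =
        ≡.trans (sgn-cong (trans (minor-det₃ X i j k)
                  (trans eq (-‿cong (sym (minor-det₃ X i′ j′ k′))))))
                (sgn-neg (minor X (i′ ∷ j′ ∷ k′ ∷ [])))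

    chirotope-swap₁₂ : ∀ i j k →
      chirotope X (j ∷ i ∷ k ∷ []) ≡ -ˢ chirotope X (i ∷ j ∷ k ∷ [])
    chirotope-swap₁₂ i j k = negated {j} {i} {k} {i} {j} {k}
      (ring-≈ (ρ i j k) λ x₀ x₁ x₂ y₀ y₁ y₂ z₀ z₁ z₂ →
        det₃ᵉ ⟨ y₀ , y₁ , y₂ ⟩ ⟨ x₀ , x₁ , x₂ ⟩ ⟨ z₀ , z₁ , z₂ ⟩ ,
        :- det₃ᵉ ⟨ x₀ , x₁ , x₂ ⟩ ⟨ y₀ , y₁ , y₂ ⟩ ⟨ z₀ , z₁ , z₂ ⟩)

    chirotope-swap₂₃ : ∀ i j k →
      chirotope X (i ∷ k ∷ j ∷ []) ≡ -ˢ chirotope X (i ∷ j ∷ k ∷ [])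
    chirotope-swap₂₃ i j k = negated {i} {k} {j} {i} {j} {k}
      (ring-≈ (ρ i j k) λ x₀ x₁ x₂ y₀ y₁ y₂ z₀ z₁ z₂ →
        det₃ᵉ ⟨ x₀ , x₁ , x₂ ⟩ ⟨ z₀ , z₁ , z₂ ⟩ ⟨ y₀ , y₁ , y₂ ⟩ ,
        :- det₃ᵉ ⟨ x₀ , x₁ , x₂ ⟩ ⟨ y₀ , y₁ , y₂ ⟩ ⟨ z₀ , z₁ , z₂ ⟩)

    chirotope-repeat : ∀ i k → chirotope X (i ∷ i ∷ k ∷ []) ≡ 0ˢ
    chirotope-repeat i k = fixed (chirotope-swap₁₂ i i k)
      where
      fixed : ∀ {s} → s ≡ -ˢ s → s ≡ 0ˢ
      fixed {0ˢ} _ = ≡.refl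

    private
      -- Agrees by computation with `sgnPerm σ` when `p`, `q`, `r` are the images under `σ`. The
      -- sign of an opaque permutation thereby becomes one that evaluates after a case split on
      -- three indices.
      sgn₃ : Fin 3 → Fin 3 → Fin 3 → Sgn
      sgn₃ p q r = sgnOf ⟨ p , q , r ⟩
        where
        sgnOf : (Fin 3 → Fin 3) → Sgn
        sgnOf f = foldr (λ p s → (if does ((proj₁ p Fin.<? proj₂ p) ×-dec
                                          (f (proj₂ p) Fin.<? f (proj₁ p)))
                                  then -1ˢ else +1ˢ) *ˢ s)
                        +1ˢ (cartesianProduct (allFin 3) (allFin 3))

      alternating₃ : ∀ i p q r → p ≢ q → p ≢ r → q ≢ r →
        chirotope X (lookup i p ∷ lookup i q ∷ lookup i r ∷ []) ≡ sgn₃ p q r *ˢ chirotope X i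
      alternating₃ (i ∷ j ∷ k ∷ []) 0F 0F r p≢q p≢r q≢r = contradiction ≡.refl p≢q
      alternating₃ (i ∷ j ∷ k ∷ []) 0F 1F 0F p≢q p≢r q≢r = contradiction ≡.refl p≢r
      alternating₃ (i ∷ j ∷ k ∷ []) 0F 1F 1F p≢q p≢r q≢r = contradiction ≡.refl q≢r
      alternating₃ (i ∷ j ∷ k ∷ []) 0F 1F 2F p≢q p≢r q≢r = ≡.refl
      alternating₃ (i ∷ j ∷ k ∷ []) 0F 2F 0F p≢q p≢r q≢r = contradiction ≡.refl p≢r
      alternating₃ (i ∷ j ∷ k ∷ []) 0F 2F 1F p≢q p≢r q≢r = chirotope-swap₂₃ i j k
      alternating₃ (i ∷ j ∷ k ∷ []) 0F 2F 2F p≢q p≢r q≢r = contradiction ≡.refl q≢r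
      alternating₃ (i ∷ j ∷ k ∷ []) 1F 0F 0F p≢q p≢r q≢r = contradiction ≡.refl q≢r
      alternating₃ (i ∷ j ∷ k ∷ []) 1F 0F 1F p≢q p≢r q≢r = contradiction ≡.refl p≢r
      alternating₃ (i ∷ j ∷ k ∷ []) 1F 0F 2F p≢q p≢r q≢r = chirotope-swap₁₂ i j k
      alternating₃ (i ∷ j ∷ k ∷ []) 1F 1F r p≢q p≢r q≢r = contradiction ≡.refl p≢q
      alternating₃ (i ∷ j ∷ k ∷ []) 1F 2F 0F p≢q p≢r q≢r =
        ≡.trans (chirotope-swap₂₃ j i k)
          (≡.trans (≡.cong -ˢ_ (chirotope-swap₁₂ i j k)) (-ˢ-involutive _))
      alternating₃ (i ∷ j ∷ k ∷ []) 1F 2F 1F p≢q p≢r q≢r = contradiction ≡.refl p≢r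
      alternating₃ (i ∷ j ∷ k ∷ []) 1F 2F 2F p≢q p≢r q≢r = contradiction ≡.refl q≢r
      alternating₃ (i ∷ j ∷ k ∷ []) 2F 0F 0F p≢q p≢r q≢r = contradiction ≡.refl q≢r
      alternating₃ (i ∷ j ∷ k ∷ []) 2F 0F 1F p≢q p≢r q≢r =
        ≡.trans (chirotope-swap₁₂ i k j)
          (≡.trans (≡.cong -ˢ_ (chirotope-swap₂₃ i j k)) (-ˢ-involutive _))
      alternating₃ (i ∷ j ∷ k ∷ []) 2F 0F 2F p≢q p≢r q≢r = contradiction ≡.refl p≢r
      alternating₃ (i ∷ j ∷ k ∷ []) 2F 1F 0F p≢q p≢r q≢r =
        ≡.trans (chirotope-swap₁₂ j k i) (≡.cong -ˢ_
          (≡.trans (chirotope-swap₂₃ j i k)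
            (≡.trans (≡.cong -ˢ_ (chirotope-swap₁₂ i j k)) (-ˢ-involutive _))))
      alternating₃ (i ∷ j ∷ k ∷ []) 2F 1F 1F p≢q p≢r q≢r = contradiction ≡.refl q≢r
      alternating₃ (i ∷ j ∷ k ∷ []) 2F 1F 2F p≢q p≢r q≢r = contradiction ≡.refl p≢r
      alternating₃ (i ∷ j ∷ k ∷ []) 2F 2F r p≢q p≢r q≢r = contradiction ≡.refl p≢q

    chirotope-alternating : ∀ i (σ : Permutation′ 3) →
      chirotope X (tabulate (λ k → lookup i (σ ⟨$⟩ʳ k))) ≡ sgnPerm σ *ˢ chirotope X i
    chirotope-alternating i σ =
      alternating₃ i (σ ⟨$⟩ʳ # 0) (σ ⟨$⟩ʳ # 1) (σ ⟨$⟩ʳ # 2)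
        (λ eq → contradiction (injective eq) λ ()) (λ eq → contradiction (injective eq) λ ())
        (λ eq → contradiction (injective eq) λ ())
      where
      injective : ∀ {a b} → σ ⟨$⟩ʳ a ≡ σ ⟨$⟩ʳ b → a ≡ b
      injective eq = ≡.trans (≡.sym (inverseˡ σ)) (≡.trans (≡.cong (σ ⟨$⟩ˡ_) eq) (inverseˡ σ))

    private
      nonNegative-sum : ∀ {x} y₁ y₂ y₃ → x ≈ y₁ + y₂ + y₃ →
        NonNegative (sgn y₁) → NonNegative (sgn y₂) → NonNegative (sgn y₃) → NonNegative (sgn x)
      nonNegative-sum {x} y₁ y₂ y₃ eq p₁ p₂ p₃ x<0 =
        +-nonNegative (+-nonNegative (≥0 p₁) (≥0 p₂)) (≥0 p₃)
        (<-respˡ eq (sgn⇒hasSign x<0))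
        where
        ≥0 : ∀ {y} → NonNegative (sgn y) → 0# ≤ y
        ≥0 p y<0 = p (hasSign⇒sgn -1ˢ y<0)
        +-nonNegative : ∀ {y z} → 0# ≤ y → 0# ≤ z → 0# ≤ y + z
        +-nonNegative {y} {z} p q y+z<0 with ≤-cases p
        ... | inj₂ 0≈y = q (<-respˡ (trans (+-congʳ (sym 0≈y)) (+-identityˡ z)) y+z<0)
        ... | inj₁ 0<y = q (<-trans (<-respˡ (+-identityˡ z) (+-monoˡ-< 0# y z 0<y)) y+z<0)

    -- By the Grassmann-Plücker relation the product of two brackets is the sum of the three
    -- exchanged products, so it is nonnegative when these are.
    chirotope-exchange : ∀ (i j : Vec (Fin n) 3) →
      (∀ k → NonNegative (chirotope X (i [ first ]≔ lookup j k) *ˢ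
                          chirotope X (j [ k ]≔ lookup i first))) →
      NonNegative (chirotope X i *ˢ chirotope X j)
    chirotope-exchange (i₁ ∷ i₂ ∷ i₃ ∷ []) (j₁ ∷ j₂ ∷ j₃ ∷ []) nonNeg =
      ≡.subst NonNegative (sgn-* _ _) (nonNegative-sum _ _ _ grassmann-plücker
        (≡.subst NonNegative (≡.sym (sgn-* _ _)) (nonNeg (# 0)))
        (≡.subst NonNegative (≡.sym (sgn-* _ _)) (nonNeg (# 1)))
        (≡.subst NonNegative (≡.sym (sgn-* _ _)) (nonNeg (# 2))))
      where
      m : Fin n → Fin n → Fin n → Carrier
      m i j k = minor X (i ∷ j ∷ k ∷ [])
      d : Fin n → Fin n → Fin n → Carrier
      d i j k = det₃ (col X i) (col X j) (col X k)

      m*m≈d*d : ∀ i j k i′ j′ k′ → m i j k * m i′ j′ k′ ≈ d i j k * d i′ j′ k′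
      m*m≈d*d i j k i′ j′ k′ = *-cong (minor-det₃ X i j k) (minor-det₃ X i′ j′ k′)

      grassmann-plücker : m i₁ i₂ i₃ * m j₁ j₂ j₃ ≈
        m j₁ i₂ i₃ * m i₁ j₂ j₃ + m j₂ i₂ i₃ * m j₁ i₁ j₃ + m j₃ i₂ i₃ * m j₁ j₂ i₁
      grassmann-plücker = begin
        m i₁ i₂ i₃ * m j₁ j₂ j₃  ≈⟨ m*m≈d*d i₁ i₂ i₃ j₁ j₂ j₃ ⟩
        d i₁ i₂ i₃ * d j₁ j₂ j₃
          ≈⟨ ring-≈ (ρ i₁ i₂ i₃ Vec.++ ρ j₁ j₂ j₃)
               (λ a₀ a₁ a₂ b₀ b₁ b₂ c₀ c₁ c₂ x₀ x₁ x₂ y₀ y₁ y₂ z₀ z₁ z₂ →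
                 let a = ⟨ a₀ , a₁ , a₂ ⟩
                     b = ⟨ b₀ , b₁ , b₂ ⟩
                     c = ⟨ c₀ , c₁ , c₂ ⟩
                     x = ⟨ x₀ , x₁ , x₂ ⟩
                     y = ⟨ y₀ , y₁ , y₂ ⟩
                     z = ⟨ z₀ , z₁ , z₂ ⟩
                 in det₃ᵉ a b c :* det₃ᵉ x y z ,
                    det₃ᵉ x b c :* det₃ᵉ a y z :+ det₃ᵉ y b c :* det₃ᵉ x a z :+
                    det₃ᵉ z b c :* det₃ᵉ x y a) ⟩
        d j₁ i₂ i₃ * d i₁ j₂ j₃ + d j₂ i₂ i₃ * d j₁ i₁ j₃ + d j₃ i₂ i₃ * d j₁ j₂ i₁
          ≈⟨ +-cong (+-cong (m*m≈d*d j₁ i₂ i₃ i₁ j₂ j₃) (m*m≈d*d j₂ i₂ i₃ j₁ i₁ j₃))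
                    (m*m≈d*d j₃ i₂ i₃ j₁ j₂ i₁) ⟨
        m j₁ i₂ i₃ * m i₁ j₂ j₃ + m j₂ i₂ i₃ * m j₁ i₁ j₃ + m j₃ i₂ i₃ * m j₁ j₂ i₁ ∎

-- Both branches realize the chirotope

module Realizability (ℝ : CompleteOrderedField) where
  open Polynomials
  open Configuration
  open CompleteOrderedField ℝ hiding (zero)
  open Evaluation commutativeRing
  open Matrices ℝ
  open OrderedField ℝ
  open LinearAlgebra ℝ
  open import Algebra.Properties.Ring ring

  configuration : Vec Carrier 3 → Matrix 3 13
  configuration ρ a k = ⟦ column a k ⟧ ρ

  evaluate : ∀ {m n} → Vec (Expr n) m → Vec Carrier n → Vec Carrier m
  evaluate σ ρ = Vec.map (λ e → ⟦ e ⟧ ρ) σ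

  eval-det₃ : ∀ {n} (xs ys zs : Vec (Poly n) 3) ρ {x y z : Vector} →
    (∀ a → evalᴾ n (lookup xs a) ρ ≈ x a) → (∀ a → evalᴾ n (lookup ys a) ρ ≈ y a) →
    (∀ a → evalᴾ n (lookup zs a) ρ ≈ z a) →
    evalᴾ n (normIn n (xs Vec.++ ys Vec.++ zs) det₃ᴱ) ρ ≈ det₃ x y z
  eval-det₃ {n} (x₀ ∷ x₁ ∷ x₂ ∷ []) (y₀ ∷ y₁ ∷ y₂ ∷ []) (z₀ ∷ z₁ ∷ z₂ ∷ []) ρ {x} {y} {z} p q r =
    normIn-correct n xyz ρ (coordinates x y z) eq det₃ᴱ
    where
    xyz : Vec (Poly n) 9
    xyz = x₀ ∷ x₁ ∷ x₂ ∷ y₀ ∷ y₁ ∷ y₂ ∷ z₀ ∷ z₁ ∷ z₂ ∷ []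
    eq : ∀ i → evalᴾ n (lookup xyz i) ρ ≈ lookup (coordinates x y z) i
    eq 0F = p (# 0)
    eq 1F = p (# 1)
    eq 2F = p (# 2)
    eq 3F = q (# 0)
    eq 4F = q (# 1)
    eq 5F = q (# 2)
    eq 6F = r (# 0)
    eq 7F = r (# 1)
    eq 8F = r (# 2)

  eval-column : ∀ {n} (σ : Vec (Expr n) 3) ρ k a →
    evalᴾ n (lookup (lookup (columnsAt σ) k) a) ρ ≈ configuration (evaluate σ ρ) a k
  eval-column {n} σ ρ k a = trans
    (reflexive (≡.cong (λ p → evalᴾ n p ρ)
      (≡.trans (≡.cong (λ c → lookup c a) (lookup-map k (Vec.map (normIn n (Vec.map norm σ))) columns))
               (lookup-map a (normIn n (Vec.map norm σ)) (lookup columns k)))))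
    (normIn-correct n (Vec.map norm σ) ρ (evaluate σ ρ) eq (column a k))
    where
    eq : ∀ i → evalᴾ n (lookup (Vec.map norm σ) i) ρ ≈ lookup (evaluate σ ρ) i
    eq i = trans (reflexive (≡.cong (λ p → evalᴾ n p ρ) (lookup-map i norm σ)))
          (trans (norm-correct (lookup σ i) ρ)
                 (reflexive (≡.sym (lookup-map i (λ e → ⟦ e ⟧ ρ) σ))))

  -- Connects the polynomials inspected by the boolean checks with the real minors of the
  -- configuration.
  eval-minor : ∀ {n} (σ : Vec (Expr n) 3) ρ i j k →
    evalᴾ n (minorᴾ (columnsAt σ) i j k) ρ ≈ minor (configuration (evaluate σ ρ)) (i ∷ j ∷ k ∷ [])
  eval-minor σ ρ i j k = trans
    (eval-det₃ (lookup (columnsAt σ) i) (lookup (columnsAt σ) j) (lookup (columnsAt σ) k) ρ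
      {col X i} {col X j} {col X k}
      (eval-column σ ρ i) (eval-column σ ρ j) (eval-column σ ρ k))
    (sym (minor-det₃ X i j k))
    where
    X : Matrix 3 13
    X = configuration (evaluate σ ρ)

  X₀ : Matrix 3 13
  X₀ = configuration (evaluate basePoint [])

  χ-X₀ : ∀ i → χ i ≡ chirotope X₀ i
  χ-X₀ (i ∷ j ∷ k ∷ []) = ≡.sym (hasSign⇒sgn (signℤ p)
    (hasSign-cong (signℤ p) (eval-minor basePoint [] i j k) (hasSign-ℤ p)))
    where
    p = minorᴾ (columnsAt basePoint) i j k

  <⇒<ᶠ : ∀ {n} {i j : Fin n} → toℕ i ℕ.< toℕ j → T (i <ᶠ j)
  <⇒<ᶠ = ℕ.<⇒<ᵇ

  -- Both chirotopes alternate, so sorting a triple by adjacent transpositions changes both signs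
  -- alike, and triples with a repetition give zero on both sides.
  agreement-on-increasing : ∀ {n} (X Y : Matrix 3 n) →
    (∀ i j k → T (i <ᶠ j) → T (j <ᶠ k) →
      chirotope X (i ∷ j ∷ k ∷ []) ≡ chirotope Y (i ∷ j ∷ k ∷ [])) →
    ∀ i → chirotope X i ≡ chirotope Y i
  agreement-on-increasing {n} X Y increasing = λ { (i ∷ j ∷ k ∷ []) → agree i j k }
    where
    Agree : Fin n → Fin n → Fin n → Set
    Agree i j k = chirotope X (i ∷ j ∷ k ∷ []) ≡ chirotope Y (i ∷ j ∷ k ∷ [])

    swap₁₂ : ∀ {i j k} → Agree i j k → Agree j i k
    swap₁₂ {i} {j} {k} eq = ≡.trans (chirotope-swap₁₂ X i j k)
      (≡.trans (≡.cong -ˢ_ eq) (≡.sym (chirotope-swap₁₂ Y i j k)))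

    swap₂₃ : ∀ {i j k} → Agree i j k → Agree i k j
    swap₂₃ {i} {j} {k} eq = ≡.trans (chirotope-swap₂₃ X i j k)
      (≡.trans (≡.cong -ˢ_ eq) (≡.sym (chirotope-swap₂₃ Y i j k)))

    repeat : ∀ {i k} → Agree i i k
    repeat {i} {k} = ≡.trans (chirotope-repeat X i k) (≡.sym (chirotope-repeat Y i k))

    i<j : ∀ {i j} k → toℕ i ℕ.< toℕ j → Agree i j k
    i<j {i} {j} k p with Fin.<-cmp j k | Fin.<-cmp i k
    ... | tri< q _ _      | _               = increasing i j k (<⇒<ᶠ p) (<⇒<ᶠ q)
    ... | tri≈ _ ≡.refl _ | _               = swap₁₂ (swap₂₃ repeat)
    ... | tri> _ _ q      | tri< r _ _      = swap₂₃ (increasing i k j (<⇒<ᶠ r) (<⇒<ᶠ q))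
    ... | tri> _ _ q      | tri≈ _ ≡.refl _ = swap₂₃ repeat
    ... | tri> _ _ q      | tri> _ _ r      = swap₂₃ (swap₁₂ (increasing k i j (<⇒<ᶠ r) (<⇒<ᶠ p)))

    agree : ∀ i j k → Agree i j k
    agree i j k with Fin.<-cmp i j
    ... | tri< p _ _      = i<j k p
    ... | tri≈ _ ≡.refl _ = repeat
    ... | tri> _ _ p      = swap₁₂ (i<j k p)

  ==-sound : ∀ s t → T (s == t) → s ≡ t
  ==-sound -1ˢ -1ˢ _ = ≡.refl
  ==-sound 0ˢ  0ˢ  _ = ≡.refl
  ==-sound +1ˢ +1ˢ _ = ≡.refl

  coefficientCheck-sound : ∀ p s {ρ} → T (coefficientCheck p s) → All (0# <_) ρ →
                           HasSign s (evalᴾ 2 p ρ)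
  coefficientCheck-sound p s c 0<ρ with coefficientSign 2 p in eq
  ... | just t = hasSign-evalᴾ 2 p (≡.trans eq (≡.cong just (==-sound t s c))) 0<ρ

  goldenCheck-sound : ∀ p s {ρ} → T (goldenCheck p s) → All (0# <_) ρ → 0# < ⟦ golden ⟧ ρ →
                      HasSign s (evalᴾ 2 p ρ)
  goldenCheck-sound p s {ρ@(a ∷ b ∷ [])} c (0<a ∷ 0<b ∷ []) 0<g
    with Equivalence.to (T-∧ {s == -1ˢ}) c
  ... | c₁ , c₂ rewrite ==-sound s -1ˢ c₁ = <-respˡ (sym (+-inverseˡ-unique _ _ p+m≈0))
      (0<x⇒-x<0 (*-positive _ _ 0<g (*-positive _ _ (+-positive 0<a 0<b) (+-positive 0<a 0<b))))
    where
    p+m≈0 : evalᴾ 2 p ρ + ⟦ goldenMinor ⟧ ρ ≈ 0#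
    p+m≈0 = trans (+-congˡ (sym (norm-correct goldenMinor ρ)))
           (trans (sym (eval-add 2 p (norm goldenMinor) ρ))
                  (eval-isZero 2 (add 2 p (norm goldenMinor)) ρ c₂))

  check₁-sound : ∀ p s {ρ} → T (check₁ p s) → All (0# <_) ρ → 0# < ⟦ golden ⟧ ρ →
                 HasSign s (evalᴾ 2 p ρ)
  check₁-sound p s c 0<ρ 0<g with Equivalence.to (T-∨ {coefficientCheck p s}) c
  ... | inj₁ c₁ = coefficientCheck-sound p s c₁ 0<ρ
  ... | inj₂ c₂ = goldenCheck-sound p s c₂ 0<ρ 0<g

  chirotope-branch₁ : ∀ {α β} → 0# < α → 0# < β → 0# < ⟦ golden ⟧ (α ∷ β ∷ []) →
    ∀ i → chirotope (configuration (evaluate branch₁ (α ∷ β ∷ []))) i ≡ χ i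
  chirotope-branch₁ {α} {β} 0<α 0<β 0<g i =
    ≡.trans (agreement-on-increasing (configuration (evaluate branch₁ (α ∷ β ∷ []))) X₀ agree i)
            (≡.sym (χ-X₀ i))
    where
    ρ = α ∷ β ∷ []
    agree : ∀ i j k → T (i <ᶠ j) → T (j <ᶠ k) →
      chirotope (configuration (evaluate branch₁ ρ)) (i ∷ j ∷ k ∷ []) ≡ chirotope X₀ (i ∷ j ∷ k ∷ [])
    agree i j k i<j j<k = ≡.trans
      (hasSign⇒sgn s (hasSign-cong s (eval-minor branch₁ ρ i j k) sign)) (χ-X₀ (i ∷ j ∷ k ∷ []))
      where
      p = minorᴾ (columnsAt branch₁) i j k
      s = χ (i ∷ j ∷ k ∷ [])
      sign : HasSign s (evalᴾ 2 p ρ)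
      sign = check₁-sound p s
        (allIncreasing-sound (checkMinor check₁ (columnsAt branch₁) (columnsAt basePoint))
                             signs₁ i j k i<j j<k)
        (0<α ∷ 0<β ∷ []) 0<g

  chirotope-branch₂ : ∀ {α β} → 0# < α → 0# < β →
    ∀ i → chirotope (configuration (evaluate branch₂ (α ∷ β ∷ []))) i ≡ χ i
  chirotope-branch₂ {α} {β} 0<α 0<β i =
    ≡.trans (agreement-on-increasing (configuration (evaluate branch₂ (α ∷ β ∷ []))) X₀ agree i)
            (≡.sym (χ-X₀ i))
    where
    ρ = α ∷ β ∷ []
    agree : ∀ i j k → T (i <ᶠ j) → T (j <ᶠ k) →
      chirotope (configuration (evaluate branch₂ ρ)) (i ∷ j ∷ k ∷ []) ≡ chirotope X₀ (i ∷ j ∷ k ∷ [])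
    agree i j k i<j j<k = ≡.trans
      (hasSign⇒sgn s (hasSign-cong s (eval-minor branch₂ ρ i j k)
        (coefficientCheck-sound p s
          (allIncreasing-sound (checkMinor coefficientCheck (columnsAt branch₂) (columnsAt basePoint))
                               signs₂ i j k i<j j<k)
          (0<α ∷ 0<β ∷ []))))
      (χ-X₀ (i ∷ j ∷ k ∷ []))
      where
      p = minorᴾ (columnsAt branch₂) i j k
      s = χ (i ∷ j ∷ k ∷ [])

  -- The axioms are inherited from the real matrix `X₀`, whose chirotope is `χ`.
  matroid : OrientedMatroid 3 13
  matroid = record
    { χ           = χ
    ; nontrivial  = (# 0 ∷ # 1 ∷ # 2 ∷ []) , λ ()
    ; alternating = λ i σ → ≡.trans (χ-X₀ (tabulate (λ k → lookup i (σ ⟨$⟩ʳ k))))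
                            (≡.trans (chirotope-alternating X₀ i σ)
                              (≡.cong (sgnPerm σ *ˢ_) (≡.sym (χ-X₀ i))))
    ; exchange    = λ i j p → ≡.subst NonNegative (≡.sym (χ*χ i j))
        (chirotope-exchange X₀ i j λ k →
          ≡.subst NonNegative (χ*χ (i [ first ]≔ lookup j k) (j [ k ]≔ lookup i first)) (p k))
    }
    where
    χ*χ : ∀ i j → χ i *ˢ χ j ≡ chirotope X₀ i *ˢ chirotope X₀ j
    χ*χ i j = ≡.cong₂ _*ˢ_ (χ-X₀ i) (χ-X₀ j)

-- Continuity of polynomial functions

module Continuity (ℝ : CompleteOrderedField) where
  open Polynomials
  open CompleteOrderedField ℝ hiding (zero)
  open Evaluation commutativeRing
  open OrderedField ℝ
  open import Algebra.Properties.Ring ring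

  abstract
    inverse-positive : ∀ {x} → 0# < x → ∃[ y ] 0# < y × x * y ≈ 1#
    inverse-positive {x} 0<x with *-inverse x (positive⇒≉0 0<x)
    ... | y , xy≈1 = y , positive-cancelˡ +1ˢ 0<x (<-respʳ (sym xy≈1) 0<1) , xy≈1

    half : ∀ {x} → 0# < x → ∃[ y ] 0# < y × y < x × y + y ≈ x
    half {x} 0<x with inverse-positive (+-positive 0<1 0<1)
    ... | h , 0<h , 2h≈1 =
      h * x , 0<hx , <-respʳ sum≈x (<-respˡ (+-identityˡ _) (+-monoˡ-< 0# _ _ 0<hx)) , sum≈x
      where
      0<hx : 0# < h * x
      0<hx = *-positive _ _ 0<h 0<x
      sum≈x : h * x + h * x ≈ x
      sum≈x = trans (ring-≈ (h ∷ x ∷ []) λ h x → h :* x :+ h :* x , con (+ 2) :* h :* x)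
             (trans (*-congʳ 2h≈1) (*-identityˡ x))

    below-both : ∀ {a b} → 0# < a → 0# < b → ∃[ c ] 0# < c × c < a × c < b
    below-both {a} {b} 0<a 0<b with compare a b
    ... | tri< a<b _ _ = let c , 0<c , c<a , _ = half 0<a in c , 0<c , c<a , <-trans c<a a<b
    ... | tri≈ _ a≈b _ = let c , 0<c , c<a , _ = half 0<a in c , 0<c , c<a , <-respʳ a≈b c<a
    ... | tri> _ _ b<a = let c , 0<c , c<b , _ = half 0<b in c , 0<c , <-trans c<b b<a , c<b

  -- ∣ x ∣ < e.
  Within : Carrier → Carrier → Set
  Within e x = 0# < e - x × 0# < e + x

  within-cong : ∀ {e d x y} → e ≈ d → x ≈ y → Within e x → Within d y
  within-cong e≈d x≈y (p , q) = <-respʳ (+-cong e≈d (-‿cong x≈y)) p , <-respʳ (+-cong e≈d x≈y) q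

  within-weaken : ∀ {d e x} → d < e → Within d x → Within e x
  within-weaken {d} {e} {x} d<e (p , q) =
    <-respʳ (ring-≈ (d ∷ e ∷ x ∷ []) λ d e x → (e :- d) :+ (d :- x) , e :- x)
            (+-positive (x<y⇒0<y-x d<e) p) ,
    <-respʳ (ring-≈ (d ∷ e ∷ x ∷ []) λ d e x → (e :- d) :+ (d :+ x) , e :+ x)
            (+-positive (x<y⇒0<y-x d<e) q)

  within-+ : ∀ {d e x y} → Within d x → Within e y → Within (d + e) (x + y)
  within-+ {d} {e} {x} {y} (p , q) (p′ , q′) =
    <-respʳ (ring-≈ (d ∷ e ∷ x ∷ y ∷ []) λ d e x y → (d :- x) :+ (e :- y) , d :+ e :- (x :+ y))
            (+-positive p p′) ,
    <-respʳ (ring-≈ (d ∷ e ∷ x ∷ y ∷ []) λ d e x y → (d :+ x) :+ (e :+ y) , d :+ e :+ (x :+ y))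
            (+-positive q q′)

  within-neg : ∀ {e x} → Within e x → Within e (- x)
  within-neg {e} {x} (p , q) = <-respʳ (ring-≈ (e ∷ x ∷ []) λ e x → e :+ x , e :- (:- x)) q , p

  -- The identities `2(de - xy) = (d - x)(e + y) + (d + x)(e - y)` and `2(de + xy) = (d - x)(e - y)
  -- + (d + x)(e + y)` replace a case distinction on the signs of `x` and `y`.
  within-* : ∀ {d e x y} → Within d x → Within e y → Within (d * e) (x * y)
  within-* {d} {e} {x} {y} (p , q) (p′ , q′) =
    positive-cancelˡ +1ˢ (+-positive 0<1 0<1)
      (<-respʳ (ring-≈ (d ∷ e ∷ x ∷ y ∷ []) λ d e x y →
                 (d :- x) :* (e :+ y) :+ (d :+ x) :* (e :- y) , con (+ 2) :* (d :* e :- x :* y))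
               (+-positive (*-positive _ _ p q′) (*-positive _ _ q p′))) ,
    positive-cancelˡ +1ˢ (+-positive 0<1 0<1)
      (<-respʳ (ring-≈ (d ∷ e ∷ x ∷ y ∷ []) λ d e x y →
                 (d :- x) :* (e :- y) :+ (d :+ x) :* (e :+ y) , con (+ 2) :* (d :* e :+ x :* y))
               (+-positive (*-positive _ _ p p′) (*-positive _ _ q q′)))

  within-0 : ∀ {e x} → 0# < e → x ≈ 0# → Within e x
  within-0 {e} 0<e x≈0 =
    <-respʳ (trans (sym (+-identityʳ e)) (+-congˡ (trans (sym -0#≈0#) (-‿cong (sym x≈0))))) 0<e ,
    <-respʳ (trans (sym (+-identityʳ e)) (+-congˡ (sym x≈0))) 0<e

  abstract
    bounded : ∀ x → ∃[ K ] 0# < K × Within K x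
    bounded x with compare x 0#
    ... | tri< x<0 _ _ = 1# - x , +-positive 0<1 (x<0⇒0<-x x<0) ,
      <-respʳ (ring-≈ (x ∷ []) λ x → con (+ 1) :+ ((:- x) :+ (:- x)) , con (+ 1) :- x :- x)
              (+-positive 0<1 (+-positive (x<0⇒0<-x x<0) (x<0⇒0<-x x<0))) ,
      <-respʳ (ring-≈ (x ∷ []) λ x → con (+ 1) , con (+ 1) :- x :+ x) 0<1
    ... | tri≈ _ x≈0 _ = 1# , 0<1 , within-0 0<1 x≈0
    ... | tri> _ _ 0<x = 1# + x , +-positive 0<1 0<x ,
      <-respʳ (ring-≈ (x ∷ []) λ x → con (+ 1) , con (+ 1) :+ x :- x) 0<1 ,
      <-respʳ (ring-≈ (x ∷ []) λ x → con (+ 1) :+ (x :+ x) , con (+ 1) :+ x :+ x)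
              (+-positive 0<1 (+-positive 0<x 0<x))

  Eventually : Carrier → (Carrier → Set) → Set
  Eventually t P = ∃[ δ ] 0# < δ × (∀ s → Within δ (s - t) → P s)

  eventually-× : ∀ {t P Q} → Eventually t P → Eventually t Q → Eventually t (λ s → P s × Q s)
  eventually-× (δ₁ , 0<δ₁ , p) (δ₂ , 0<δ₂ , q) with below-both 0<δ₁ 0<δ₂
  ... | δ , 0<δ , δ<δ₁ , δ<δ₂ =
    δ , 0<δ , λ s w → p s (within-weaken δ<δ₁ w) , q s (within-weaken δ<δ₂ w)

  eventually-map : ∀ {t} {P Q : Carrier → Set} → (∀ s → P s → Q s) →
                   Eventually t P → Eventually t Q
  eventually-map f (δ , 0<δ , p) = δ , 0<δ , λ s w → f s (p s w)

  eventually-∀ : ∀ {n t} {P : Fin n → Carrier → Set} → (∀ k → Eventually t (P k)) →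
                 Eventually t (λ s → ∀ k → P k s)
  eventually-∀ {zero}  p = 1# , 0<1 , λ s w ()
  eventually-∀ {suc n} p = eventually-map
    (λ { s (p₀ , ps) → λ { 0F → p₀ ; (suc k) → ps k } })
    (eventually-× (p 0F) (eventually-∀ (λ k → p (suc k))))

  ContinuousAt : Carrier → (Carrier → Carrier) → Set
  ContinuousAt t f = ∀ ε → 0# < ε → Eventually t (λ s → Within ε (f s - f t))

  continuous-constant : ∀ {t} c → ContinuousAt t (λ _ → c)
  continuous-constant c ε 0<ε = 1# , 0<1 , λ s w → within-0 0<ε (-‿inverseʳ c)

  continuous-id : ∀ {t} → ContinuousAt t (λ x → x)
  continuous-id ε 0<ε = ε , 0<ε , λ s w → w

  continuous-neg : ∀ {t f} → ContinuousAt t f → ContinuousAt t (λ x → - f x)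
  continuous-neg {t} {f} cf ε 0<ε = eventually-map
    (λ s w → within-cong refl (ring-≈ (f s ∷ f t ∷ []) λ x y → :- (x :- y) , :- x :- :- y)
                         (within-neg w))
    (cf ε 0<ε)

  continuous-+ : ∀ {t f g} → ContinuousAt t f → ContinuousAt t g → ContinuousAt t (λ x → f x + g x)
  continuous-+ {t} {f} {g} cf cg ε 0<ε with half 0<ε
  ... | e , 0<e , _ , e+e≈ε = eventually-map near (eventually-× (cf e 0<e) (cg e 0<e))
    where
    near : ∀ s → Within e (f s - f t) × Within e (g s - g t) → Within ε ((f s + g s) - (f t + g t))
    near s (w , w′) = within-cong e+e≈ε
      (ring-≈ (f s ∷ f t ∷ g s ∷ g t ∷ []) λ x x′ y y′ →
        (x :- x′) :+ (y :- y′) , (x :+ y) :- (x′ :+ y′))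
      (within-+ w w′)

  -- The difference of products is `(f s - f t) * g s + f t * (g s - g t)`. With `K` and `L`
  -- bounding `f t` and `g t`, the value `g s` is bounded by `1# + L` once it is within `1#` of
  -- `g t`, so the tolerances `e / (1 + L)` and `e / K` make each summand smaller than `e`, half of
  -- `ε`.
  continuous-* : ∀ {t f g} → ContinuousAt t f → ContinuousAt t g → ContinuousAt t (λ x → f x * g x)
  continuous-* {t} {f} {g} cf cg ε 0<ε
    with half 0<ε | bounded (f t) | bounded (g t)
  ... | e , 0<e , _ , e+e≈ε | K , 0<K , wf | L , 0<L , wg
    with inverse-positive 0<K | inverse-positive (+-positive 0<1 0<L)
  ... | K⁻¹ , 0<K⁻¹ , KK⁻¹≈1 | L⁻¹ , 0<L⁻¹ , LL⁻¹≈1 = eventually-map near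
    (eventually-× (cf (e * L⁻¹) (*-positive _ _ 0<e 0<L⁻¹))
      (eventually-× (cg 1# 0<1) (cg (e * K⁻¹) (*-positive _ _ 0<e 0<K⁻¹))))
    where
    cancel : ∀ i x → x * i ≈ 1# → e * i * x ≈ e
    cancel i x xi≈1 = trans (ring-≈ (e ∷ i ∷ x ∷ []) λ e i x → e :* i :* x , e :* (x :* i))
                     (trans (*-congˡ xi≈1) (*-identityʳ e))
    cancel′ : ∀ i x → x * i ≈ 1# → x * (e * i) ≈ e
    cancel′ i x xi≈1 = trans (*-comm x (e * i)) (cancel i x xi≈1)

    near : ∀ s → Within (e * L⁻¹) (f s - f t) × Within 1# (g s - g t) × Within (e * K⁻¹) (g s - g t) →
           Within ε (f s * g s - f t * g t)
    near s (w , w₁ , w₂) = within-cong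
      (trans (+-cong (cancel L⁻¹ (1# + L) LL⁻¹≈1) (cancel′ K⁻¹ K KK⁻¹≈1)) e+e≈ε)
      (ring-≈ (f s ∷ f t ∷ g s ∷ g t ∷ []) λ x x′ y y′ →
        (x :- x′) :* ((y :- y′) :+ y′) :+ x′ :* (y :- y′) , x :* y :- x′ :* y′)
      (within-+ (within-* w (within-+ w₁ wg)) (within-* wf w₂))

  continuous-⟦⟧ : ∀ {n t} (e : Expr n) (γ : Carrier → Vec Carrier n) →
                  (∀ i → ContinuousAt t (λ x → lookup (γ x) i)) → ContinuousAt t (λ x → ⟦ e ⟧ (γ x))
  continuous-⟦⟧ (con c)  γ cγ = continuous-constant _
  continuous-⟦⟧ (var i)  γ cγ = cγ i
  continuous-⟦⟧ (e :+ f) γ cγ =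
    continuous-+ {f = λ x → ⟦ e ⟧ (γ x)} {λ x → ⟦ f ⟧ (γ x)}
                 (continuous-⟦⟧ e γ cγ) (continuous-⟦⟧ f γ cγ)
  continuous-⟦⟧ (e :* f) γ cγ =
    continuous-* {f = λ x → ⟦ e ⟧ (γ x)} {λ x → ⟦ f ⟧ (γ x)}
                 (continuous-⟦⟧ e γ cγ) (continuous-⟦⟧ f γ cγ)
  continuous-⟦⟧ (:- e)   γ cγ =
    continuous-neg {f = λ x → ⟦ e ⟧ (γ x)} (continuous-⟦⟧ e γ cγ)

  continuous-mix : ∀ {t} x y → ContinuousAt t (λ s → mix s x y)
  continuous-mix {t} x y = continuous-⟦⟧
    ((con (+ 1) :- var (# 0)) :* var (# 1) :+ var (# 0) :* var (# 2)) (λ s → s ∷ x ∷ y ∷ [])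
    λ { 0F → continuous-id ; 1F → continuous-constant x ; 2F → continuous-constant y }

-- Paths of realizations and the connectedness of the unit interval

module Paths (ℝ : CompleteOrderedField) {r n : ℕ} .{{_ : NonZero r}} (M : OrientedMatroid r n) where
  open Polynomials
  open CompleteOrderedField ℝ hiding (zero)
  open Evaluation commutativeRing
  open Matrices ℝ
  open OrderedField ℝ
  open Continuity ℝ
  open RealizationSpace ℝ M
  open import Algebra.Properties.Ring ring

  -- The curve of matrices is defined for all parameters, which keeps continuity free of side
  -- conditions; the realizations exist on the unit interval and are tied to the curve only by
  -- pointwise equality of matrices.
  record Path : Set where
    field
      curve      : Carrier → Matrix r n
      continuous : ∀ t a b → ContinuousAt t (λ s → curve s a b)
      point      : ∀ t → 0# ≤ t → t ≤ 1# → Realization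
      on-curve   : ∀ t p q → matrix (point t p q) ≋ curve t

  <-irreflexive : ∀ {x} → ¬ x < x
  <-irreflexive = <-irrefl refl

  0≤0 : 0# ≤ 0#
  0≤0 = <-irreflexive

  0≤1 : 0# ≤ 1#
  0≤1 = <-asym 0<1

  1≤1 : 1# ≤ 1#
  1≤1 = <-irreflexive

  abstract
    -- The conclusion covers all proofs of `0# ≤ s` and `s ≤ 1#`, because `point` takes these proofs
    -- as arguments and `U` could tell the resulting realizations apart.
    open⇒eventually : ∀ (γ : Path) {U} → IsOpen U → ∀ t p q → U (Path.point γ t p q) →
      Eventually t (λ s → ∀ p′ q′ → U (Path.point γ s p′ q′))
    open⇒eventually γ (_ , U-open) t p q Ut with U-open (Path.point γ t p q) Ut
    ... | ε , 0<ε , near = eventually-map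
      (λ s close p′ q′ → near (point s p′ q′) λ a b →
        to-close (on-curve t p q a b) (on-curve s p′ q′ a b) (close a b))
      (eventually-∀ λ a → eventually-∀ λ b → continuous t a b ε 0<ε)
      where
      open Path γ
      to-close : ∀ {x x′ y y′} → x ≈ x′ → y ≈ y′ → Within ε (y′ - x′) →
                 (- ε < x - y) × (x - y < ε)
      to-close {x} {x′} {y} {y′} x≈x′ y≈y′ w
        with within-cong {y = x - y} refl
               (trans (ring-≈ (y′ ∷ x′ ∷ []) λ y x → :- (y :- x) , x :- y)
                      (+-cong (sym x≈x′) (-‿cong (sym y≈y′))))
               (within-neg w)
      ... | u , l = 0<y-x⇒x<y (<-respʳ (ring-≈ (ε ∷ x ∷ y ∷ []) λ e x y →
                      e :+ (x :- y) , x :- y :- :- e) l) , 0<y-x⇒x<y u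

  -- Let `s` be the supremum of the parameters in `U`. If `s` belongs to `U`, then either `U`
  -- continues beyond `s`, or `s` is the end point, which lies in `V`. If `s` belongs to `V`, so
  -- does an interval to its left, and `s - δ` is a smaller upper bound.
  path-not-separated : ∀ (γ : Path) {U V} → IsOpen U → IsOpen V →
    Universal (U ∪ V) → Empty (U ∩ V) →
    U (Path.point γ 0# 0≤0 0≤1) → ¬ V (Path.point γ 1# 0≤1 1≤1)
  path-not-separated γ {U} {V} U-open V-open cover disjoint U₀ V₁ = case-s (cover (point s 0≤s s≤1))
    where
    open Path γ

    P : Pred Carrier 0ℓ
    P t = ∃[ p ] ∃[ q ] U (point t p q)

    sup : ∃[ s ] UpperBound P s × (∀ u → UpperBound P u → s ≤ u)
    sup = supremum P (0# , 0≤0 , 0≤1 , U₀) (1# , λ { t (_ , t≤1 , _) → t≤1 })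

    s : Carrier
    s = proj₁ sup
    bound : UpperBound P s
    bound = proj₁ (proj₂ sup)
    least : ∀ u → UpperBound P u → s ≤ u
    least = proj₂ (proj₂ sup)

    0≤s : 0# ≤ s
    0≤s = bound 0# (0≤0 , 0≤1 , U₀)
    s≤1 : s ≤ 1#
    s≤1 = least 1# λ { t (_ , t≤1 , _) → t≤1 }

    case-s : (U ∪ V) (point s 0≤s s≤1) → ⊥
    case-s (inj₁ Us) with open⇒eventually γ U-open s 0≤s s≤1 Us | ≤-cases s≤1
    -- Here `s` only equals `1#` up to `_≈_`, so the end point is reached as a member of the
    -- neighbourhood of `s`.
    ... | δ , 0<δ , near | inj₂ s≈1 =
      disjoint _ (near 1# (within-0 0<δ (trans (+-congˡ (-‿cong s≈1)) (-‿inverseʳ 1#))) 0≤1 1≤1 , V₁)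
    ... | δ , 0<δ , near | inj₁ s<1 with below-both 0<δ (x<y⇒0<y-x s<1)
    ... | h , 0<h , h<δ , h<1-s = bound t (0≤t , t≤1 , near t close 0≤t t≤1) s<t
      where
      t : Carrier
      t = s + h
      s<t : s < t
      s<t = 0<y-x⇒x<y (<-respʳ (ring-≈ (s ∷ h ∷ []) λ s h → h , s :+ h :- s) 0<h)
      t<1 : t < 1#
      t<1 = 0<y-x⇒x<y (<-respʳ (ring-≈ (s ∷ h ∷ []) λ s h →
              con (+ 1) :- s :- h , con (+ 1) :- (s :+ h)) (x<y⇒0<y-x h<1-s))
      0≤t : 0# ≤ t
      0≤t t<0 = 0≤s (<-trans s<t t<0)
      t≤1 : t ≤ 1#
      t≤1 = <-asym t<1
      close : Within δ (t - s)
      close = within-cong refl (ring-≈ (s ∷ h ∷ []) λ s h → h , s :+ h :- s)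
        (x<y⇒0<y-x h<δ , +-positive 0<δ 0<h)
    case-s (inj₂ Vs) with open⇒eventually γ V-open s 0≤s s≤1 Vs
    ... | δ , 0<δ , near = least (s - δ) earlier
      (0<y-x⇒x<y (<-respʳ (ring-≈ (s ∷ δ ∷ []) λ s d → d , s :- (s :- d)) 0<δ))
      where
      earlier : UpperBound P (s - δ)
      earlier t (p , q , Ut) s-δ<t = disjoint _ (Ut , near t (above , below) p q)
        where
        above : 0# < δ - (t - s)
        above with ≤-cases (bound t (p , q , Ut))
        ... | inj₁ t<s = <-respʳ (ring-≈ (s ∷ δ ∷ t ∷ []) λ s d t → d :+ (s :- t) , d :- (t :- s))
                                 (+-positive 0<δ (x<y⇒0<y-x t<s))
        ... | inj₂ t≈s = <-respʳ (trans (ring-≈ (s ∷ δ ∷ []) λ s d → d , d :- (s :- s))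
                                        (+-congˡ (-‿cong (+-congʳ (sym t≈s))))) 0<δ
        below : 0# < δ + (t - s)
        below = <-respʳ (ring-≈ (s ∷ δ ∷ t ∷ []) λ s d t → t :- (s :- d) , d :+ (t :- s))
                        (x<y⇒0<y-x s-δ<t)

-- Points as meets of lines, and the equation of the two branches

module Incidence (ℝ : CompleteOrderedField) where
  open Polynomials
  open Configuration
  open CompleteOrderedField ℝ hiding (zero)
  open Evaluation commutativeRing
  open Matrices ℝ
  open OrderedField ℝ
  open LinearAlgebra ℝ
  open Realizability ℝ
  open import Algebra.Properties.Ring ring

  next : Fin 3 → Fin 3
  next 0F = # 1
  next 1F = # 2
  next 2F = # 0

  infixl 7 _⨯_ _⨯ᴱ_
  -- On homogeneous coordinates the cross product is both the line through two points and the meet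
  -- of two lines.
  _⨯_ : Vector → Vector → Vector
  (x ⨯ y) a = x (next a) * y (next (next a)) - x (next (next a)) * y (next a)

  _⨯ᴱ_ : ∀ {n} → (Fin 3 → Expr n) → (Fin 3 → Expr n) → Fin 3 → Expr n
  (x ⨯ᴱ y) a = x (next a) :* y (next (next a)) :- x (next (next a)) :* y (next a)

  ≉0⇒⊥⇒≈0 : ∀ {x} → ¬ (x ≉ 0#) → x ≈ 0#
  ≉0⇒⊥⇒≈0 {x} p with compare x 0#
  ... | tri< _ q _ = contradiction q p
  ... | tri≈ _ q _ = q
  ... | tri> _ q _ = contradiction q p

  parallel : ∀ p y → (∀ a → (p ⨯ y) a ≈ 0#) → ∀ i j → p i * y j ≈ p j * y i
  parallel p y eq 0F 0F = refl
  parallel p y eq 0F 1F = x∙y⁻¹≈ε⇒x≈y _ _ (eq (# 2))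
  parallel p y eq 0F 2F = sym (x∙y⁻¹≈ε⇒x≈y _ _ (eq (# 1)))
  parallel p y eq 1F 0F = sym (x∙y⁻¹≈ε⇒x≈y _ _ (eq (# 2)))
  parallel p y eq 1F 1F = refl
  parallel p y eq 1F 2F = x∙y⁻¹≈ε⇒x≈y _ _ (eq (# 0))
  parallel p y eq 2F 0F = x∙y⁻¹≈ε⇒x≈y _ _ (eq (# 1))
  parallel p y eq 2F 1F = sym (x∙y⁻¹≈ε⇒x≈y _ _ (eq (# 0)))
  parallel p y eq 2F 2F = refl

  -- p lies on the lines through a, b and through c, d.
  meet-⨯ : ∀ p a b c d → det₃ p a b ≈ 0# → det₃ p c d ≈ 0# →
           ∀ i → (p ⨯ ((a ⨯ b) ⨯ (c ⨯ d))) i ≈ 0#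
  meet-⨯ p a b c d pab≈0 pcd≈0 i = trans (identity i)
    (trans (+-cong (*-congˡ pcd≈0) (-‿cong (*-congˡ pab≈0)))
           (ring-≈ ((a ⨯ b) i ∷ (c ⨯ d) i ∷ []) λ x y → x :* con (+ 0) :- y :* con (+ 0) , con (+ 0)))
    where
    ρ : Vec Carrier 15
    ρ = p (# 0) ∷ p (# 1) ∷ p (# 2) ∷ a (# 0) ∷ a (# 1) ∷ a (# 2) ∷ b (# 0) ∷ b (# 1) ∷ b (# 2) ∷
        c (# 0) ∷ c (# 1) ∷ c (# 2) ∷ d (# 0) ∷ d (# 1) ∷ d (# 2) ∷ []
    pᴱ aᴱ bᴱ cᴱ dᴱ : Fin 3 → Expr 15
    pᴱ = ⟨ var (# 0)  , var (# 1)  , var (# 2)  ⟩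
    aᴱ = ⟨ var (# 3)  , var (# 4)  , var (# 5)  ⟩
    bᴱ = ⟨ var (# 6)  , var (# 7)  , var (# 8)  ⟩
    cᴱ = ⟨ var (# 9)  , var (# 10) , var (# 11) ⟩
    dᴱ = ⟨ var (# 12) , var (# 13) , var (# 14) ⟩
    lhs rhs : Fin 3 → Expr 15
    lhs = pᴱ ⨯ᴱ ((aᴱ ⨯ᴱ bᴱ) ⨯ᴱ (cᴱ ⨯ᴱ dᴱ))
    rhs i = (aᴱ ⨯ᴱ bᴱ) i :* det₃ᵉ pᴱ cᴱ dᴱ :- (cᴱ ⨯ᴱ dᴱ) i :* det₃ᵉ pᴱ aᴱ bᴱ
    identity : ∀ i → (p ⨯ ((a ⨯ b) ⨯ (c ⨯ d))) i ≈
                     (a ⨯ b) i * det₃ p c d - (c ⨯ d) i * det₃ p a b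
    identity 0F = expr-≈ (lhs (# 0)) (rhs (# 0)) ρ _
    identity 1F = expr-≈ (lhs (# 1)) (rhs (# 1)) ρ _
    identity 2F = expr-≈ (lhs (# 2)) (rhs (# 2)) ρ _

  ⨯-scaleʳ : ∀ p m y κ → (∀ a → m a ≈ κ * y a) → ∀ a → (p ⨯ m) a ≈ κ * (p ⨯ y) a
  ⨯-scaleʳ p m y κ eq a = trans
    (+-cong (*-congˡ (eq (next (next a)))) (-‿cong (*-congˡ (eq (next a)))))
    (ring-≈ (p (next a) ∷ p (next (next a)) ∷ y (next a) ∷ y (next (next a)) ∷ κ ∷ [])
      λ p q y z κ → p :* (κ :* z) :- q :* (κ :* y) , κ :* (p :* z :- q :* y))

  -- A point on both lines is parallel to their cross product `κ * y`; that `κ` is nonzero expresses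
  -- that the lines are distinct. The factor is `p t / y t`.
  meet : ∀ p a b c d y κ t → det₃ p a b ≈ 0# → det₃ p c d ≈ 0# →
         (∀ i → ((a ⨯ b) ⨯ (c ⨯ d)) i ≈ κ * y i) → κ ≉ 0# → y t ≉ 0# →
         ∃[ l ] ∀ i → p i ≈ l * y i
  meet p a b c d y κ t pab≈0 pcd≈0 m≈κy κ≉0 yt≉0 with *-inverse (y t) yt≉0
  ... | z , ytz≈1 = p t * z , λ i → trans (sym (*-identityʳ (p i)))
    (trans (*-congˡ (sym ytz≈1))
    (trans (sym (*-assoc _ _ _))
    (trans (*-congʳ (parallel p y p⨯y≈0 i t))
           (ring-≈ (p t ∷ y i ∷ z ∷ []) λ p y z → p :* y :* z , p :* z :* y))))
    where
    p⨯y≈0 : ∀ a → (p ⨯ y) a ≈ 0#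
    p⨯y≈0 i = *-cancel-≈0 κ≉0
      (trans (sym (⨯-scaleʳ p _ y κ m≈κy i)) (meet-⨯ p a b c d pab≈0 pcd≈0 i))

  -- The three lines are orthogonal to `p`, and Cramer's rule writes `p` times their determinant as
  -- a combination of these scalar products. So if `p` is nonzero, the lines are dependent.
  concurrent : ∀ p a b c d e f → det₃ p a b ≈ 0# → det₃ p c d ≈ 0# → det₃ p e f ≈ 0# →
               ∀ i → p i * det₃ (a ⨯ b) (c ⨯ d) (e ⨯ f) ≈ 0#
  concurrent p a b c d e f pab≈0 pcd≈0 pef≈0 = go
    where
    A B C : Vector
    A = a ⨯ b
    B = c ⨯ d
    C = e ⨯ f
    dot : ∀ a b → det₃ p a b ≈ 0# →
          p (# 0) * (a ⨯ b) (# 0) + p (# 1) * (a ⨯ b) (# 1) + p (# 2) * (a ⨯ b) (# 2) ≈ 0#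
    dot a b eq = trans (ring-≈ (coordinates p a b) λ p₀ p₁ p₂ a₀ a₁ a₂ b₀ b₁ b₂ →
      p₀ :* (a₁ :* b₂ :- a₂ :* b₁) :+ p₁ :* (a₂ :* b₀ :- a₀ :* b₂) :+ p₂ :* (a₀ :* b₁ :- a₁ :* b₀) ,
      det₃ᵉ ⟨ p₀ , p₁ , p₂ ⟩ ⟨ a₀ , a₁ , a₂ ⟩ ⟨ b₀ , b₁ , b₂ ⟩) eq
    ρ : Vec Carrier 12
    ρ = p (# 0) ∷ p (# 1) ∷ p (# 2) ∷ coordinates A B C
    pᴱ Aᴱ Bᴱ Cᴱ : Fin 3 → Expr 12
    pᴱ = ⟨ var (# 0) , var (# 1)  , var (# 2)  ⟩
    Aᴱ = ⟨ var (# 3) , var (# 4)  , var (# 5)  ⟩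
    Bᴱ = ⟨ var (# 6) , var (# 7)  , var (# 8)  ⟩
    Cᴱ = ⟨ var (# 9) , var (# 10) , var (# 11) ⟩
    dotᴱ : (Fin 3 → Expr 12) → Expr 12
    dotᴱ x = pᴱ (# 0) :* x (# 0) :+ pᴱ (# 1) :* x (# 1) :+ pᴱ (# 2) :* x (# 2)
    lhs rhs : Fin 3 → Expr 12
    lhs i = pᴱ i :* det₃ᵉ Aᴱ Bᴱ Cᴱ
    rhs i = dotᴱ Aᴱ :* (Bᴱ ⨯ᴱ Cᴱ) i :+ dotᴱ Bᴱ :* (Cᴱ ⨯ᴱ Aᴱ) i :+ dotᴱ Cᴱ :* (Aᴱ ⨯ᴱ Bᴱ) i
    vanish : ∀ i {x} → x ≈ ⟦ rhs i ⟧ ρ → x ≈ 0#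
    vanish i eq = trans eq (trans
      (+-cong (+-cong (*-congʳ (dot a b pab≈0)) (*-congʳ (dot c d pcd≈0))) (*-congʳ (dot e f pef≈0)))
      (ring-≈ (⟦ (Bᴱ ⨯ᴱ Cᴱ) i ⟧ ρ ∷ ⟦ (Cᴱ ⨯ᴱ Aᴱ) i ⟧ ρ ∷ ⟦ (Aᴱ ⨯ᴱ Bᴱ) i ⟧ ρ ∷ []) λ x y z →
        con (+ 0) :* x :+ con (+ 0) :* y :+ con (+ 0) :* z , con (+ 0)))
    go : ∀ i → p i * det₃ A B C ≈ 0#
    go 0F = vanish (# 0) (expr-≈ (lhs (# 0)) (rhs (# 0)) ρ _)
    go 1F = vanish (# 1) (expr-≈ (lhs (# 1)) (rhs (# 1)) ρ _)
    go 2F = vanish (# 2) (expr-≈ (lhs (# 2)) (rhs (# 2)) ρ _)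

  columnᴱ : Fin 13 → Fin 3 → Expr 3
  columnᴱ k a = column a k

  -- The point k of the configuration is the meet of the lines ij and lm.
  meetIdentity : (k i j l m : Fin 13) → Expr 3 → Fin 3 → Bool
  meetIdentity k i j l m κ a =
    isZero 3 (norm (((columnᴱ i ⨯ᴱ columnᴱ j) ⨯ᴱ (columnᴱ l ⨯ᴱ columnᴱ m)) a :- κ :* columnᴱ k a))

  meetCheck : (k i j l m : Fin 13) → Expr 3 → Bool
  meetCheck k i j l m κ = allFinᵇ (meetIdentity k i j l m κ)

  det₃-zeroʳ : ∀ x y z → (∀ a → z a ≈ 0#) → det₃ x y z ≈ 0#
  det₃-zeroʳ x y z z≈0 = trans
    (det₃-cong {x} {x} {y} {y} {z} {λ _ → 0#} (λ _ → refl) (λ _ → refl) z≈0)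
    (ring-≈ (coordinates x y y) λ x₀ x₁ x₂ y₀ y₁ y₂ _ _ _ →
      det₃ᵉ ⟨ x₀ , x₁ , x₂ ⟩ ⟨ y₀ , y₁ , y₂ ⟩ (λ _ → con (+ 0)) , con (+ 0))

  module Alignment (Z : Matrix 3 13) (Z-χ : ∀ i → chirotope Z i ≡ χ i)
                   (u v w : Carrier) where

    ρ : Vec Carrier 3
    ρ = u ∷ v ∷ w ∷ []

    Y : Matrix 3 13
    Y = configuration ρ

    sign-det₃ : ∀ i j k {s} → χ (i ∷ j ∷ k ∷ []) ≡ s → HasSign s (det₃ (col Z i) (col Z j) (col Z k))
    sign-det₃ i j k {s} eq = hasSign-cong s (minor-det₃ Z i j k)
      (sgn⇒hasSign (≡.trans (Z-χ (i ∷ j ∷ k ∷ [])) eq))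

    Aligned : Fin 13 → Set
    Aligned k = ∃[ l ] l ≉ 0# × (∀ a → Z a k ≈ l * Y a k)

    -- If the factor vanished, so would the column and its bracket with the points 0 and 1, which
    -- `χ` requires to be positive.
    aligned : ∀ k → χ (# 0 ∷ # 1 ∷ k ∷ []) ≡ +1ˢ → (∃[ l ] ∀ a → Z a k ≈ l * Y a k) → Aligned k
    aligned k χ₀₁ₖ (l , eq) = l , l≉0 , eq
      where
      l≉0 : l ≉ 0#
      l≉0 l≈0 = positive⇒≉0 (sign-det₃ (# 0) (# 1) k χ₀₁ₖ)
        (det₃-zeroʳ (col Z (# 0)) (col Z (# 1)) (col Z k)
          (λ a → trans (eq a) (trans (*-congʳ l≈0) (zeroˡ (Y a k)))))

    collinear : ∀ k i j → Aligned i → Aligned j → χ (k ∷ i ∷ j ∷ []) ≡ 0ˢ →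
                det₃ (col Z k) (col Y i) (col Y j) ≈ 0#
    collinear k i j (l , l≉0 , eqᵢ) (m , m≉0 , eqⱼ) χ≡0 =
      *-cancel-≈0 (*-≉0 l≉0 m≉0) (trans (sym (trans
        (det₃-cong {col Z k} {col Z k} (λ _ → refl) eqᵢ eqⱼ)
        (ring-≈ (l ∷ m ∷ coordinates (col Z k) (col Y i) (col Y j))
          λ l m x₀ x₁ x₂ y₀ y₁ y₂ z₀ z₁ z₂ →
          det₃ᵉ ⟨ x₀ , x₁ , x₂ ⟩ ⟨ l :* y₀ , l :* y₁ , l :* y₂ ⟩ ⟨ m :* z₀ , m :* z₁ , m :* z₂ ⟩ ,
          l :* m :* det₃ᵉ ⟨ x₀ , x₁ , x₂ ⟩ ⟨ y₀ , y₁ , y₂ ⟩ ⟨ z₀ , z₁ , z₂ ⟩)))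
        (sign-det₃ k i j χ≡0))

    aligned-meet : ∀ k i j l m κ t → Aligned i → Aligned j → Aligned l → Aligned m →
      χ (k ∷ i ∷ j ∷ []) ≡ 0ˢ → χ (k ∷ l ∷ m ∷ []) ≡ 0ˢ → χ (# 0 ∷ # 1 ∷ k ∷ []) ≡ +1ˢ →
      T (meetCheck k i j l m κ) → ⟦ κ ⟧ ρ ≉ 0# → Y t k ≉ 0# → Aligned k
    aligned-meet k i j l m κ t Aᵢ Aⱼ Aₗ Aₘ χ₁ χ₂ χ₃ check κ≉0 Yt≉0 =
      aligned k χ₃ (meet (col Z k) (col Y i) (col Y j) (col Y l) (col Y m) (col Y k) (⟦ κ ⟧ ρ) t
        (collinear k i j Aᵢ Aⱼ χ₁) (collinear k l m Aₗ Aₘ χ₂)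
        (λ a → expr-≈ (((columnᴱ i ⨯ᴱ columnᴱ j) ⨯ᴱ (columnᴱ l ⨯ᴱ columnᴱ m)) a)
                      (κ :* columnᴱ k a) ρ (allFinᵇ-sound (meetIdentity k i j l m κ) check a))
        κ≉0 Yt≉0)

    -- The columns are recovered in the order of the construction. Every `κ` and every coordinate
    -- that must not vanish on the way is, up to sign, a product of factors `u`, `v - u` and
    -- `w - u`, possibly empty.
    module Chain (0<u : 0# < u) (0<v-u : 0# < v - u) (0<w-u : 0# < w - u)
                 (A₀ : Aligned (# 0)) (A₁ : Aligned (# 1)) (A₂ : Aligned (# 2))
                 (A₃ : Aligned (# 3)) (A₄ : Aligned (# 4)) where

      uᴱ vᴱ wᴱ : Expr 3
      uᴱ = var (# 0)
      vᴱ = var (# 1)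
      wᴱ = var (# 2)

      u≉0 : u ≉ 0#
      u≉0 = positive⇒≉0 0<u

      w-u≉0 : w - u ≉ 0#
      w-u≉0 = positive⇒≉0 0<w-u

      1≉0 : 1# ≉ 0#
      1≉0 = positive⇒≉0 0<1

      neg≉0 : ∀ {x} → x ≉ 0# → - x ≉ 0#
      neg≉0 x≉0 eq = x≉0 (trans (sym (-‿involutive _)) (trans (-‿cong eq) -0#≈0#))

      abstract
        A₅ : Aligned (# 5)
        A₅ = aligned-meet (# 5) (# 3) (# 4) (# 0) (# 2) (:- con (+ 1)) (# 2) A₃ A₄ A₀ A₂
               ≡.refl ≡.refl ≡.refl _ (neg≉0 1≉0) w-u≉0

        A₆ : Aligned (# 6)
        A₆ = aligned-meet (# 6) (# 2) (# 4) (# 1) (# 3) (con (+ 1)) (# 0) A₂ A₄ A₁ A₃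
               ≡.refl ≡.refl ≡.refl _ 1≉0 u≉0

        A₇ : Aligned (# 7)
        A₇ = aligned-meet (# 7) (# 1) (# 3) (# 0) (# 4) (:- con (+ 1)) (# 0) A₁ A₃ A₀ A₄
               ≡.refl ≡.refl ≡.refl _ (neg≉0 1≉0) u≉0

        A₈ : Aligned (# 8)
        A₈ = aligned-meet (# 8) (# 0) (# 2) (# 1) (# 4) (con (+ 1)) (# 2) A₀ A₂ A₁ A₄
               ≡.refl ≡.refl ≡.refl _ 1≉0 w-u≉0

        A₉ : Aligned (# 9)
        A₉ = aligned-meet (# 9) (# 0) (# 2) (# 1) (# 3) (con (+ 1)) (# 1) A₀ A₂ A₁ A₃
               ≡.refl ≡.refl ≡.refl _ 1≉0 1≉0

        A₁₀ : Aligned (# 10)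
        A₁₀ = aligned-meet (# 10) (# 8) (# 6) (# 1) (# 5) (wᴱ :- uᴱ) (# 0) A₈ A₆ A₁ A₅
                ≡.refl ≡.refl ≡.refl _ w-u≉0 (neg≉0 (*-≉0 u≉0 u≉0))

        A₁₁ : Aligned (# 11)
        A₁₁ = aligned-meet (# 11) (# 7) (# 5) (# 0) (# 6) (:- uᴱ) (# 0) A₇ A₅ A₀ A₆
                ≡.refl ≡.refl ≡.refl _ (neg≉0 u≉0)
                (λ eq → *-≉0 u≉0 (positive⇒≉0 0<v-u)
                  (trans (ring-≈ (u ∷ v ∷ []) λ u v → u :* (v :- u) , u :* v :- u :* u) eq))

        -- Two of the three lines through the point 12 determine it; the third, (3,10), is kept for
        -- `two-branches`.
        A₁₂ : Aligned (# 12)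
        A₁₂ = aligned-meet (# 12) (# 4) (# 9) (# 2) (# 11) (:- uᴱ) (# 0) A₄ A₉ A₂ A₁₁
                ≡.refl ≡.refl ≡.refl _ (neg≉0 u≉0) (*-≉0 u≉0 (positive⇒≉0 0<v-u))

        all-aligned : ∀ k → Aligned k
        all-aligned 0F             = A₀
        all-aligned 1F             = A₁
        all-aligned 2F             = A₂
        all-aligned 3F             = A₃
        all-aligned 4F             = A₄
        all-aligned 5F             = A₅
        all-aligned 6F             = A₆
        all-aligned 7F             = A₇
        all-aligned 8F             = A₈
        all-aligned 9F             = A₉
        all-aligned (suc 9F)       = A₁₀
        all-aligned (suc (suc 9F)) = A₁₁
        all-aligned (suc (suc (suc 9F))) = A₁₂

        -- The lines (2,11), (3,10) and (4,9) meet in the point 12.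
        two-branches : (1# + 1#) * u - w ≈ 0# ⊎ u * u - u * w + w * w - v * w ≈ 0#
        two-branches = *-≈0 (*-cancel-≈0 (*-≉0 u≉0 w-u≉0) (trans (sym factorization) D≈0))
          where
          2u-w conic : Carrier
          2u-w  = (1# + 1#) * u - w
          conic = u * u - u * w + w * w - v * w
          Dᴱ : Expr 3
          Dᴱ = det₃ᵉ (columnᴱ (# 2) ⨯ᴱ columnᴱ (# 11)) (columnᴱ (# 3) ⨯ᴱ columnᴱ (# 10))
                     (columnᴱ (# 4) ⨯ᴱ columnᴱ (# 9))
          D≈0 : ⟦ Dᴱ ⟧ ρ ≈ 0#
          -- If the three lines were independent, `concurrent` would force column 12 of `Z` to
          -- vanish.
          D≈0 = ≉0⇒⊥⇒≈0 λ D≉0 → positive⇒≉0 (sign-det₃ (# 0) (# 1) (# 12) ≡.refl)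
            (det₃-zeroʳ (col Z (# 0)) (col Z (# 1)) (col Z (# 12))
                     (λ a → *-cancel-≈0 D≉0 (trans (*-comm _ _)
                       (concurrent (col Z (# 12)) (col Y (# 2)) (col Y (# 11)) (col Y (# 3))
                          (col Y (# 10)) (col Y (# 4)) (col Y (# 9))
                          (collinear (# 12) (# 2) (# 11) A₂ A₁₁ ≡.refl)
                          (collinear (# 12) (# 3) (# 10) A₃ A₁₀ ≡.refl)
                          (collinear (# 12) (# 4) (# 9) A₄ A₉ ≡.refl) a))))
          factorization : ⟦ Dᴱ ⟧ ρ ≈ (u * (w - u)) * (2u-w * conic)
          factorization = expr-≈ Dᴱ ((uᴱ :* (wᴱ :- uᴱ)) :*
            ((con (+ 2) :* uᴱ :- wᴱ) :* (uᴱ :* uᴱ :- uᴱ :* wᴱ :+ wᴱ :* wᴱ :- vᴱ :* wᴱ))) ρ _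

-- Every framed realization lies on a branch, up to positive column factors

module NormalForms (ℝ : CompleteOrderedField) where
  open Polynomials
  open Configuration
  open CompleteOrderedField ℝ hiding (zero)
  open Evaluation commutativeRing
  open Matrices ℝ
  open OrderedField ℝ
  open LinearAlgebra ℝ
  open Realizability ℝ
  open Incidence ℝ
  open Continuity ℝ using (inverse-positive)
  open import Algebra.Properties.Ring ring

  data Branch : Set where
    linear conic : Branch

  parametrization : Branch → Vec (Expr 2) 3
  parametrization linear  = branch₁
  parametrization conic = branch₂

  Admissible : Branch → Carrier → Carrier → Set
  Admissible linear  α β = 0# < ⟦ golden ⟧ (α ∷ β ∷ [])
  Admissible conic α β = ⊤

  onBranch : Branch → Carrier → Carrier → Matrix 3 13
  onBranch b α β = configuration (evaluate (parametrization b) (α ∷ β ∷ []))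

  chirotope-onBranch : ∀ b {α β} → 0# < α → 0# < β → Admissible b α β →
                       ∀ i → chirotope (onBranch b α β) i ≡ χ i
  chirotope-onBranch linear  0<α 0<β 0<g = chirotope-branch₁ 0<α 0<β 0<g
  chirotope-onBranch conic 0<α 0<β _   = chirotope-branch₂ 0<α 0<β

  record NormalForm (Z : Matrix 3 13) : Set where
    field
      branch      : Branch
      α β         : Carrier
      0<α         : 0# < α
      0<β         : 0# < β
      admissible  : Admissible branch α β
      scaling     : Fin 13 → Carrier
      0<scaling   : ∀ k → 0# < scaling k
      normal-form : ∀ a k → Z a k ≈ scaling k * onBranch branch α β a k

  -- The first four columns are constant in `ρ`. The quantification serves both the coordinates read
  -- off from `Z` and the branch parameters that replace them later.
  record Framed (Z : Matrix 3 13) : Set where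
    field
      l₀ l₁ l₂ l₃ : Carrier
      0<l₀ : 0# < l₀
      0<l₁ : 0# < l₁
      0<l₂ : 0# < l₂
      0<l₃ : 0# < l₃
      col₀ : ∀ ρ a → Z a (# 0) ≈ l₀ * configuration ρ a (# 0)
      col₁ : ∀ ρ a → Z a (# 1) ≈ l₁ * configuration ρ a (# 1)
      col₂ : ∀ ρ a → Z a (# 2) ≈ l₂ * configuration ρ a (# 2)
      col₃ : ∀ ρ a → Z a (# 3) ≈ l₃ * configuration ρ a (# 3)

  det₃-aligned : ∀ (Z Y : Matrix 3 13) i j k {l m n} → (∀ a → Z a i ≈ l * Y a i) →
    (∀ a → Z a j ≈ m * Y a j) → (∀ a → Z a k ≈ n * Y a k) →
    det₃ (col Z i) (col Z j) (col Z k) ≈ l * m * n * det₃ (col Y i) (col Y j) (col Y k)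
  det₃-aligned Z Y i j k {l} {m} {n} p q r = trans (det₃-cong p q r)
    (det₃-scale l m n (col Y i) (col Y j) (col Y k))

  -- The bracket with the points 0 and 1 is positive on the branch and in `Z` for each of the other
  -- eleven points; comparing the two shows that the column factor is positive.
  heightCheck : Branch → Fin 11 → Bool
  heightCheck b k =
    coefficientCheck (minorᴾ (columnsAt (parametrization b)) (# 0) (# 1) (suc (suc k))) +1ˢ

  heights : ∀ b → allFinᵇ (heightCheck b) ≡ true
  heights linear  = ≡.refl
  heights conic = ≡.refl

  χ-heights : ∀ (k : Fin 11) → χ (# 0 ∷ # 1 ∷ suc (suc k) ∷ []) ≡ +1ˢ
  χ-heights k = ==-sound _ _ (allFinᵇ-sound (λ k → χ (# 0 ∷ # 1 ∷ suc (suc k) ∷ []) == +1ˢ) _ k)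

  module _ (Z : Matrix 3 13) (Z-χ : ∀ i → chirotope Z i ≡ χ i) (framed : Framed Z) where
    open Framed framed

    module _ (b : Branch) {α β : Carrier} (0<α : 0# < α) (0<β : 0# < β) where
      private
        Y : Matrix 3 13
        Y = onBranch b α β

      height-positive : ∀ k → 0# < det₃ (col Y (# 0)) (col Y (# 1)) (col Y (suc (suc k)))
      height-positive k = <-respʳ
        (trans (eval-minor (parametrization b) (α ∷ β ∷ []) (# 0) (# 1) (suc (suc k)))
                                         (minor-det₃ Y (# 0) (# 1) (suc (suc k))))
        (coefficientCheck-sound (minorᴾ (columnsAt (parametrization b)) (# 0) (# 1) (suc (suc k))) +1ˢ
          (allFinᵇ-sound (heightCheck b) (≡.subst T (≡.sym (heights b)) _) k) (0<α ∷ 0<β ∷ []))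

      scaling-positive : ∀ k {l} → (∀ a → Z a (suc (suc k)) ≈ l * Y a (suc (suc k))) → 0# < l
      scaling-positive k {l} eq = positive-cancelˡ +1ˢ
        (*-positive _ _ (*-positive _ _ 0<l₀ 0<l₁) (height-positive k))
        (<-respʳ (trans (det₃-aligned Z Y (# 0) (# 1) (suc (suc k)) (col₀ _) (col₁ _) eq)
                   (ring-≈ (l₀ ∷ l₁ ∷ l ∷ det₃ (col Y (# 0)) (col Y (# 1)) (col Y (suc (suc k))) ∷ [])
                     λ l m n d → l :* m :* n :* d , l :* m :* d :* n))
                 (hasSign-cong +1ˢ (minor-det₃ Z (# 0) (# 1) (suc (suc k)))
                   (sgn⇒hasSign (≡.trans (Z-χ (# 0 ∷ # 1 ∷ suc (suc k) ∷ [])) (χ-heights k)))))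

    goldenIdentity :
      isZero 2 (add 2 (minorᴾ (columnsAt branch₁) (# 7) (# 8) (# 12)) (norm goldenMinor)) ≡ true
    goldenIdentity = ≡.refl

    -- The bracket of 7, 8, 12 is minus `goldenMinor` on this branch by `goldenIdentity`, and `χ`
    -- makes it negative. The condition on `α / β` is thus forced by the oriented matroid.
    golden-positive : ∀ {α β} → 0# < α → 0# < β → (l : Fin 13 → Carrier) → (∀ k → 0# < l k) →
      (∀ a k → Z a k ≈ l k * onBranch linear α β a k) → 0# < ⟦ golden ⟧ (α ∷ β ∷ [])
    golden-positive {α} {β} 0<α 0<β l 0<l eq = positive-cancelˡ +1ˢ
      (*-positive _ _ (+-positive 0<α 0<β) (+-positive 0<α 0<β))
      (<-respʳ (trans (sym goldenMinor≈-p) (*-comm _ _)) (x<0⇒0<-x p<0))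
      where
      ρ : Vec Carrier 2
      ρ = α ∷ β ∷ []
      p : Poly 2
      p = minorᴾ (columnsAt branch₁) (# 7) (# 8) (# 12)
      Y : Matrix 3 13
      Y = onBranch linear α β
      p<0 : evalᴾ 2 p ρ < 0#
      p<0 = positive-cancelˡ -1ˢ (*-positive _ _ (*-positive _ _ (0<l (# 7)) (0<l (# 8))) (0<l (# 12)))
        (<-respˡ (trans (minor-det₃ Z (# 7) (# 8) (# 12))
                 (trans (det₃-aligned Z Y (# 7) (# 8) (# 12) (λ a → eq a _) (λ a → eq a _)
                                     (λ a → eq a _))
                        (*-congˡ (sym (trans (eval-minor branch₁ ρ (# 7) (# 8) (# 12))
                                             (minor-det₃ Y (# 7) (# 8) (# 12)))))))
                 (sgn⇒hasSign { -1ˢ} (Z-χ (# 7 ∷ # 8 ∷ # 12 ∷ []))))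
      goldenMinor≈-p : ⟦ goldenMinor ⟧ ρ ≈ - evalᴾ 2 p ρ
      goldenMinor≈-p = +-inverseˡ-unique _ _ (trans (+-comm _ _)
        (trans (+-congˡ (sym (norm-correct goldenMinor ρ)))
        (trans (sym (eval-add 2 p (norm goldenMinor) ρ))
               (eval-isZero 2 (add 2 p (norm goldenMinor)) ρ (≡.subst T (≡.sym goldenIdentity) _)))))

    -- Applied first to the coordinates of the point 4 in `Z`, which decides the branch, and then to
    -- the parametrized triple of that branch, which represents the same point up to the factor
    -- `l₄`.
    module Aligning (u v w : Carrier) (l₄ : Carrier) (l₄≉0 : l₄ ≉ 0#)
                    (col₄ : ∀ a → Z a (# 4) ≈ l₄ * configuration (u ∷ v ∷ w ∷ []) a (# 4))
                    (0<u : 0# < u) (0<v-u : 0# < v - u) (0<w-u : 0# < w - u) where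
      open Alignment Z Z-χ u v w using (Aligned; module Chain)
      open Chain 0<u 0<v-u 0<w-u
        (l₀ , positive⇒≉0 0<l₀ , col₀ _) (l₁ , positive⇒≉0 0<l₁ , col₁ _)
        (l₂ , positive⇒≉0 0<l₂ , col₂ _) (l₃ , positive⇒≉0 0<l₃ , col₃ _)
        (l₄ , l₄≉0 , col₄) public using (all-aligned; two-branches)

      scalingOf : Fin 13 → Carrier
      scalingOf k = proj₁ (all-aligned k)

      scalingOf-eq : ∀ a k → Z a k ≈ scalingOf k * configuration (u ∷ v ∷ w ∷ []) a k
      scalingOf-eq a k = proj₂ (proj₂ (all-aligned k)) a

    private
      u v w : Carrier
      u = Z (# 0) (# 4)
      v = Z (# 1) (# 4)
      w = Z (# 2) (# 4)

      Y : Matrix 3 13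
      Y = configuration (u ∷ v ∷ w ∷ [])

      col₄ : ∀ a → Z a (# 4) ≈ 1# * Y a (# 4)
      col₄ 0F = sym (*-identityˡ _)
      col₄ 1F = sym (*-identityˡ _)
      col₄ 2F = sym (*-identityˡ _)

      bracket-positive : ∀ i j k {l m n} → 0# < l → 0# < m → 0# < n →
        (∀ a → Z a i ≈ l * Y a i) → (∀ a → Z a j ≈ m * Y a j) → (∀ a → Z a k ≈ n * Y a k) →
        χ (i ∷ j ∷ k ∷ []) ≡ +1ˢ → 0# < det₃ (col Y i) (col Y j) (col Y k)
      bracket-positive i j k 0<l 0<m 0<n p q r χ≡+ = positive-cancelˡ +1ˢ
        (*-positive _ _ (*-positive _ _ 0<l 0<m) 0<n)
        (<-respʳ (trans (minor-det₃ Z i j k) (det₃-aligned Z Y i j k p q r))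
          (sgn⇒hasSign {+1ˢ} (≡.trans (Z-χ (i ∷ j ∷ k ∷ [])) χ≡+)))

      bracketᴱ : Fin 13 → Fin 13 → Fin 13 → Expr 3
      bracketᴱ i j k = det₃ᵉ (columnᴱ i) (columnᴱ j) (columnᴱ k)

      uᴱ vᴱ wᴱ : Expr 3
      uᴱ = var (# 0)
      vᴱ = var (# 1)
      wᴱ = var (# 2)

      0<u : 0# < u
      0<u = <-respʳ (expr-≈ (bracketᴱ (# 0) (# 4) (# 2)) uᴱ (u ∷ v ∷ w ∷ []) _)
        (bracket-positive (# 0) (# 4) (# 2) 0<l₀ 0<1 0<l₂ (col₀ _) col₄ (col₂ _) ≡.refl)

      0<v-u : 0# < v - u
      0<v-u = <-respʳ (expr-≈ (bracketᴱ (# 0) (# 3) (# 4)) (vᴱ :- uᴱ) (u ∷ v ∷ w ∷ []) _)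
        (bracket-positive (# 0) (# 3) (# 4) 0<l₀ 0<l₃ 0<1 (col₀ _) (col₃ _) col₄ ≡.refl)

      0<w-u : 0# < w - u
      0<w-u = <-respʳ (expr-≈ (bracketᴱ (# 1) (# 3) (# 4)) (wᴱ :- uᴱ) (u ∷ v ∷ w ∷ []) _)
        (bracket-positive (# 1) (# 3) (# 4) 0<l₁ 0<l₃ 0<1 (col₁ _) (col₃ _) col₄ ≡.refl)

      0<w-v : 0# < w - v
      0<w-v = <-respʳ (expr-≈ (bracketᴱ (# 2) (# 4) (# 3)) (wᴱ :- vᴱ) (u ∷ v ∷ w ∷ []) _)
        (bracket-positive (# 2) (# 4) (# 3) 0<l₂ 0<1 0<l₃ (col₂ _) col₄ (col₃ _) ≡.refl)

      0<w : 0# < w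
      0<w = <-respʳ (ring-≈ (u ∷ w ∷ []) λ u w → u :+ (w :- u) , w) (+-positive 0<u 0<w-u)

      with-signs : ∀ b {α β} → 0# < α → 0# < β →
        (∀ k → ∃[ l ] ∀ a → Z a k ≈ l * onBranch b α β a k) → NormalForm Z
      with-signs b {α} {β} 0<α 0<β f = record
        { branch = b ; α = α ; β = β ; 0<α = 0<α ; 0<β = 0<β
        ; admissible = admissible b ≡.refl
        ; scaling = scaling ; 0<scaling = 0<scaling ; normal-form = eq }
        where
        scaling : Fin 13 → Carrier
        scaling 0F = l₀
        scaling 1F = l₁
        scaling (suc (suc k)) = proj₁ (f (suc (suc k)))
        0<scaling : ∀ k → 0# < scaling k
        0<scaling 0F = 0<l₀
        0<scaling 1F = 0<l₁
        0<scaling (suc (suc k)) = scaling-positive b 0<α 0<β k (proj₂ (f (suc (suc k))))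
        eq : ∀ a k → Z a k ≈ scaling k * onBranch b α β a k
        eq a 0F = col₀ _ a
        eq a 1F = col₁ _ a
        eq a (suc (suc k)) = proj₂ (f (suc (suc k))) a
        -- Matching on a copy of the branch lets `scaling` and `eq`, stated for `b`, specialize
        -- along with it.
        admissible : ∀ c → c ≡ b → Admissible c α β
        admissible linear ≡.refl = golden-positive 0<α 0<β scaling 0<scaling eq
        admissible conic  _      = tt

    minus-≈0 : ∀ {x y} → x ≈ 0# → y ≈ y - x
    minus-≈0 x≈0 = sym (trans (+-congˡ (trans (-‿cong x≈0) -0#≈0#)) (+-identityʳ _))

    linear-case : (1# + 1#) * u - w ≈ 0# → NormalForm Z
    linear-case 2u-w≈0 = with-signs linear 0<v-u 0<w-v λ k → scalingOf k , λ a → scalingOf-eq a k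
      where
      α β : Carrier
      α = v - u
      β = w - v
      -- Subtracting the vanishing `2u - w` from each coordinate of the point 4 turns it into the
      -- linear expression in `α` and `β` that `branch₁` prescribes.
      col₄′ : ∀ a → Z a (# 4) ≈ 1# * onBranch linear α β a (# 4)
      col₄′ 0F = trans (minus-≈0 2u-w≈0)
        (ring-≈ (u ∷ v ∷ w ∷ []) λ u v w →
          u :- (con (+ 2) :* u :- w) , con (+ 1) :* (v :- u :+ (w :- v)))
      col₄′ 1F = trans (minus-≈0 2u-w≈0)
        (ring-≈ (u ∷ v ∷ w ∷ []) λ u v w →
          v :- (con (+ 2) :* u :- w) , con (+ 1) :* (con (+ 2) :* (v :- u) :+ (w :- v)))
      col₄′ 2F = trans (minus-≈0 2u-w≈0)
        (ring-≈ (u ∷ v ∷ w ∷ []) λ u v w →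
          w :- (con (+ 2) :* u :- w) , con (+ 1) :* (con (+ 2) :* (v :- u :+ (w :- v))))
      open Aligning _ _ _ 1# (positive⇒≉0 0<1) col₄′
        (+-positive 0<v-u 0<w-v)
        (<-respʳ (ring-≈ (α ∷ β ∷ []) λ α β → α , con (+ 2) :* α :+ β :- (α :+ β)) 0<v-u)
        (<-respʳ (ring-≈ (α ∷ β ∷ []) λ α β → α :+ β , con (+ 2) :* (α :+ β) :- (α :+ β))
                 (+-positive 0<v-u 0<w-v))

    conic-case : u * u - u * w + w * w - v * w ≈ 0# → NormalForm Z
    conic-case conic≈0 with inverse-positive 0<w
    ... | i , 0<i , wi≈1 = with-signs conic 0<u 0<w-u λ k → scalingOf k , λ a → scalingOf-eq a k
      where
      α β : Carrier
      α = u
      β = w - u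
      -- Inserting the factor `w * i` lets the identities be solved with `i` as an independent
      -- variable; the relation `w * i ≈ 1#` enters only here.
      by-w : ∀ {x y} → x * (w * i) ≈ y → x ≈ y
      by-w eq = trans (sym (*-identityʳ _)) (trans (*-congˡ (sym wi≈1)) eq)
      col₄′ : ∀ a → Z a (# 4) ≈ i * onBranch conic α β a (# 4)
      col₄′ 0F = by-w (ring-≈ (u ∷ w ∷ i ∷ []) λ u w i →
        u :* (w :* i) , i :* (u :* (u :+ (w :- u))))
      col₄′ 1F = by-w (x∙y⁻¹≈ε⇒x≈y _ _ (trans
        (ring-≈ (u ∷ v ∷ w ∷ i ∷ []) λ u v w i →
          v :* (w :* i) :- i :* (u :* u :+ u :* (w :- u) :+ (w :- u) :* (w :- u)) ,
          :- (i :* (u :* u :- u :* w :+ w :* w :- v :* w)))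
        (trans (-‿cong (trans (*-congˡ conic≈0) (zeroʳ i))) -0#≈0#)))
      col₄′ 2F = by-w (ring-≈ (u ∷ w ∷ i ∷ []) λ u w i →
        w :* (w :* i) , i :* ((u :+ (w :- u)) :* (u :+ (w :- u))))
      open Aligning _ _ _ i (positive⇒≉0 0<i) col₄′
        (*-positive _ _ 0<u (+-positive 0<u 0<w-u))
        (<-respʳ (ring-≈ (α ∷ β ∷ []) λ α β →
                   β :* β , (α :* α :+ α :* β :+ β :* β) :- α :* (α :+ β))
                 (*-positive _ _ 0<w-u 0<w-u))
        (<-respʳ (ring-≈ (α ∷ β ∷ []) λ α β →
                   (α :+ β) :* β , (α :+ β) :* (α :+ β) :- α :* (α :+ β))
                 (*-positive _ _ (+-positive 0<u 0<w-u) 0<w-u))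

    toNormalForm : NormalForm Z
    toNormalForm = [ linear-case , conic-case ]′
      (Aligning.two-branches u v w 1# (positive⇒≉0 0<1) col₄ 0<u 0<v-u 0<w-u)

-- Moving the first four points to the standard frame

module Frames (ℝ : CompleteOrderedField) where
  open Polynomials
  open Configuration
  open CompleteOrderedField ℝ hiding (zero)
  open Evaluation commutativeRing
  open Matrices ℝ
  open OrderedField ℝ
  open LinearAlgebra ℝ
  open Realizability ℝ
  open Incidence ℝ
  open NormalForms ℝ
  open import Algebra.Properties.Ring ring

  module _ (X : Matrix 3 13) (X-χ : ∀ i → chirotope X i ≡ χ i) where

    private
      x : Fin 13 → Vector
      x = col X

      x₀ x₁ x₂ x₃ : Vector
      x₀ = x (# 0)
      x₁ = x (# 1)
      x₂ = x (# 2)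
      x₃ = x (# 3)

      -- The columns are ordered so that `χ` makes all four brackets positive.
      Δ d₀ d₁ d₂ : Carrier
      Δ  = det₃ x₀ x₁ x₂
      d₀ = det₃ x₁ x₃ x₂
      d₁ = det₃ x₀ x₃ x₂
      d₂ = det₃ x₀ x₁ x₃

      bracket-positive : ∀ i j k → χ (i ∷ j ∷ k ∷ []) ≡ +1ˢ → 0# < det₃ (x i) (x j) (x k)
      bracket-positive i j k eq =
        <-respʳ (minor-det₃ X i j k) (sgn⇒hasSign {+1ˢ} (≡.trans (X-χ (i ∷ j ∷ k ∷ [])) eq))

      0<Δ : 0# < Δ
      0<Δ = bracket-positive (# 0) (# 1) (# 2) ≡.refl
      0<d₀ : 0# < d₀
      0<d₀ = bracket-positive (# 1) (# 3) (# 2) ≡.refl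
      0<d₁ : 0# < d₁
      0<d₁ = bracket-positive (# 0) (# 3) (# 2) ≡.refl
      0<d₂ : 0# < d₂
      0<d₂ = bracket-positive (# 0) (# 1) (# 3) ≡.refl

    -- The coordinates of y for which the first four points are multiples of
    -- (0,0,1), (1,0,1), (0,1,1) and (1,1,1), from its brackets with x₀, x₁, x₂.
    framing : Carrier → Carrier → Carrier → Vector
    framing p q s = ⟨ p * (d₀ * d₂) , q * (d₀ * d₁) , p * (d₀ * d₂) + q * (d₀ * d₁) + s * (d₁ * d₂) ⟩

    framed-coordinates : Vector → Vector
    framed-coordinates y = framing (det₃ x₀ y x₂) (det₃ x₀ x₁ y) (det₃ y x₁ x₂)

    unit : Fin 3 → Vector
    unit = ⟨ ⟨ 1# , 0# , 0# ⟩ , ⟨ 0# , 1# , 0# ⟩ , ⟨ 0# , 0# , 1# ⟩ ⟩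

    G : Matrix 3 3
    G a b = framed-coordinates (unit b) a

    framing-cong : ∀ {p q s p′ q′ s′} → p ≈ p′ → q ≈ q′ → s ≈ s′ →
                   ∀ a → framing p q s a ≈ framing p′ q′ s′ a
    framing-cong p q s 0F             = *-congʳ p
    framing-cong p q s 1F       = *-congʳ q
    framing-cong p q s 2F = +-cong (+-cong (*-congʳ p) (*-congʳ q)) (*-congʳ s)

    G⊡X : ∀ a k → (G ⊡ X) a k ≈ framed-coordinates (x k) a
    G⊡X a k = rows a
      where
      y : Vector
      y = x k
      ρ : Vec Carrier 15
      ρ = d₀ * d₂ ∷ d₀ * d₁ ∷ d₁ * d₂ ∷ y (# 0) ∷ y (# 1) ∷ y (# 2) ∷ coordinates x₀ x₁ x₂
      sᴱ : Fin 3 → Expr 15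
      sᴱ = ⟨ var (# 0) , var (# 1) , var (# 2) ⟩
      yᴱ x₀ᴱ x₁ᴱ x₂ᴱ : Fin 3 → Expr 15
      yᴱ  = ⟨ var (# 3)  , var (# 4)  , var (# 5)  ⟩
      x₀ᴱ = ⟨ var (# 6)  , var (# 7)  , var (# 8)  ⟩
      x₁ᴱ = ⟨ var (# 9)  , var (# 10) , var (# 11) ⟩
      x₂ᴱ = ⟨ var (# 12) , var (# 13) , var (# 14) ⟩
      unitᴱ : Fin 3 → Fin 3 → Expr 15
      unitᴱ = ⟨ ⟨ con (+ 1) , con (+ 0) , con (+ 0) ⟩ , ⟨ con (+ 0) , con (+ 1) , con (+ 0) ⟩ ,
                ⟨ con (+ 0) , con (+ 0) , con (+ 1) ⟩ ⟩
      rowᴱ : Fin 3 → (Fin 3 → Expr 15) → Expr 15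
      rowᴱ a z = ⟨ p , q , p :+ q :+ det₃ᵉ z x₁ᴱ x₂ᴱ :* sᴱ (# 2) ⟩ a
        where
        p q : Expr 15
        p = det₃ᵉ x₀ᴱ z x₂ᴱ :* sᴱ (# 0)
        q = det₃ᵉ x₀ᴱ x₁ᴱ z :* sᴱ (# 1)
      lhs : Fin 3 → Expr 15
      lhs a = rowᴱ a (unitᴱ (# 0)) :* yᴱ (# 0) :+ (rowᴱ a (unitᴱ (# 1)) :* yᴱ (# 1) :+
             (rowᴱ a (unitᴱ (# 2)) :* yᴱ (# 2) :+ con (+ 0)))
      rows : ∀ a → (G ⊡ X) a k ≈ framed-coordinates y a
      rows 0F = expr-≈ (lhs (# 0)) (rowᴱ (# 0) yᴱ) ρ _
      rows 1F = expr-≈ (lhs (# 1)) (rowᴱ (# 1) yᴱ) ρ _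
      rows 2F = expr-≈ (lhs (# 2)) (rowᴱ (# 2) yᴱ) ρ _

    private
      repeat₁₂ : ∀ y z → det₃ y y z ≈ 0#
      repeat₁₂ y z = ring-≈ (coordinates y z z) λ y₀ y₁ y₂ z₀ z₁ z₂ _ _ _ →
        det₃ᵉ ⟨ y₀ , y₁ , y₂ ⟩ ⟨ y₀ , y₁ , y₂ ⟩ ⟨ z₀ , z₁ , z₂ ⟩ , con (+ 0)
      repeat₁₃ : ∀ y z → det₃ y z y ≈ 0#
      repeat₁₃ y z = ring-≈ (coordinates y z z) λ y₀ y₁ y₂ z₀ z₁ z₂ _ _ _ →
        det₃ᵉ ⟨ y₀ , y₁ , y₂ ⟩ ⟨ z₀ , z₁ , z₂ ⟩ ⟨ y₀ , y₁ , y₂ ⟩ , con (+ 0)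
      repeat₂₃ : ∀ y z → det₃ y z z ≈ 0#
      repeat₂₃ y z = ring-≈ (coordinates y z z) λ y₀ y₁ y₂ z₀ z₁ z₂ _ _ _ →
        det₃ᵉ ⟨ y₀ , y₁ , y₂ ⟩ ⟨ z₀ , z₁ , z₂ ⟩ ⟨ z₀ , z₁ , z₂ ⟩ , con (+ 0)
      cyclic : det₃ x₃ x₁ x₂ ≈ - d₀
      cyclic = ring-≈ (coordinates x₁ x₂ x₃) λ y₀ y₁ y₂ z₀ z₁ z₂ t₀ t₁ t₂ →
        det₃ᵉ ⟨ t₀ , t₁ , t₂ ⟩ ⟨ y₀ , y₁ , y₂ ⟩ ⟨ z₀ , z₁ , z₂ ⟩ ,
        :- det₃ᵉ ⟨ y₀ , y₁ , y₂ ⟩ ⟨ t₀ , t₁ , t₂ ⟩ ⟨ z₀ , z₁ , z₂ ⟩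

      δ : Vec Carrier 4
      δ = Δ ∷ d₀ ∷ d₁ ∷ d₂ ∷ []

    framed : Framed (G ⊡ X)
    framed = record
      { l₀ = Δ * (d₁ * d₂) ; l₁ = Δ * (d₀ * d₂) ; l₂ = Δ * (d₀ * d₁) ; l₃ = d₀ * (d₁ * d₂)
      ; 0<l₀ = *-positive _ _ 0<Δ (*-positive _ _ 0<d₁ 0<d₂)
      ; 0<l₁ = *-positive _ _ 0<Δ (*-positive _ _ 0<d₀ 0<d₂)
      ; 0<l₂ = *-positive _ _ 0<Δ (*-positive _ _ 0<d₀ 0<d₁)
      ; 0<l₃ = *-positive _ _ 0<d₀ (*-positive _ _ 0<d₁ 0<d₂)
      ; col₀ = λ ρ a → trans (trans (G⊡X a (# 0)) (framing-cong (repeat₁₂ x₀ x₂) (repeat₁₃ x₀ x₁) refl a))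
                                (c₀ ρ a)
      ; col₁ = λ ρ a → trans (trans (G⊡X a (# 1)) (framing-cong refl (repeat₂₃ x₀ x₁) (repeat₁₂ x₁ x₂) a))
                                (c₁ ρ a)
      ; col₂ = λ ρ a → trans (trans (G⊡X a (# 2)) (framing-cong (repeat₂₃ x₀ x₂) refl (repeat₁₃ x₂ x₁) a))
                                (c₂ ρ a)
      -- The brackets of `x₃` are `d₁`, `d₂` and `- d₀`, and the weights make all three products
      -- equal up to sign; the last coordinate is then `1 + 1 - 1` times `d₀ * (d₁ * d₂)`.
      ; col₃ = λ ρ a → trans (trans (G⊡X a (# 3)) (framing-cong refl refl cyclic a)) (c₃ ρ a)
      }
      where
      c₀ : ∀ ρ a → framing 0# 0# Δ a ≈ Δ * (d₁ * d₂) * configuration ρ a (# 0)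
      c₀ ρ 0F = ring-≈ δ λ D a b c → con (+ 0) :* (a :* c) , D :* (b :* c) :* con (+ 0)
      c₀ ρ 1F = ring-≈ δ λ D a b c → con (+ 0) :* (a :* b) , D :* (b :* c) :* con (+ 0)
      c₀ ρ 2F = ring-≈ δ λ D a b c →
        con (+ 0) :* (a :* c) :+ con (+ 0) :* (a :* b) :+ D :* (b :* c) , D :* (b :* c) :* con (+ 1)
      c₁ : ∀ ρ a → framing Δ 0# 0# a ≈ Δ * (d₀ * d₂) * configuration ρ a (# 1)
      c₁ ρ 0F = ring-≈ δ λ D a b c → D :* (a :* c) , D :* (a :* c) :* con (+ 1)
      c₁ ρ 1F = ring-≈ δ λ D a b c → con (+ 0) :* (a :* b) , D :* (a :* c) :* con (+ 0)
      c₁ ρ 2F = ring-≈ δ λ D a b c →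
        D :* (a :* c) :+ con (+ 0) :* (a :* b) :+ con (+ 0) :* (b :* c) , D :* (a :* c) :* con (+ 1)
      c₂ : ∀ ρ a → framing 0# Δ 0# a ≈ Δ * (d₀ * d₁) * configuration ρ a (# 2)
      c₂ ρ 0F = ring-≈ δ λ D a b c → con (+ 0) :* (a :* c) , D :* (a :* b) :* con (+ 0)
      c₂ ρ 1F = ring-≈ δ λ D a b c → D :* (a :* b) , D :* (a :* b) :* con (+ 1)
      c₂ ρ 2F = ring-≈ δ λ D a b c →
        con (+ 0) :* (a :* c) :+ D :* (a :* b) :+ con (+ 0) :* (b :* c) , D :* (a :* b) :* con (+ 1)
      c₃ : ∀ ρ a → framing d₁ d₂ (- d₀) a ≈ d₀ * (d₁ * d₂) * configuration ρ a (# 3)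
      c₃ ρ 0F = ring-≈ δ λ D a b c → b :* (a :* c) , a :* (b :* c) :* con (+ 1)
      c₃ ρ 1F = ring-≈ δ λ D a b c → c :* (a :* b) , a :* (b :* c) :* con (+ 1)
      c₃ ρ 2F = ring-≈ δ λ D a b c →
        b :* (a :* c) :+ c :* (a :* b) :+ (:- a) :* (b :* c) , a :* (b :* c) :* con (+ 1)

    -- Instead of expanding `G`, multiplicativity is used: `Δ` times its determinant is the bracket
    -- of 0, 1, 2 in `G ⊡ X`, hence `l₀ * l₁ * l₂` times that of the standard frame, which is 1.
    det-G-positive : 0# < det₃ (col G (# 0)) (col G (# 1)) (col G (# 2))
    det-G-positive = positive-cancelˡ +1ˢ 0<Δ (<-respʳ eq (*-positive _ _
        (*-positive _ _ (*-positive _ _ 0<l₀ 0<l₁) 0<l₂) 0<1))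
      where
      open Framed framed
      Y : Matrix 3 13
      Y = configuration (0# ∷ 0# ∷ 0# ∷ [])
      detY : 1# ≈ det₃ (col Y (# 0)) (col Y (# 1)) (col Y (# 2))
      detY = expr-≈ (con (+ 1)) (det₃ᵉ (columnᴱ (# 0)) (columnᴱ (# 1)) (columnᴱ (# 2)))
                    (0# ∷ 0# ∷ 0# ∷ []) _
      eq : l₀ * l₁ * l₂ * 1# ≈ Δ * det₃ (col G (# 0)) (col G (# 1)) (col G (# 2))
      eq = trans (*-congˡ detY)
          (trans (sym (det₃-aligned (G ⊡ X) Y (# 0) (# 1) (# 2) (col₀ _) (col₁ _) (col₂ _)))
          (trans (sym (minor-det₃ (G ⊡ X) (# 0) (# 1) (# 2)))
          (trans (minor-⊡ G X (# 0 ∷ # 1 ∷ # 2 ∷ []))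
          (trans (*-congˡ (minor-det₃ X (# 0) (# 1) (# 2))) (*-comm _ _)))))

    chirotope-G⊡X : ∀ i → chirotope (G ⊡ X) i ≡ χ i
    chirotope-G⊡X i = ≡.trans (hasSign⇒sgn (chirotope X i)
      (hasSign-cong (chirotope X i) (sym (minor-⊡ G X i))
        (hasSign-positive-* (chirotope X i) det-G-positive (sgn-hasSign (minor X i))))) (X-χ i)

    normalForm : NormalForm (G ⊡ X)
    normalForm = toNormalForm (G ⊡ X) chirotope-G⊡X framed

  -- The sign of χ is absorbed by the invertible matrix.
  normalize : ∀ (X : Matrix 3 13) →
    (∀ i → chirotope X i ≡ χ i) ⊎ (∀ i → chirotope X i ≡ -ˢ χ i) →
    ∃[ A ] det₃ (col A (# 0)) (col A (# 1)) (col A (# 2)) ≉ 0# × NormalForm (A ⊡ X)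
  normalize X (inj₁ X-χ) = G X X-χ , positive⇒≉0 (det-G-positive X X-χ) , normalForm X X-χ
  normalize X (inj₂ X-χ) = -G , det≉0 ,
    record { NormalForm nf
           ; normal-form = λ a k → trans (eq a k) (NormalForm.normal-form nf a k) }
    where
    -- The rank is odd, so negating the matrix negates every bracket and turns `-ˢ χ` into `χ`.
    -X : Matrix 3 13
    -X a k = - X a k

    minor-neg : ∀ i → minor -X i ≈ - minor X i
    minor-neg (i ∷ j ∷ k ∷ []) = trans (minor-det₃ -X i j k)
      (trans (ring-≈ (coordinates (col X i) (col X j) (col X k)) λ x₀ x₁ x₂ y₀ y₁ y₂ z₀ z₁ z₂ →
        det₃ᵉ ⟨ :- x₀ , :- x₁ , :- x₂ ⟩ ⟨ :- y₀ , :- y₁ , :- y₂ ⟩ ⟨ :- z₀ , :- z₁ , :- z₂ ⟩ ,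
        :- det₃ᵉ ⟨ x₀ , x₁ , x₂ ⟩ ⟨ y₀ , y₁ , y₂ ⟩ ⟨ z₀ , z₁ , z₂ ⟩)
      (-‿cong (sym (minor-det₃ X i j k))))

    -X-χ : ∀ i → chirotope -X i ≡ χ i
    -X-χ i = ≡.trans (sgn-cong (minor-neg i)) (≡.trans (sgn-neg (minor X i))
      (≡.trans (≡.cong -ˢ_ (X-χ i)) (-ˢ-involutive (χ i))))

    G′ -G : Matrix 3 3
    G′ = G -X -X-χ
    -G a b = - G′ a b

    nf : NormalForm (G′ ⊡ -X)
    nf = normalForm -X -X-χ

    det≉0 : det₃ (col -G (# 0)) (col -G (# 1)) (col -G (# 2)) ≉ 0#
    det≉0 eq = positive⇒≉0 (det-G-positive -X -X-χ) (trans
      (ring-≈ (coordinates (col G′ (# 0)) (col G′ (# 1)) (col G′ (# 2))) λ x₀ x₁ x₂ y₀ y₁ y₂ z₀ z₁ z₂ →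
        det₃ᵉ ⟨ x₀ , x₁ , x₂ ⟩ ⟨ y₀ , y₁ , y₂ ⟩ ⟨ z₀ , z₁ , z₂ ⟩ ,
        :- det₃ᵉ ⟨ :- x₀ , :- x₁ , :- x₂ ⟩ ⟨ :- y₀ , :- y₁ , :- y₂ ⟩ ⟨ :- z₀ , :- z₁ , :- z₂ ⟩)
      (trans (-‿cong eq) -0#≈0#))

    eq : ∀ a k → (-G ⊡ X) a k ≈ (G′ ⊡ -X) a k
    eq a k = ring-≈ (G′ a (# 0) ∷ G′ a (# 1) ∷ G′ a (# 2) ∷ X (# 0) k ∷ X (# 1) k ∷ X (# 2) k ∷ [])
      λ g h l x y z →
        (:- g) :* x :+ ((:- h) :* y :+ ((:- l) :* z :+ con (+ 0))) ,
        g :* (:- x) :+ (h :* (:- y) :+ (l :* (:- z) :+ con (+ 0)))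

-- Connectedness: every realization is joined to the crossing

module Geometry (ℝ : CompleteOrderedField) where
  open Polynomials
  open Configuration
  open CompleteOrderedField ℝ hiding (zero)
  open Evaluation commutativeRing
  open Matrices ℝ
  open OrderedField ℝ
  open LinearAlgebra ℝ
  open Realizability ℝ
  open Incidence ℝ
  open NormalForms ℝ
  open Frames ℝ
  open Continuity ℝ
  open Paths ℝ matroid
  open RealizationSpace ℝ matroid
  open import Algebra.Properties.Ring ring
  open import Algebra.Properties.Semiring.Exp semiring using (^-homo-*)
  open import Algebra.Properties.CommutativeSemigroup *-commutativeSemigroup
    using () renaming (interchange to *-medial)

  I-invertible : Invertible I
  I-invertible = det₃-invertible I λ eq → positive⇒≉0 0<1 (trans
    (ring-≈ [] (con (+ 1) , det₃ᵉ ⟨ con (+ 1) , con (+ 0) , con (+ 0) ⟩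
                                  ⟨ con (+ 0) , con (+ 1) , con (+ 0) ⟩
                                  ⟨ con (+ 0) , con (+ 0) , con (+ 1) ⟩)) eq)

  -- Predicates on `Realization` need not respect equality of matrices, but open ones respect `_∼_`.
  -- This allows the end of a path to be exchanged for `base`.
  ≋⇒∼ : ∀ X Y → matrix X ≋ matrix Y → X ∼ Y
  ≋⇒∼ X Y X≋Y = I , I-invertible , λ a k → trans (sym (X≋Y a k)) (sym (I⊡ a k))
    where
    I⊡ : ∀ a k → (I ⊡ matrix X) a k ≈ matrix X a k
    I⊡ a k = rows a
      where
      ρ : Vec Carrier 3
      ρ = matrix X (# 0) k ∷ matrix X (# 1) k ∷ matrix X (# 2) k ∷ []
      rows : ∀ a → (I ⊡ matrix X) a k ≈ matrix X a k
      rows 0F = ring-≈ ρ λ x y z →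
        con (+ 1) :* x :+ (con (+ 0) :* y :+ (con (+ 0) :* z :+ con (+ 0))) , x
      rows 1F = ring-≈ ρ λ x y z →
        con (+ 0) :* x :+ (con (+ 1) :* y :+ (con (+ 0) :* z :+ con (+ 0))) , y
      rows 2F = ring-≈ ρ λ x y z →
        con (+ 0) :* x :+ (con (+ 0) :* y :+ (con (+ 1) :* z :+ con (+ 0))) , z

  module _ (b : Branch) {α β : Carrier} (0<α : 0# < α) (0<β : 0# < β) (adm : Admissible b α β)
           (l : Fin 13 → Carrier) (0<l : ∀ k → 0# < l k) where

    private
      X : Matrix 3 13
      X a k = l k * onBranch b α β a k

      X-χ : ∀ i → chirotope X i ≡ χ i
      X-χ i = ≡.trans (chirotope-scale (onBranch b α β) l 0<l i) (chirotope-onBranch b 0<α 0<β adm i)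

    realization : Realization
    realization = record
      { matrix   = X
      ; fullRank = minor≉0⇒fullRowRank X (# 0 ∷ # 1 ∷ # 2 ∷ [])
                     (positive⇒≉0 (sgn⇒hasSign {+1ˢ} (X-χ (# 0 ∷ # 1 ∷ # 2 ∷ []))))
      ; realizes = inj₁ X-χ
      }

  base : Realization
  base = realization conic 0<1 0<1 tt (λ _ → 1#) (λ _ → 0<1)

  -- Along a segment the quadratic form `golden` is determined by its values at the
  -- ends and its polar form there; the factor 2 avoids a division.
  golden-mix : ∀ {α β t} → 0# < α → 0# < β → 0# < ⟦ golden ⟧ (α ∷ β ∷ []) → 0# ≤ t → t ≤ 1# →
               0# < ⟦ golden ⟧ (mix t α 1# ∷ mix t β 1# ∷ [])
  golden-mix {α} {β} {t} 0<α 0<β 0<g 0≤t t≤1 = positive-cancelˡ +1ˢ 0<2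
    (<-respʳ (ring-≈ (α ∷ β ∷ t ∷ []) λ α β t →
        let :mix : Expr 3 → Expr 3 → Expr 3
            :mix x y = (con (+ 1) :- t) :* x :+ t :* y
            :golden : Expr 3 → Expr 3 → Expr 3
            :golden a b = b :* b :+ a :* b :- a :* a
            :polar = con (+ 3) :* β :- α
        in :mix (:mix (con (+ 2) :* :golden α β) :polar) (:mix :polar (con (+ 2))) ,
           con (+ 2) :* :golden (:mix α (con (+ 1))) (:mix β (con (+ 1))))
      (mix-positive 0≤t t≤1 (mix-positive 0≤t t≤1 (*-positive _ _ 0<2 0<g) 0<polar)
                            (mix-positive 0≤t t≤1 0<polar 0<2)))
    where
    0<2 : 0# < 1# + 1#
    0<2 = +-positive 0<1 0<1
    polar : Carrier
    polar = ℤ→R (+ 3) * β - α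
    0<polar : 0# < polar
    -- `polar` is `g(x + y) - g(x) - g(y)` for `g = golden`, `x = (α , β)` and `y = (1 , 1)`. Its
    -- product with the positive `α + 2β` is `golden` plus `5β²`.
    0<polar = positive-cancelˡ +1ˢ {α + (β + β)} (+-positive 0<α (+-positive 0<β 0<β))
      (<-respʳ (ring-≈ (α ∷ β ∷ []) λ α β →
          (β :* β :+ α :* β :- α :* α) :+ con (+ 5) :* (β :* β) ,
          (α :+ (β :+ β)) :* (con (+ 3) :* β :- α))
        (+-positive 0<g (*-positive _ _ (ℕ→R-positive 4) (*-positive _ _ 0<β 0<β))))

  admissible-mix : ∀ b {α β t} → 0# < α → 0# < β → Admissible b α β → 0# ≤ t → t ≤ 1# →
                   Admissible b (mix t α 1#) (mix t β 1#)
  admissible-mix linear = golden-mix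
  admissible-mix conic  = λ _ _ _ _ _ → tt

  continuous-evaluate : ∀ {m n t} (σ : Vec (Expr n) m) (γ : Carrier → Vec Carrier n) →
    (∀ i → ContinuousAt t (λ s → lookup (γ s) i)) →
    ∀ i → ContinuousAt t (λ s → lookup (evaluate σ (γ s)) i)
  continuous-evaluate (e ∷ σ) γ cγ 0F    = continuous-⟦⟧ e γ cγ
  continuous-evaluate (e ∷ σ) γ cγ (suc i) = continuous-evaluate σ γ cγ i

  evaluate-cong : ∀ {m n} (σ : Vec (Expr n) m) {ρ ρ′} → (∀ i → lookup ρ i ≈ lookup ρ′ i) →
                  ∀ i → lookup (evaluate σ ρ) i ≈ lookup (evaluate σ ρ′) i
  evaluate-cong (e ∷ σ) eq 0F    = ⟦⟧-cong e eq
  evaluate-cong (e ∷ σ) eq (suc i) = evaluate-cong σ eq i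

  onBranch-cong : ∀ b {α β α′ β′} → α ≈ α′ → β ≈ β′ → onBranch b α β ≋ onBranch b α′ β′
  onBranch-cong b α≈ β≈ a k = ⟦⟧-cong (column a k)
    (evaluate-cong (parametrization b) λ { 0F → α≈ ; 1F → β≈ })

  -- Both parametrizations take the value (2 : 3 : 4) there, with the same representative.
  branches-meet : ∀ b → onBranch b 1# 1# ≋ onBranch conic 1# 1#
  branches-meet conic  a k = refl
  branches-meet linear a k = ⟦⟧-cong (column a k) λ
    { 0F             → ring-≈ [] (:1 :+ :1 , :1 :* (:1 :+ :1))
    ; 1F       → ring-≈ [] (con (+ 2) :* :1 :+ :1 , :1 :* :1 :+ :1 :* :1 :+ :1 :* :1)
    ; 2F → ring-≈ [] (con (+ 2) :* (:1 :+ :1) , (:1 :+ :1) :* (:1 :+ :1)) }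
    where
    :1 : Expr 0
    :1 = con (+ 1)

  mix-0 : ∀ x y → mix 0# x y ≈ x
  mix-0 x y = ring-≈ (x ∷ y ∷ []) λ x y → (con (+ 1) :- con (+ 0)) :* x :+ con (+ 0) :* y , x

  mix-1 : ∀ x y → mix 1# x y ≈ y
  mix-1 x y = ring-≈ (x ∷ y ∷ []) λ x y → (con (+ 1) :- con (+ 1)) :* x :+ con (+ 1) :* y , y

  module _ {Z : Matrix 3 13} (nf : NormalForm Z) where
    open NormalForm nf

    private
      parameters : Carrier → Vec Carrier 2
      parameters t = mix t α 1# ∷ mix t β 1# ∷ []

    -- The admissible parameters and positive column factors form a set that is star-shaped about
    -- the point with all entries 1, so all of them are moved along straight segments.
    pathToBase : Path
    pathToBase = record
      { curve      = λ t a k → mix t (scaling k) 1# * onBranch branch (mix t α 1#) (mix t β 1#) a k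
      ; continuous = λ t a k → continuous-* {f = λ s → mix s (scaling k) 1#}
          (continuous-mix (scaling k) 1#)
          (continuous-⟦⟧ (column a k) (λ s → evaluate (parametrization branch) (parameters s))
            (continuous-evaluate (parametrization branch) parameters
              λ { 0F → continuous-mix α 1# ; 1F → continuous-mix β 1# }))
      ; point      = λ t p q → realization branch (mix-positive p q 0<α 0<1) (mix-positive p q 0<β 0<1)
          (admissible-mix branch 0<α 0<β admissible p q)
          (λ k → mix t (scaling k) 1#) (λ k → mix-positive p q (0<scaling k) 0<1)
      ; on-curve   = λ t p q a k → refl
      }

    start-≋ : Path.curve pathToBase 0# ≋ Z
    start-≋ a k = trans
      (*-cong (mix-0 (scaling k) 1#) (onBranch-cong branch (mix-0 α 1#) (mix-0 β 1#) a k))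
      (sym (normal-form a k))

    end-≋ : matrix base ≋ Path.curve pathToBase 1#
    end-≋ a k = sym (*-cong (mix-1 (scaling k) 1#)
      (trans (onBranch-cong branch (mix-1 α 1#) (mix-1 β 1#) a k) (branches-meet branch a k)))

  module _ {U V : Pred Realization 0ℓ} (U-open : IsOpen U) (V-open : IsOpen V)
           (cover : Universal (U ∪ V)) (disjoint : Empty (U ∩ V)) where

    -- Invariance carries `U` from `X` to its normal form, where the path starts. If `base` were in
    -- `V`, so would be the end of the path, which would then be separated.
    toBase : ∀ X → U X → U base
    toBase X UX with cover base | normalize (matrix X) (realizes X)
    ... | inj₁ U-base | _ = U-base
    ... | inj₂ V-base | A , det≉0 , nf = contradiction
      (proj₁ V-open (≋⇒∼ base (point 1# 0≤1 1≤1) (end-≋ nf)) V-base)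
      (path-not-separated (pathToBase nf) U-open V-open cover disjoint
        (proj₁ U-open {X} (A , det₃-invertible A det≉0 , start-≋ nf) UX))
      where
      open Path (pathToBase nf)

  connected : Connected
  connected (U , V , U-open , V-open , (X , UX) , (Y , VY) , cover , disjoint) =
    disjoint base (toBase U-open V-open cover disjoint X UX ,
                   toBase V-open U-open (λ W → swap (cover W))
                          (λ { W (VW , UW) → disjoint W (UW , VW) }) Y VY)

  -- Non-irreducibility: the branches as zero sets of forms in the brackets

  bracket : Fin 13 → Fin 13 → Fin 13 → Form (Vec (Fin 13) 3) 1
  bracket i j k = var (i ∷ j ∷ k ∷ [])

  minus : ∀ {d} → Form (Vec (Fin 13) 3) d → Form (Vec (Fin 13) 3) d
  minus F = con (- 1#) ⊗ F

  -- Up to one common factor, these are u, w - u and w - v, where (u , v , w)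
  -- are the coordinates of the point 4 in the frame of the points 0, 1, 2, 3.
  Fu Fw-u Fw-v : Form (Vec (Fin 13) 3) 3
  Fu   = bracket (# 0) (# 4) (# 2) ⊗ (bracket (# 0) (# 1) (# 3) ⊗ bracket (# 1) (# 3) (# 2))
  Fw-u = bracket (# 1) (# 3) (# 4) ⊗ (bracket (# 0) (# 1) (# 2) ⊗ bracket (# 0) (# 3) (# 2))
  Fw-v = bracket (# 2) (# 4) (# 3) ⊗ (bracket (# 0) (# 1) (# 2) ⊗ bracket (# 0) (# 1) (# 3))

  -- Each of `Fu`, `Fw-u`, `Fw-v` contains the points 0 to 3 twice and the point 4 once. Column
  -- factors therefore multiply all three by the same `weight`, and their sums stay meaningful.
  linearForm : Form (Vec (Fin 13) 3) 3
  linearForm = Fu ⊕ minus Fw-u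

  -- With `w = u + (w - u)`, the conic reads `(w - v) w - u (w - u)`.
  conicForm : Form (Vec (Fin 13) 3) 6
  conicForm = (Fw-v ⊗ (Fu ⊕ Fw-u)) ⊕ minus (Fu ⊗ Fw-u)

  module _ (Z : Matrix 3 13) (l : Fin 13 → Carrier) (u v w : Carrier)
           (Z≈lY : ∀ a k → Z a k ≈ l k * configuration (u ∷ v ∷ w ∷ []) a k) where

    private
      Y : Matrix 3 13
      Y = configuration (u ∷ v ∷ w ∷ [])

      bracket-value : ∀ i j k e →
        {_ : T (isZero 3 (norm (det₃ᵉ (columnᴱ i) (columnᴱ j) (columnᴱ k) :- e)))} →
        minor Z (i ∷ j ∷ k ∷ []) ≈ l i * l j * l k * ⟦ e ⟧ (u ∷ v ∷ w ∷ [])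
      bracket-value i j k e {z} = trans (minor-det₃ Z i j k)
        (trans (det₃-aligned Z Y i j k (λ a → Z≈lY a i) (λ a → Z≈lY a j) (λ a → Z≈lY a k))
               (*-congˡ (expr-≈ (det₃ᵉ (columnᴱ i) (columnᴱ j) (columnᴱ k)) e (u ∷ v ∷ w ∷ []) z)))

      uᴱ vᴱ wᴱ :1 : Expr 3
      uᴱ = var (# 0)
      vᴱ = var (# 1)
      wᴱ = var (# 2)
      :1 = con (+ 1)

    weight : Carrier
    weight =
      (l (# 0) * l (# 0)) * (l (# 1) * l (# 1)) * (l (# 2) * l (# 2)) * (l (# 3) * l (# 3)) * l (# 4)

    private
      ls : Vec Carrier 8
      ls = l (# 0) ∷ l (# 1) ∷ l (# 2) ∷ l (# 3) ∷ l (# 4) ∷ u ∷ v ∷ w ∷ []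

      Fu-value : eval Fu (minor Z) ≈ weight * u
      Fu-value = trans
        (*-cong (bracket-value (# 0) (# 4) (# 2) uᴱ)
          (*-cong (bracket-value (# 0) (# 1) (# 3) :1) (bracket-value (# 1) (# 3) (# 2) :1)))
        (ring-≈ ls λ a b c d e u v w →
          a :* e :* c :* u :* (a :* b :* d :* con (+ 1) :* (b :* d :* c :* con (+ 1))) ,
          (a :* a) :* (b :* b) :* (c :* c) :* (d :* d) :* e :* u)

      Fw-u-value : eval Fw-u (minor Z) ≈ weight * (w - u)
      Fw-u-value = trans
        (*-cong (bracket-value (# 1) (# 3) (# 4) (wᴱ :- uᴱ))
          (*-cong (bracket-value (# 0) (# 1) (# 2) :1) (bracket-value (# 0) (# 3) (# 2) :1)))
        (ring-≈ ls λ a b c d e u v w →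
          b :* d :* e :* (w :- u) :* (a :* b :* c :* con (+ 1) :* (a :* d :* c :* con (+ 1))) ,
          (a :* a) :* (b :* b) :* (c :* c) :* (d :* d) :* e :* (w :- u))

      Fw-v-value : eval Fw-v (minor Z) ≈ weight * (w - v)
      Fw-v-value = trans
        (*-cong (bracket-value (# 2) (# 4) (# 3) (wᴱ :- vᴱ))
          (*-cong (bracket-value (# 0) (# 1) (# 2) :1) (bracket-value (# 0) (# 1) (# 3) :1)))
        (ring-≈ ls λ a b c d e u v w →
          c :* e :* d :* (w :- v) :* (a :* b :* c :* con (+ 1) :* (a :* b :* d :* con (+ 1))) ,
          (a :* a) :* (b :* b) :* (c :* c) :* (d :* d) :* e :* (w :- v))

    linearForm-value : eval linearForm (minor Z) ≈ weight * ((1# + 1#) * u - w)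
    linearForm-value = trans (+-cong Fu-value (*-congˡ Fw-u-value))
      (ring-≈ (weight ∷ u ∷ w ∷ []) λ l u w →
        l :* u :+ (:- con (+ 1)) :* (l :* (w :- u)) , l :* (con (+ 2) :* u :- w))

    conicForm-value : eval conicForm (minor Z) ≈ weight * weight * (u * u - u * w + w * w - v * w)
    conicForm-value = trans
      (+-cong (*-cong Fw-v-value (+-cong Fu-value Fw-u-value)) (*-congˡ (*-cong Fu-value Fw-u-value)))
      (ring-≈ (weight ∷ u ∷ v ∷ w ∷ []) λ l u v w →
        l :* (w :- v) :* (l :* u :+ l :* (w :- u)) :+ (:- con (+ 1)) :* (l :* u :* (l :* (w :- u))) ,
        l :* l :* (u :* u :- u :* w :+ w :* w :- v :* w))

  eval-cong : ∀ {V d} (F : Form V d) {ρ ρ′} → (∀ v → ρ v ≈ ρ′ v) → eval F ρ ≈ eval F ρ′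
  eval-cong (con c) eq = refl
  eval-cong (var v) eq = eq v
  eval-cong (F ⊕ G) eq = +-cong (eval-cong F eq) (eval-cong G eq)
  eval-cong (F ⊗ G) eq = *-cong (eval-cong F eq) (eval-cong G eq)

  eval-homogeneous : ∀ {V d} (F : Form V d) c ρ → eval F (λ v → c * ρ v) ≈ c ^ d * eval F ρ
  eval-homogeneous (con x) c ρ = sym (*-identityˡ x)
  eval-homogeneous (var v) c ρ = *-congʳ (sym (*-identityʳ c))
  eval-homogeneous (F ⊕ G) c ρ =
    trans (+-cong (eval-homogeneous F c ρ) (eval-homogeneous G c ρ)) (sym (distribˡ _ _ _))
  eval-homogeneous (_⊗_ {d} {e} F G) c ρ = trans
    (*-cong (eval-homogeneous F c ρ) (eval-homogeneous G c ρ))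
    (trans (*-medial _ _ _ _) (*-congʳ (sym (^-homo-* c d e))))

  ^-≉0 : ∀ {c} n → c ≉ 0# → c ^ n ≉ 0#
  ^-≉0 zero    c≉0 = positive⇒≉0 0<1
  ^-≉0 (suc n) c≉0 = *-≉0 c≉0 (^-≉0 n c≉0)

  -- Passing to `A ⊡ X` multiplies all minors by the determinant of `A`, hence a form of degree `d`
  -- by the `d`-th power of it.
  vanishes-⊡ : ∀ {d} (F : Form (Vec (Fin 13) 3) d) (A : Matrix 3 3) (X : Matrix 3 13) →
    det₃ (col A (# 0)) (col A (# 1)) (col A (# 2)) ≉ 0# →
    eval F (minor (A ⊡ X)) ≈ 0# → eval F (minor X) ≈ 0#
  vanishes-⊡ {d} F A X det≉0 F≈0 = *-cancel-≈0 (^-≉0 d det≉0)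
    (trans (sym (eval-homogeneous F _ (minor X))) (trans (sym (eval-cong F (minor-⊡ A X))) F≈0))

  linearPart conicPart : Pred Realization 0ℓ
  linearPart X = eval linearForm (minor (matrix X)) ≈ 0#
  conicPart  X = eval conicForm  (minor (matrix X)) ≈ 0#

  linearPart-closed : ZariskiClosed linearPart
  linearPart-closed = ⊤ , (λ _ → 3 , linearForm) , λ X → mk⇔ (λ z _ → z) (λ f → f tt)

  conicPart-closed : ZariskiClosed conicPart
  conicPart-closed = ⊤ , (λ _ → 6 , conicForm) , λ X → mk⇔ (λ z _ → z) (λ f → f tt)

  parts-cover : Universal (linearPart ∪ conicPart)
  parts-cover X with normalize (matrix X) (realizes X)
  ... | A , det≉0 , record { branch = linear ; α = α ; β = β ; scaling = l ; normal-form = eq } =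
    inj₁ (vanishes-⊡ linearForm A (matrix X) det≉0 (trans
      (linearForm-value (A ⊡ matrix X) l _ _ _ eq)
      (trans (*-congˡ (ring-≈ (α ∷ β ∷ []) λ α β →
                con (+ 2) :* (α :+ β) :- con (+ 2) :* (α :+ β) , con (+ 0)))
             (zeroʳ _))))
  ... | A , det≉0 , record { branch = conic ; α = α ; β = β ; scaling = l ; normal-form = eq } =
    inj₂ (vanishes-⊡ conicForm A (matrix X) det≉0 (trans
      (conicForm-value (A ⊡ matrix X) l _ _ _ eq)
      (trans (*-congˡ (ring-≈ (α ∷ β ∷ []) λ α β →
                let u = α :* (α :+ β)
                    v = α :* α :+ α :* β :+ β :* β
                    w = (α :+ β) :* (α :+ β)
                in u :* u :- u :* w :+ w :* w :- v :* w , con (+ 0)))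
             (zeroʳ _))))

  private
    0<2 : 0# < 1# + 1#
    0<2 = +-positive 0<1 0<1

    ones : Fin 13 → Carrier
    ones _ = 1#

    weight-1≉0 : ∀ (Z : Matrix 3 13) u v w eq → weight Z ones u v w eq ≉ 0#
    weight-1≉0 Z u v w eq w≈0 = positive⇒≉0 0<1 (trans
      (ring-≈ [] (:1 , (:1 :* :1) :* (:1 :* :1) :* (:1 :* :1) :* (:1 :* :1) :* :1)) w≈0)
      where
      :1 : Expr 0
      :1 = con (+ 1)

    -- The branches meet where `α = β`, so a pair with `α` different from `β` separates them. For (1
    -- , 2) the triples are (3 : 4 : 6) on the axis, where the conic has the value 3, and (3 : 7 :
    -- 9) on the conic, where `2u - w` is -3.
    onLine onConic : Realization
    onLine  = realization linear 0<1 0<2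
      (<-respʳ (ring-≈ [] (con (+ 5) ,
        con (+ 2) :* con (+ 2) :+ con (+ 1) :* con (+ 2) :- con (+ 1) :* con (+ 1)))
               (ℕ→R-positive 4)) ones (λ _ → 0<1)
    onConic = realization conic 0<1 0<2 tt ones (λ _ → 0<1)

  linearPart-proper : Proper linearPart
  linearPart-proper all = positive⇒≉0 (ℕ→R-positive 2) (trans
    (ring-≈ [] (con (+ 3) , :- (con (+ 2) :* u :- w)))
    (trans (-‿cong (*-cancel-≈0 (weight-1≉0 (matrix onConic) _ _ _ (λ a k → refl))
      (trans (sym (linearForm-value (matrix onConic) ones _ _ _ (λ a k → refl))) (all onConic)))) -0#≈0#))
    where
    u w : Expr 0
    u = con (+ 1) :* (con (+ 1) :+ con (+ 2))
    w = (con (+ 1) :+ con (+ 2)) :* (con (+ 1) :+ con (+ 2))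

  conicPart-proper : Proper conicPart
  conicPart-proper all = positive⇒≉0 (ℕ→R-positive 2) (trans
    (ring-≈ [] (con (+ 3) , u :* u :- u :* w :+ w :* w :- v :* w))
    (*-cancel-≈0 (*-≉0 weight≉0 weight≉0)
      (trans (sym (conicForm-value (matrix onLine) ones _ _ _ (λ a k → refl))) (all onLine))))
    where
    weight≉0 = weight-1≉0 (matrix onLine) _ _ _ (λ a k → refl)
    u v w : Expr 0
    u = con (+ 1) :+ con (+ 2)
    v = con (+ 2) :* con (+ 1) :+ con (+ 2)
    w = con (+ 2) :* (con (+ 1) :+ con (+ 2))

  not-irreducible : ¬ Irreducible
  not-irreducible irreducible = irreducible
    (linearPart , conicPart , linearPart-closed , conicPart-closed ,
     linearPart-proper , conicPart-proper , parts-cover)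

theorem1p4 : (ℝ : CompleteOrderedField) →
    Σ (OrientedMatroid 3 13) λ M →
    RealizationSpace.Connected ℝ M × ¬ RealizationSpace.Irreducible ℝ M
theorem1p4 ℝ = matroid , connected , not-irreducible
  where
  open Realizability ℝ using (matroid)
  open Geometry ℝ
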